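{- There is an algorithm which, given an instance of \textsc{Min Stable Cut} with $n$ vertices, maximum weight $W$, maximum degree $\Delta$, and a tree decomposition of width $\mathrm{tw}$ of the input graph, finds an optimal solution in time $2^{O(\Delta\cdot\mathrm{tw})}(n+\log W)^{O(1)}$.
   Context: Let $G=(V,E)$ be a finite simple graph with edge weights $w:E\to\mathbb{N}$ (given in binary). The weighted degree of $v\in V$ is $d_w(v)=\sum_{uv\in E}w(uv)$. A cut is a partition of $V$ into $V_0,V_1$. It is stable for $v\in V_i$ ($i\in\{0,1\}$) if $\sum_{vu\in E,\,u\in V_{1-i}}w(vu)\ge d_w(v)/2$; it is stable if it is stable for all vertices. The weight of the cut is the sum of the weights of edges with one endpoint in $V_0$ and the other in $V_1$. \textsc{Min Stable Cut}: given $(G,w)$, find a stable cut of minimum weight. Maximum degree means the maximum unweighted degree (number of incident edges); maximum weight means $\max_{e\in E}w(e)$. -}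

module Defs where

open import Algebra.Properties.CommutativeMonoid.Sum using (sum)
open import Data.Bool using (Bool; true; false; if_then_else_; _∧_; _xor_)
open import Data.Fin using (Fin; zero; suc; _<?_)
open import Data.Fin.Subset using (Subset; _∈_; ∣_∣)
open import Data.List using (List; []; _∷_; _++_; length; lookup; map; tabulate)
open import Data.List.Extrema.Nat using (max)
open import Data.Maybe using (Maybe; just; nothing; fromMaybe; is-just)
open import Data.Nat using (ℕ; suc; _+_; _*_; _∸_; _≤_)
open import Data.Nat.Binary using (ℕᵇ; 2[1+_]; 1+[2_]; fromℕ) renaming (zero to 0ᵇ)
open import Data.Nat.Properties using (+-0-commutativeMonoid)
open import Data.Product using (∃-syntax; _×_)
import Data.Vec as Vec
open import Data.Vec using (Vec)
open import Relation.Binary.Construct.Closure.Equivalence using (EqClosure)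
open import Relation.Binary.PropositionalEquality using (_≡_)
open import Relation.Nullary using (does)

sumFin : ∀ {n} → (Fin n → ℕ) → ℕ
sumFin = sum +-0-commutativeMonoid

maxFin : ∀ {n} → (Fin n → ℕ) → ℕ
maxFin f = max 0 (tabulate f)

-- `edge u v ≡ just k` says that uv ∈ E and w(uv) = k (k = 0 is allowed);
-- `edge u v ≡ nothing` says that uv ∉ E.
record WeightedGraph (n : ℕ) : Set where
  field
    edge      : Fin n → Fin n → Maybe ℕ
    symmetric : ∀ u v → edge u v ≡ edge v u
    loopless  : ∀ v → edge v v ≡ nothing

  IsEdge : Fin n → Fin n → Set
  IsEdge u v = ∃[ k ] edge u v ≡ just k

  -- The weight of an edge, extended by 0 to non-edges.
  weight : Fin n → Fin n → ℕ
  weight u v = fromMaybe 0 (edge u v)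

  degree : Fin n → ℕ
  degree v = sumFin λ u → if is-just (edge v u) then 1 else 0

  weightedDegree : Fin n → ℕ
  weightedDegree v = sumFin λ u → weight v u

  maxDegree : ℕ
  maxDegree = maxFin degree

  maxWeight : ℕ
  maxWeight = maxFin λ u → maxFin λ v → weight u v

-- The partition V₀ = {v | S v ≡ false}, V₁ = {v | S v ≡ true}; a side may be empty.
Cut : ℕ → Set
Cut n = Fin n → Bool

module _ {n : ℕ} (G : WeightedGraph n) where
  open WeightedGraph G

  crossingDegree : Cut n → Fin n → ℕ
  crossingDegree S v = sumFin λ u → if S v xor S u then weight v u else 0

  -- crossingDegree ≥ d_w(v) / 2, cleared of the denominator.
  StableAt : Cut n → Fin n → Set
  StableAt S v = weightedDegree v ≤ 2 * crossingDegree S v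

  Stable : Cut n → Set
  Stable S = ∀ v → StableAt S v

  -- Each edge uv is counted once, from its smaller endpoint.
  cutWeight : Cut n → ℕ
  cutWeight S = sumFin λ u → sumFin λ v →
    if does (u <? v) ∧ (S u xor S v) then weight u v else 0

  IsMinStableCut : Cut n → Set
  IsMinStableCut S = Stable S × (∀ S′ → Stable S′ → cutWeight S ≤ cutWeight S′)

-- Finite nonempty trees, presented with a chosen root.
data Tree (A : Set) : Set where
  node : A → List (Tree A) → Tree A

module _ {A : Set} where
  data Node : Tree A → Set where
    root  : ∀ {t} → Node t
    below : ∀ {a ts} (i : Fin (length ts)) → Node (lookup ts i) → Node (node a ts)

  data Child : {t : Tree A} → Node t → Node t → Set where
    here  : ∀ {a ts} (i : Fin (length ts)) →
            Child {node a ts} root (below i root)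
    there : ∀ {a ts} (i : Fin (length ts)) {x y : Node (lookup ts i)} →
            Child x y → Child {node a ts} (below i x) (below i y)

  label : {t : Tree A} → Node t → A
  label {node a _} root        = a
  label            (below _ x) = label x

  mutual
    labels : Tree A → List A
    labels (node a ts) = a ∷ labels* ts

    labels* : List (Tree A) → List A
    labels* []       = []
    labels* (t ∷ ts) = labels t ++ labels* ts

record TreeDecomposition {n : ℕ} (G : WeightedGraph n) : Set where
  open WeightedGraph G
  field
    tree : Tree (Subset n)

  bag : Node tree → Subset n
  bag = label

  field
    coversVertices : ∀ v → ∃[ x ] v ∈ bag x
    coversEdges    : ∀ u v → IsEdge u v → ∃[ x ] (u ∈ bag x × v ∈ bag x)
    -- The nodes whose bags contain v induce a connected subgraph of the tree.
    connected      : ∀ v x y → v ∈ bag x → v ∈ bag y →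
                     EqClosure (λ x′ y′ → Child x′ y′ × v ∈ bag x′ × v ∈ bag y′) x y

  numNodes : ℕ
  numNodes = length (labels tree)

  width : ℕ
  width = max 0 (map ∣_∣ (labels tree)) ∸ 1

-- The model of computation is a pure Lisp: untyped call-by-value recursive
-- functions over cons cells, with de Bruijn variables.  `case` binds the head
-- as variable 0 and the tail as variable 1; `fun` binds its argument as
-- variable 0 and itself as variable 1.
data Term (m : ℕ) : Set where
  var  : Fin m → Term m
  nil  : Term m
  cons : Term m → Term m → Term m
  case : Term m → Term m → Term (2 + m) → Term m
  fun  : Term (2 + m) → Term m
  app  : Term m → Term m → Term m

data Value : Set where
  nil     : Value
  cons    : Value → Value → Value
  closure : ∀ {m} → Vec Value m → Term (2 + m) → Value

-- ρ ⊢ e ⇓ v ∣ t : in environment ρ, e evaluates to v in t steps, one for each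
-- rule applied.  For a fixed program every rule takes constant time on a
-- machine that represents values by pointers (environments have bounded
-- length), so this measure is polynomially related to Turing machine time.
infix 4 _⊢_⇓_∣_
data _⊢_⇓_∣_ {m : ℕ} (ρ : Vec Value m) : Term m → Value → ℕ → Set where
  ⇓var  : ∀ {i} → ρ ⊢ var i ⇓ Vec.lookup ρ i ∣ 1
  ⇓nil  : ρ ⊢ nil ⇓ nil ∣ 1
  ⇓cons : ∀ {e₁ e₂ v₁ v₂ t₁ t₂} →
          ρ ⊢ e₁ ⇓ v₁ ∣ t₁ → ρ ⊢ e₂ ⇓ v₂ ∣ t₂ →
          ρ ⊢ cons e₁ e₂ ⇓ cons v₁ v₂ ∣ suc (t₁ + t₂)
  ⇓case-nil  : ∀ {e e₁ e₂ v t t₁} →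
               ρ ⊢ e ⇓ nil ∣ t → ρ ⊢ e₁ ⇓ v ∣ t₁ →
               ρ ⊢ case e e₁ e₂ ⇓ v ∣ suc (t + t₁)
  ⇓case-cons : ∀ {e e₁ e₂ v₁ v₂ v t t₂} →
               ρ ⊢ e ⇓ cons v₁ v₂ ∣ t → v₁ Vec.∷ v₂ Vec.∷ ρ ⊢ e₂ ⇓ v ∣ t₂ →
               ρ ⊢ case e e₁ e₂ ⇓ v ∣ suc (t + t₂)
  ⇓fun  : ∀ {e} → ρ ⊢ fun e ⇓ closure ρ e ∣ 1
  ⇓app  : ∀ {m′ e₁ e₂ e v₂ v t₁ t₂ t} {ρ′ : Vec Value m′} →
          ρ ⊢ e₁ ⇓ closure ρ′ e ∣ t₁ → ρ ⊢ e₂ ⇓ v₂ ∣ t₂ →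
          v₂ Vec.∷ closure ρ′ e Vec.∷ ρ′ ⊢ e ⇓ v ∣ t →
          ρ ⊢ app e₁ e₂ ⇓ v ∣ suc (t₁ + t₂ + t)

-- The single free variable is the input.
Program : Set
Program = Term 1

_on_returns_in-time_ : Program → Value → Value → ℕ → Set
p on x returns y in-time t = x Vec.∷ Vec.[] ⊢ p ⇓ y ∣ t

encodeList : List Value → Value
encodeList []       = nil
encodeList (v ∷ vs) = cons v (encodeList vs)

encodeBool : Bool → Value
encodeBool false = nil
encodeBool true  = cons nil nil

encodeMaybe : Maybe Value → Value
encodeMaybe nothing  = nil
encodeMaybe (just v) = cons v nil

-- Least significant digit first, in the bijective base-2 numeration of ℕᵇ, so
-- the encoding of k has O(1 + log k) cells.
encodeℕᵇ : ℕᵇ → Value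
encodeℕᵇ 0ᵇ       = nil
encodeℕᵇ 2[1+ b ] = cons (encodeBool false) (encodeℕᵇ b)
encodeℕᵇ 1+[2 b ] = cons (encodeBool true) (encodeℕᵇ b)

encodeℕ : ℕ → Value
encodeℕ k = encodeℕᵇ (fromℕ k)

encodeSubset : ∀ {n} → Subset n → Value
encodeSubset s = encodeList (map encodeBool (Vec.toList s))

mutual
  encodeTree : ∀ {n} → Tree (Subset n) → Value
  encodeTree (node s ts) = cons (encodeSubset s) (encodeTrees ts)

  encodeTrees : ∀ {n} → List (Tree (Subset n)) → Value
  encodeTrees []       = nil
  encodeTrees (t ∷ ts) = cons (encodeTree t) (encodeTrees ts)

-- The weighted adjacency matrix, row by row.
encodeGraph : ∀ {n} → WeightedGraph n → Value
encodeGraph G = encodeList (tabulate λ u → encodeList (tabulate λ v →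
  encodeMaybe (Data.Maybe.map encodeℕ (WeightedGraph.edge G u v))))

encodeInstance : ∀ {n} (G : WeightedGraph n) → TreeDecomposition G → Value
encodeInstance G D = cons (encodeGraph G) (encodeTree (TreeDecomposition.tree D))

encodeCut : ∀ {n} → Cut n → Value
encodeCut S = encodeList (tabulate λ v → encodeBool (S v))

{-# OPTIONS --safe #-}

-- The classical dynamic program over the tree decomposition, with tables indexed
-- by the cuts of the boundary P of a bag B, that is, the ends of the edges that
-- meet B; as |P| ≤ 2Δ|B|, a table has 2^O(Δ·tw) entries.  An edge uv with u
-- below the bag and v not has u in B, so both ends are in P.  Hence whether a vertex
-- below the bag is stable depends only on the cut below the bag and on P, and an
-- entry can be replaced by any cheaper one that agrees with it on P.  The cost of a
-- cut is the sum of the crossing degrees, twice its weight, which splits over the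
-- vertices.  A stable cut exists since local search for a cut of maximal weight ends.
--
-- The program is written in a small typed language in which the Agda meaning and the
-- exact running time of the compiled term are both given by recursion on syntax.
-- With M = (2 + n + log W)³ · 2^(4Δ·tw), every list that occurs has length polynomial
-- in M, so the time per node is M^O(1).
module Submission where

open import Defs
open import Algebra.Properties.CommutativeMonoid.Sum using (sum-cong-≗; ∑-distrib-+; ∑-comm; sum-remove)
open import Data.Bool using (Bool; true; false; if_then_else_; not; _∧_; _∨_; _xor_)
open import Data.Bool.Properties using (xor-comm; xor-same; ∨-zeroʳ)
open import Data.Empty using (⊥-elim; ⊥)
open import Data.Fin using (Fin; zero; suc; punchIn; punchOut)
open import Data.Fin.Patterns using (0F; 1F; 2F; 3F; 4F; 5F; 6F; 7F; 8F; 9F)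
open import Data.Fin.Properties using (punchInᵢ≢i; all?; ¬∀⟶∃¬; punchIn-punchOut) renaming (_≟_ to _≟ᶠ_; <-cmp to <ᶠ-cmp)
open import Data.Fin.Subset using (Subset; ∣_∣)
open import Data.List using (List; []; _∷_; length; map; lookup; _++_; tabulate)
open import Data.List.Extrema.Nat using (xs≤max; max≤v⁺)
open import Data.List.Membership.Propositional using (_∈_)
open import Data.List.Membership.Propositional.Properties using (∈-++⁺ˡ; ∈-++⁺ʳ; ∈-map⁺)
open import Data.List.Properties using (length-++; length-map; length-tabulate; tabulate-cong; ++-identityʳ; map-tabulate; ∷-injectiveˡ)
open import Data.List.Relation.Unary.All as All using (All; []; _∷_)
open import Data.List.Relation.Unary.All.Properties using (++⁻ˡ; ++⁻ʳ; tabulate⁻; tabulate⁺) renaming (map⁻ to All-map⁻)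
open import Data.List.Relation.Unary.Any using (here; there)
open import Data.Maybe using (Maybe; just; nothing; fromMaybe; is-just)
open import Data.Nat using (ℕ; zero; suc; _+_; _*_; _^_; _≤_; z≤n; s≤s; >-nonZero; _<_)
open import Data.Nat.Binary using (ℕᵇ; 2[1+_]; 1+[2_]; fromℕ) renaming (zero to 0ᵇ; toℕ to valᵇ)
open import Data.Nat.Binary.Properties using (toℕ-fromℕ)
open import Data.Nat.Logarithm using (⌈log₂_⌉; ⌈log₂⌉-mono-≤; ⌈log₂2^n⌉≡n)
open import Data.Nat.Properties
open import Data.Nat.Tactic.RingSolver using (solve-∀)
open import Data.Product using (Σ; ∃-syntax; _×_; _,_; proj₁; proj₂)
open import Data.Sum using (_⊎_; inj₁; inj₂; [_,_]′)
open import Data.Unit using (⊤; tt)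
open import Data.Vec using (Vec; _∷_; [])
import Data.Vec as Vec
open import Data.Vec.Properties using ([]=⇒lookup; lookup⇒[]=)
open import Function using (_∘_; id)
open import Relation.Binary.Construct.Closure.Equivalence using (EqClosure) renaming (symmetric to EqClosure-sym)
open import Relation.Binary.Construct.Closure.ReflexiveTransitive using (ε; _◅_; _◅◅_)
open import Relation.Binary.Construct.Closure.Symmetric using (fwd; bwd)
open import Relation.Binary.Definitions using (tri<; tri≈; tri>)
open import Relation.Binary.PropositionalEquality
open import Relation.Nullary using (¬_; Reflects; ofʸ; ofⁿ; does; yes; no)
open import Relation.Nullary.Decidable using (dec-true; dec-false)

-- A first-order language of lists and its compilation

-- Nothing is claimed about the individual entries of a table. Their stability and cost on the
-- vertices below the bag are computed afresh whenever a table is pruned, and once more at the end,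
-- so a useless entry does no harm. The only invariant is an exchange property: every stable cut can
-- be overwritten, below the bag, by some entry that agrees with it on the boundary, and it stays
-- stable and becomes no more costly. As this holds for every stable cut, two tables are combined by
-- using it twice: the cut improved by the first table is handed to the second.
--
-- The tree is consumed one child at a time while the root bag stays in place, so that all joins are
-- binary whatever the shape of the tree.
--
-- The exponent is Δ·tw and not Δ·(tw + 1), which matters when tw = 0: there are then no edges at
-- all, and the table must have a single entry. It does, since the boundary consists of ends of
-- edges and leaves out isolated vertices of the bag.

infixr 6 _⊗_
data Ty : Set where
  bool : Ty
  list : Ty → Ty
  _⊗_  : Ty → Ty → Ty

⟦_⟧ : Ty → Set
⟦ bool ⟧   = Bool
⟦ list τ ⟧ = List ⟦ τ ⟧
⟦ σ ⊗ τ ⟧  = ⟦ σ ⟧ × ⟦ τ ⟧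

enc : ∀ τ → ⟦ τ ⟧ → Value
enc bool     b       = encodeBool b
enc (list τ) xs      = encodeList (map (enc τ) xs)
enc (σ ⊗ τ)  (x , y) = cons (enc σ x) (enc τ y)

Ctx : Set
Ctx = List Ty

Env : Ctx → Set
Env []      = ⊤
Env (τ ∷ Γ) = ⟦ τ ⟧ × Env Γ

encEnv : ∀ Γ → Env Γ → Value
encEnv []      _       = nil
encEnv (τ ∷ Γ) (x , γ) = cons (enc τ x) (encEnv Γ γ)

get : ∀ {Γ} (i : Fin (length Γ)) → Env Γ → ⟦ lookup Γ i ⟧
get {τ ∷ Γ} zero    (x , _) = x
get {τ ∷ Γ} (suc i) (_ , γ) = get i γ

infixr 5 _∷_
mutual
  -- In `rec xs p (loop base next step)` the recursive call on the tail of xs is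
  -- made once, on the parameter computed by `next`, and `step` receives its
  -- result as variable 0.
  data Exp (Γ : Ctx) : Ty → Set where
    var           : ∀ i → Exp Γ (lookup Γ i)
    lit           : Bool → Exp Γ bool
    ifᵉ_then_else_ : ∀ {τ} → Exp Γ bool → Exp Γ τ → Exp Γ τ → Exp Γ τ
    []            : ∀ {τ} → Exp Γ (list τ)
    _∷_           : ∀ {τ} → Exp Γ τ → Exp Γ (list τ) → Exp Γ (list τ)
    caseList      : ∀ {σ τ} → Exp Γ (list σ) → Exp Γ τ → Exp (σ ∷ list σ ∷ Γ) τ → Exp Γ τ
    pair          : ∀ {σ τ} → Exp Γ σ → Exp Γ τ → Exp Γ (σ ⊗ τ)
    fst           : ∀ {σ τ} → Exp Γ (σ ⊗ τ) → Exp Γ σ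
    snd           : ∀ {σ τ} → Exp Γ (σ ⊗ τ) → Exp Γ τ
    rec           : ∀ {σ π τ} → Exp Γ (list σ) → Exp Γ π → Loop Γ σ π τ → Exp Γ τ
    call          : ∀ {Δ τ} → Exp Δ τ → Exps Γ Δ → Exp Γ τ

  data Loop (Γ : Ctx) (σ π τ : Ty) : Set where
    loop : Exp (π ∷ Γ) τ → Exp (σ ∷ list σ ∷ π ∷ Γ) π → Exp (τ ∷ σ ∷ list σ ∷ π ∷ Γ) τ →
           Loop Γ σ π τ

  data Exps (Γ : Ctx) : Ctx → Set where
    []  : Exps Γ []
    _∷_ : ∀ {τ Δ} → Exp Γ τ → Exps Γ Δ → Exps Γ (τ ∷ Δ)

matchList : ∀ {A C : Set} → List A → C → (A → List A → C) → C
matchList []       c f = c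
matchList (x ∷ xs) c f = f x xs

mutual
  eval : ∀ {Γ τ} → Exp Γ τ → Env Γ → ⟦ τ ⟧
  eval (var i)              γ = get i γ
  eval (lit b)              γ = b
  eval (ifᵉ c then a else b) γ = if eval c γ then eval a γ else eval b γ
  eval []                   γ = []
  eval (e ∷ es)             γ = eval e γ ∷ eval es γ
  eval (caseList e a b)     γ = matchList (eval e γ) (eval a γ) λ x xs → eval b (x , xs , γ)
  eval (pair a b)           γ = eval a γ , eval b γ
  eval (fst e)              γ = proj₁ (eval e γ)
  eval (snd e)              γ = proj₂ (eval e γ)
  eval (rec xs p ℓ)     γ = evalRec ℓ γ (eval xs γ) (eval p γ)
  eval (call f es)          γ = eval f (evals es γ)

  evals : ∀ {Γ Δ} → Exps Γ Δ → Env Γ → Env Δ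
  evals []       γ = tt
  evals (e ∷ es) γ = eval e γ , evals es γ

  evalRec : ∀ {Γ σ π τ} → Loop Γ σ π τ → Env Γ → List ⟦ σ ⟧ → ⟦ π ⟧ → ⟦ τ ⟧
  evalRec (loop b n s) γ []       p = eval b (p , γ)
  evalRec (loop b n s) γ (x ∷ xs) p =
    eval s (evalRec (loop b n s) γ xs (eval n (x , xs , p , γ)) , x , xs , p , γ)

varCost : ∀ {k} → Fin k → ℕ
varCost zero    = 0
varCost (suc i) = 2 + varCost i

mutual
  cost : ∀ {Γ τ} → Exp Γ τ → Env Γ → ℕ
  cost (var i)              γ = varCost i + 3
  cost (lit false)          γ = 1
  cost (lit true)           γ = 3
  cost (ifᵉ c then a else b) γ = suc (cost c γ + (if eval c γ then 3 + cost a γ else cost b γ))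
  cost []                   γ = 1
  cost (e ∷ es)             γ = suc (cost e γ + cost es γ)
  cost (caseList e a b)     γ = suc (cost e γ +
    matchList (eval e γ) (cost a γ) λ x xs → 7 + cost b (x , xs , γ))
  cost (pair a b)           γ = suc (cost a γ + cost b γ)
  cost (fst e)              γ = suc (cost e γ + 1)
  cost (snd e)              γ = suc (cost e γ + 1)
  cost (rec xs p ℓ)     γ =
    2 + (suc (cost xs γ + cost p γ) + costRec ℓ γ (eval xs γ) (eval p γ))
  cost (call f es)          γ = 2 + (costs es γ + cost f (evals es γ))

  costs : ∀ {Γ Δ} → Exps Γ Δ → Env Γ → ℕ
  costs []       γ = 1
  costs (e ∷ es) γ = suc (cost e γ + costs es γ)

  costRec : ∀ {Γ σ π τ} → Loop Γ σ π τ → Env Γ → List ⟦ σ ⟧ → ⟦ π ⟧ → ℕ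
  costRec (loop b n s) γ []       p = 9 + cost b (p , γ)
  costRec (loop b n s) γ (x ∷ xs) p =
    let p′ = eval n (x , xs , p , γ) in
    6 + (suc (13 + cost n (x , xs , p , γ) + costRec (loop b n s) γ xs p′ + 7) +
      cost s (evalRec (loop b n s) γ xs p′ , x , xs , p , γ))

walk : ∀ {k m} → Fin k → Term m → Term m
walk zero    e = case e nil (var 0F)
walk (suc i) e = walk i (case e nil (var 1F))

-- A compiled expression finds its whole environment, as one list, in variable 0.
mutual
  compile : ∀ {Γ τ m} → Exp Γ τ → Term (suc m)
  compile (var i)              = walk i (var 0F)
  compile (lit false)          = nil
  compile (lit true)           = cons nil nil
  -- `case` binds two variables in front of the environment; applying a function to `var 2F` moves
  -- the environment back to variable 0. This detour is the 3 in the `cost` of the true branch.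
  compile (ifᵉ c then a else b) = case (compile c) (compile b) (app (fun (compile a)) (var 2F))
  compile []                   = nil
  compile (e ∷ es)             = cons (compile e) (compile es)
  compile (caseList e a b)     =
    case (compile e) (compile a)
         (app (fun (compile b)) (cons (var 0F) (cons (var 1F) (var 2F))))
  compile (pair a b)           = cons (compile a) (compile b)
  compile (fst e)              = case (compile e) nil (var 0F)
  compile (snd e)              = case (compile e) nil (var 1F)
  compile (rec xs p ℓ)     =
    app (fun (recBody ℓ)) (cons (compile xs) (compile p))
  compile (call f es)          = app (fun (compile f)) (compiles es)

  compiles : ∀ {Γ Δ m} → Exps Γ Δ → Term (suc m)
  compiles []       = nil
  compiles (e ∷ es) = cons (compile e) (compiles es)

  recBody : ∀ {Γ σ π τ m} → Loop Γ σ π τ → Term (3 + m)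
  -- The argument is the pair of list and parameter. After the outer `case`, variables 0 to 4 are
  -- the list, the parameter, the argument, the function itself and the environment; the inner
  -- `case` puts head and tail in front of them.
  recBody (loop b n s) = case (var 0F) nil (case (var 0F)
    (app (fun (compile b)) (cons (var 1F) (var 4F)))
    (app (fun (compile s))
         (cons (app (var 5F) (cons (var 1F) (app (fun (compile n)) recEnv))) recEnv)))
    where
    recEnv : ∀ {m} → Term (7 + m)
    recEnv = cons (var 0F) (cons (var 1F) (cons (var 3F) (var 6F)))

-- Correctness of the compilation, with exact running times

⇓≡ : ∀ {m} {ρ : Vec Value m} {e v t u} → t ≡ u → ρ ⊢ e ⇓ v ∣ t → ρ ⊢ e ⇓ v ∣ u
⇓≡ refl d = d

walk-⇓ : ∀ {Γ m} {ρ : Vec Value m} {e t} (i : Fin (length Γ)) (γ : Env Γ) →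
         ρ ⊢ e ⇓ encEnv Γ γ ∣ t → ρ ⊢ walk i e ⇓ enc (lookup Γ i) (get i γ) ∣ varCost i + (2 + t)
walk-⇓ {τ ∷ Γ} {t = t} zero    (x , γ) d = ⇓≡ (cong suc (+-comm t 1)) (⇓case-cons d ⇓var)
walk-⇓ {τ ∷ Γ} {t = t} (suc i) (x , γ) d =
  ⇓≡ (eq (varCost i) t) (walk-⇓ i γ (⇓case-cons d ⇓var))
  where
  eq : ∀ a t → a + (2 + suc (t + 1)) ≡ 2 + a + (2 + t)
  eq = solve-∀

mutual
  compile-⇓ : ∀ {Γ τ m} (e : Exp Γ τ) (γ : Env Γ) {ρ : Vec Value m} →
              encEnv Γ γ ∷ ρ ⊢ compile e ⇓ enc τ (eval e γ) ∣ cost e γ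
  compile-⇓ (var i) γ = walk-⇓ i γ ⇓var
  compile-⇓ (lit false) γ = ⇓nil
  compile-⇓ (lit true) γ = ⇓cons ⇓nil ⇓nil
  compile-⇓ (ifᵉ c then a else b) γ {ρ} with eval c γ | compile-⇓ c γ {ρ}
  ... | true  | d = ⇓case-cons d (⇓app ⇓fun ⇓var (compile-⇓ a γ))
  ... | false | d = ⇓case-nil d (compile-⇓ b γ)
  compile-⇓ [] γ = ⇓nil
  compile-⇓ (e ∷ es) γ = ⇓cons (compile-⇓ e γ) (compile-⇓ es γ)
  compile-⇓ (caseList e a b) γ {ρ} with eval e γ | compile-⇓ e γ {ρ}
  ... | []     | d = ⇓case-nil d (compile-⇓ a γ)
  ... | x ∷ xs | d =
    ⇓case-cons d (⇓app ⇓fun (⇓cons ⇓var (⇓cons ⇓var ⇓var)) (compile-⇓ b (x , xs , γ)))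
  compile-⇓ (pair a b) γ = ⇓cons (compile-⇓ a γ) (compile-⇓ b γ)
  compile-⇓ (fst e) γ = ⇓case-cons (compile-⇓ e γ) ⇓var
  compile-⇓ (snd e) γ = ⇓case-cons (compile-⇓ e γ) ⇓var
  compile-⇓ (rec xs p ℓ) γ =
    ⇓app ⇓fun (⇓cons (compile-⇓ xs γ) (compile-⇓ p γ)) (recBody-⇓ ℓ γ (eval xs γ) (eval p γ))
  compile-⇓ (call f es) γ = ⇓app ⇓fun (compiles-⇓ es γ) (compile-⇓ f (evals es γ))

  compiles-⇓ : ∀ {Γ Δ m} (es : Exps Γ Δ) (γ : Env Γ) {ρ : Vec Value m} →
               encEnv Γ γ ∷ ρ ⊢ compiles es ⇓ encEnv Δ (evals es γ) ∣ costs es γ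
  compiles-⇓ [] γ = ⇓nil
  compiles-⇓ (e ∷ es) γ = ⇓cons (compile-⇓ e γ) (compiles-⇓ es γ)

  recBody-⇓ : ∀ {Γ σ π τ m} (ℓ : Loop Γ σ π τ) (γ : Env Γ) xs p {ρ : Vec Value m} →
              cons (enc (list σ) xs) (enc π p) ∷ closure (encEnv Γ γ ∷ ρ) (recBody ℓ)
                ∷ encEnv Γ γ ∷ ρ
                ⊢ recBody ℓ ⇓ enc τ (evalRec ℓ γ xs p) ∣ costRec ℓ γ xs p
  recBody-⇓ (loop b n s) γ [] p =
    ⇓case-cons ⇓var (⇓case-nil ⇓var (⇓app ⇓fun (⇓cons ⇓var ⇓var) (compile-⇓ b (p , γ))))
  recBody-⇓ (loop b n s) γ (x ∷ xs) p =
    ⇓case-cons ⇓var (⇓case-cons ⇓var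
      (⇓app ⇓fun
        (⇓cons (⇓app ⇓var (⇓cons ⇓var (⇓app ⇓fun ⇓recEnv (compile-⇓ n (x , xs , p , γ))))
                 (recBody-⇓ (loop b n s) γ xs _))
               ⇓recEnv)
        (compile-⇓ s (_ , x , xs , p , γ))))
    where
    ⇓recEnv = ⇓cons ⇓var (⇓cons ⇓var (⇓cons ⇓var ⇓var))

-- Time bounds

-- Both branches of a conditional are included, so `bound` need not know the data.
mutual
  Calls : ∀ {Γ τ} → Exp Γ τ → Env Γ → ℕ → Set
  Calls (var i)               γ B = ⊤
  Calls (lit b)               γ B = ⊤
  Calls (ifᵉ c then a else b) γ B = Calls c γ B × Calls a γ B × Calls b γ B
  Calls []                    γ B = ⊤
  Calls (e ∷ es)              γ B = Calls e γ B × Calls es γ B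
  Calls (caseList e a b)      γ B =
    Calls e γ B × Calls a γ B × (∀ x xs → eval e γ ≡ x ∷ xs → Calls b (x , xs , γ) B)
  Calls (pair a b)            γ B = Calls a γ B × Calls b γ B
  Calls (fst e)               γ B = Calls e γ B
  Calls (snd e)               γ B = Calls e γ B
  Calls (rec xs p ℓ)      γ B =
    Calls xs γ B × Calls p γ B × costRec ℓ γ (eval xs γ) (eval p γ) ≤ B
  Calls (call f es)           γ B = Calls* es γ B × cost f (evals es γ) ≤ B

  Calls* : ∀ {Γ Δ} → Exps Γ Δ → Env Γ → ℕ → Set
  Calls* []       γ B = ⊤
  Calls* (e ∷ es) γ B = Calls e γ B × Calls* es γ B

opaque
  mutual
    -- `B` stands in for every loop and every callee, whose bodies are not inspected. The bound is
    -- therefore affine in `B`, with coefficients read off the syntax, and polynomial as soon as `B`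
    -- is.
    bound : ∀ {Γ τ} → Exp Γ τ → ℕ → ℕ
    bound (var i)               B = varCost i + 3
    bound (lit b)               B = 3
    bound (ifᵉ c then a else b) B = 4 + (bound c B + (bound a B + bound b B))
    bound []                    B = 1
    bound (e ∷ es)              B = suc (bound e B + bound es B)
    bound (caseList e a b)      B = suc (bound e B + (bound a B + (7 + bound b B)))
    bound (pair a b)            B = suc (bound a B + bound b B)
    bound (fst e)               B = suc (bound e B + 1)
    bound (snd e)               B = suc (bound e B + 1)
    bound (rec xs p ℓ)      B = 2 + (suc (bound xs B + bound p B) + B)
    bound (call f es)           B = 2 + (bound* es B + B)

    bound* : ∀ {Γ Δ} → Exps Γ Δ → ℕ → ℕ
    bound* []       B = 1
    bound* (e ∷ es) B = suc (bound e B + bound* es B)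

  mutual
    cost≤bound : ∀ {Γ τ} (e : Exp Γ τ) γ {B} → Calls e γ B → cost e γ ≤ bound e B
    cost≤bound (var i) γ _ = ≤-refl
    cost≤bound (lit false) γ _ = s≤s z≤n
    cost≤bound (lit true) γ _ = ≤-refl
    cost≤bound (ifᵉ c then a else b) γ {B} (cc , ca , cb) =
      s≤s (≤-trans (+-mono-≤ (cost≤bound c γ cc) (branch (eval c γ))) (≤-reflexive (eq (bound c B) _)))
      where
      branch : ∀ t → (if t then 3 + cost a γ else cost b γ) ≤ 3 + (bound a B + bound b B)
      branch true  = +-monoʳ-≤ 3 (≤-trans (cost≤bound a γ ca) (m≤m+n _ _))
      branch false = m≤n⇒m≤o+n 3 (≤-trans (cost≤bound b γ cb) (m≤n+m _ _))
      eq : ∀ x y → x + (3 + y) ≡ 3 + (x + y)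
      eq = solve-∀
    cost≤bound [] γ _ = ≤-refl
    cost≤bound (e ∷ es) γ (c , cs) = s≤s (+-mono-≤ (cost≤bound e γ c) (cost≤bound es γ cs))
    cost≤bound (caseList e a b) γ {B} (ce , ca , cb) =
      s≤s (+-mono-≤ (cost≤bound e γ ce) (branch (eval e γ) cb))
      where
      branch : ∀ l → (∀ x xs → l ≡ x ∷ xs → Calls b (x , xs , γ) B) →
        matchList l (cost a γ) (λ x xs → 7 + cost b (x , xs , γ)) ≤ bound a B + (7 + bound b B)
      branch []       _ = ≤-trans (cost≤bound a γ ca) (m≤m+n _ _)
      branch (x ∷ xs) h =
        m≤n⇒m≤o+n (bound a B) (+-monoʳ-≤ 7 (cost≤bound b (x , xs , γ) (h x xs refl)))
    cost≤bound (pair a b) γ (ca , cb) = s≤s (+-mono-≤ (cost≤bound a γ ca) (cost≤bound b γ cb))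
    cost≤bound (fst e) γ c = s≤s (+-monoˡ-≤ 1 (cost≤bound e γ c))
    cost≤bound (snd e) γ c = s≤s (+-monoˡ-≤ 1 (cost≤bound e γ c))
    cost≤bound (rec xs p ℓ) γ (cx , cp , cr) =
      +-monoʳ-≤ 2 (+-mono-≤ (s≤s (+-mono-≤ (cost≤bound xs γ cx) (cost≤bound p γ cp))) cr)
    cost≤bound (call f es) γ (c , cs) = +-monoʳ-≤ 2 (+-mono-≤ (costs≤bound* es γ c) cs)

    costs≤bound* : ∀ {Γ Δ} (es : Exps Γ Δ) γ {B} → Calls* es γ B → costs es γ ≤ bound* es B
    costs≤bound* [] γ _ = ≤-refl
    costs≤bound* (e ∷ es) γ (c , cs) = s≤s (+-mono-≤ (cost≤bound e γ c) (costs≤bound* es γ cs))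

-- A round pays for both a base case and a step, with their overheads 9 and 27 = 6 + 1 + 13 + 7 in
-- `costRec`. A list of length k then takes k + 1 rounds, the last one for the base case.
roundBound : ∀ {Γ σ π τ} → Loop Γ σ π τ → ℕ → ℕ
roundBound (loop b n s) B = 9 + bound b B + (27 + (bound n B + bound s B))

opaque
  -- The time bound of a loop of at most M rounds, each of whose calls costs at most B.
  rounds : ∀ {Γ σ π τ} → Loop Γ σ π τ → ℕ → ℕ → ℕ
  rounds ℓ M B = suc M * roundBound ℓ B

module _ {Γ σ π τ} (b : Exp (π ∷ Γ) τ) (n : Exp (σ ∷ list σ ∷ π ∷ Γ) π)
         (s : Exp (τ ∷ σ ∷ list σ ∷ π ∷ Γ) τ) (γ : Env Γ) (B : ℕ)
         (Inv : List ⟦ σ ⟧ → ⟦ π ⟧ → Set)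
         (onBase : ∀ p → Inv [] p → Calls b (p , γ) B)
         (onStep : ∀ x xs p → Inv (x ∷ xs) p →
           Calls n (x , xs , p , γ) B × Inv xs (eval n (x , xs , p , γ)) ×
           Calls s (evalRec (loop b n s) γ xs (eval n (x , xs , p , γ)) , x , xs , p , γ) B)
  where

  opaque
    unfolding rounds

    -- `Inv` ties the remaining list to the current parameter and carries into each round the length
    -- bounds on which the cost of the calls depends. `Calls s` is required at the actual result of
    -- the recursive call, since that result is often an argument of a call.
    costRec≤length : ∀ xs p → Inv xs p →
      costRec (loop b n s) γ xs p ≤ rounds (loop b n s) (length xs) B
    costRec≤length [] p i = ≤-trans (+-monoʳ-≤ 9 (cost≤bound b _ (onBase p i)))
      (≤-trans (m≤m+n _ _) (m≤m+n _ 0))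
    costRec≤length (x ∷ xs) p i =
      let cn , i′ , cs = onStep x xs p i
          p′ = eval n (x , xs , p , γ)
          N  = cost n (x , xs , p , γ)
          R  = costRec (loop b n s) γ xs p′
          S  = cost s (evalRec (loop b n s) γ xs p′ , x , xs , p , γ)
      in begin
        6 + (suc (13 + N + R + 7) + S) ≡⟨ eq N R S ⟩
        27 + (N + S) + R ≤⟨ +-mono-≤
            (≤-trans (+-monoʳ-≤ 27 (+-mono-≤ (cost≤bound n _ cn) (cost≤bound s _ cs)))
                     (m≤n+m _ (9 + bound b B)))
            (costRec≤length xs _ i′) ⟩
        rounds (loop b n s) (length (x ∷ xs)) B ∎
      where
      open ≤-Reasoning
      eq : ∀ n r s → 6 + (suc (13 + n + r + 7) + s) ≡ 27 + (n + s) + r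
      eq = solve-∀

    costRec≤ : ∀ {M} xs p → Inv xs p → length xs ≤ M →
      costRec (loop b n s) γ xs p ≤ rounds (loop b n s) M B
    costRec≤ xs p i l = ≤-trans (costRec≤length xs p i) (*-monoˡ-≤ _ (s≤s l))

-- Functions of polynomial growth

Polynomial : (ℕ → ℕ) → Set
Polynomial f = ∃[ c ] ∀ M → 1 ≤ M → f M ≤ c * M ^ c

^-mono-exp : ∀ {M a b} → 1 ≤ M → a ≤ b → M ^ a ≤ M ^ b
^-mono-exp {M} h l = ^-monoʳ-≤ M {{>-nonZero h}} l

1≤^ : ∀ {M} a → 1 ≤ M → 1 ≤ M ^ a
1≤^ a h = ^-mono-exp {a = 0} {b = a} h z≤n

poly-const : ∀ k → Polynomial (λ _ → k)
poly-const k = k , λ M h → ≤-trans (≤-reflexive (sym (*-identityʳ k))) (*-monoʳ-≤ k (1≤^ k h))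

poly-id : Polynomial (λ M → M)
poly-id = 1 , λ M h → ≤-reflexive (sym (trans (+-identityʳ _) (*-identityʳ M)))

poly-+ : ∀ {f g} → Polynomial f → Polynomial g → Polynomial (λ M → f M + g M)
poly-+ {f} {g} (a , p) (b , q) = a + b , λ M h → begin
  f M + g M ≤⟨ +-mono-≤ (p M h) (q M h) ⟩
  a * M ^ a + b * M ^ b ≤⟨ +-mono-≤ (*-monoʳ-≤ a (^-mono-exp h (m≤m+n a b)))
                                    (*-monoʳ-≤ b (^-mono-exp h (m≤n+m b a))) ⟩
  a * M ^ (a + b) + b * M ^ (a + b) ≡⟨ *-distribʳ-+ (M ^ (a + b)) a b ⟨
  (a + b) * M ^ (a + b) ∎
  where open ≤-Reasoning

-- One constant serves as both coefficient and exponent, hence the sum of the coefficient `a * b`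
-- and the exponent `a + b` of the product.
poly-* : ∀ {f g} → Polynomial f → Polynomial g → Polynomial (λ M → f M * g M)
poly-* {f} {g} (a , p) (b , q) = a * b + (a + b) , λ M h → begin
  f M * g M ≤⟨ *-mono-≤ (p M h) (q M h) ⟩
  (a * M ^ a) * (b * M ^ b) ≡⟨ eq a (M ^ a) b (M ^ b) ⟩
  (a * b) * (M ^ a * M ^ b) ≡⟨ cong ((a * b) *_) (^-distribˡ-+-* M a b) ⟨
  (a * b) * M ^ (a + b) ≤⟨ *-mono-≤ (m≤m+n (a * b) (a + b)) (^-mono-exp h (m≤n+m (a + b) (a * b))) ⟩
  (a * b + (a + b)) * M ^ (a * b + (a + b)) ∎
  where
  open ≤-Reasoning
  eq : ∀ a x b y → (a * x) * (b * y) ≡ (a * b) * (x * y)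
  eq = solve-∀

poly-suc : ∀ {f} → Polynomial f → Polynomial (λ M → suc (f M))
poly-suc p = poly-+ (poly-const 1) p

opaque
  unfolding bound

  mutual
    poly-bound : ∀ {Γ τ} (e : Exp Γ τ) {B} → Polynomial B → Polynomial (λ M → bound e (B M))
    poly-bound (var i) p = poly-const _
    poly-bound (lit b) p = poly-const _
    poly-bound (ifᵉ c then a else b) p =
      poly-+ (poly-const 4) (poly-+ (poly-bound c p) (poly-+ (poly-bound a p) (poly-bound b p)))
    poly-bound [] p = poly-const _
    poly-bound (e ∷ es) p = poly-suc (poly-+ (poly-bound e p) (poly-bound es p))
    poly-bound (caseList e a b) p = poly-suc (poly-+ (poly-bound e p)
      (poly-+ (poly-bound a p) (poly-+ (poly-const 7) (poly-bound b p))))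
    poly-bound (pair a b) p = poly-suc (poly-+ (poly-bound a p) (poly-bound b p))
    poly-bound (fst e) p = poly-suc (poly-+ (poly-bound e p) (poly-const 1))
    poly-bound (snd e) p = poly-suc (poly-+ (poly-bound e p) (poly-const 1))
    poly-bound (rec xs q ℓ) p = poly-+ (poly-const 2)
      (poly-+ (poly-suc (poly-+ (poly-bound xs p) (poly-bound q p))) p)
    poly-bound (call f es) p = poly-+ (poly-const 2) (poly-+ (poly-bound* es p) p)

    poly-bound* : ∀ {Γ Δ} (es : Exps Γ Δ) {B} → Polynomial B → Polynomial (λ M → bound* es (B M))
    poly-bound* [] p = poly-const _
    poly-bound* (e ∷ es) p = poly-suc (poly-+ (poly-bound e p) (poly-bound* es p))

opaque
  unfolding rounds

  poly-rounds : ∀ {Γ σ π τ} (ℓ : Loop Γ σ π τ) {f B} → Polynomial f → Polynomial B →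
                Polynomial (λ M → rounds ℓ (f M) (B M))
  poly-rounds (loop b n s) p q = poly-* (poly-suc p)
    (poly-+ (poly-+ (poly-const 9) (poly-bound b q))
            (poly-+ (poly-const 27) (poly-+ (poly-bound n q) (poly-bound s q))))

-- The dynamic program

-- Numbers are digit lists as in encodeℕᵇ (true is the digit 1, false the digit 2);
-- an edge of weight k is the one-element list of k, a non-edge the empty list.
bits row graph piece : Ty
bits  = list bool
row   = list (list bits)
graph = list row
piece = bits ⊗ list bits

notᵉ : ∀ {Γ} → Exp Γ bool → Exp Γ bool
notᵉ a = ifᵉ a then lit false else lit true

xorᵉ : ∀ {Γ} → Exp Γ bool → Exp Γ bool → Exp Γ bool
xorᵉ a b = ifᵉ a then notᵉ b else b

-- The entries of a list of bits beyond its end are taken to be false.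
headᵉ : ∀ {Γ} → Exp Γ bits → Exp Γ bool
headᵉ e = caseList e (lit false) (var 0F)

tailᵉ : ∀ {Γ} → Exp Γ bits → Exp Γ bits
tailᵉ e = caseList e [] (var 1F)

-- In bijective base 2 a digit 1 becomes 2 without a carry, whereas a digit 2 becomes 3 = 1 + 2 · 1
-- and increments the tail. The parameter is a dummy.
incˡ : Loop (bits ∷ []) bool bool bits
incˡ = loop
  (lit true ∷ []) (lit false)
  (ifᵉ var 1F then lit false ∷ var 2F else (lit true ∷ var 0F))

incᵉ : Exp (bits ∷ []) bits
incᵉ = rec (var 0F) (lit false) incˡ

-- The sums of digits are 1 + 1 = 2 without a carry, 1 + 2 = 1 + 2 · 1 and 2 + 2 = 2 + 2 · 1 with
-- one. The carry is not passed along the digits but added by `incᵉ` to the finished sum of the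
-- tails, at the price of quadratic time.
addˡ : Loop (bits ∷ bits ∷ []) bool bits bits
addˡ = loop
  (var 0F) (tailᵉ (var 2F))
  (caseList (var 3F) (var 1F ∷ var 2F)
    (ifᵉ var 3F
     then ifᵉ var 0F then lit false ∷ var 2F else (lit true ∷ call incᵉ (var 2F ∷ []))
     else ifᵉ var 0F then lit true ∷ call incᵉ (var 2F ∷ [])
                     else (lit false ∷ call incᵉ (var 2F ∷ []))))

addᵉ : Exp (bits ∷ bits ∷ []) bits
addᵉ = rec (var 0F) (var 1F) addˡ

-- The first argument asks for strict comparison.
leqˡ : Loop (bool ∷ bits ∷ bits ∷ []) bool (bool ⊗ bits) bool
leqˡ = loop
  (caseList (snd (var 0F)) (notᵉ (fst (var 0F))) (lit true))
  (caseList (snd (var 2F)) (pair (fst (var 2F)) [])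
    -- The lowest digits only settle ties between the tails: equal digits keep the flag, a 1 against
    -- a 2 makes the comparison of the tails non-strict, a 2 against a 1 makes it strict.
    (pair (ifᵉ var 2F then ifᵉ var 0F then fst (var 4F) else lit false
                      else ifᵉ var 0F then lit true else fst (var 4F))
          (var 1F)))
  (caseList (snd (var 3F)) (lit false) (var 2F))

leqᵉ : Exp (bool ∷ bits ∷ bits ∷ []) bool
leqᵉ = rec (var 1F) (pair (var 0F) (var 2F)) leqˡ

crossˡ : Loop (bool ∷ row ∷ bits ∷ []) (list bits) bits bits
crossˡ = loop
  [] (tailᵉ (var 2F))
  (ifᵉ xorᵉ (var 4F) (headᵉ (var 3F))
   then caseList (var 1F) (var 0F) (call addᵉ (var 0F ∷ var 2F ∷ []))
   else var 0F)

crossᵉ : Exp (bool ∷ row ∷ bits ∷ []) bits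
crossᵉ = rec (var 1F) (var 2F) crossˡ

-- Halving is avoided: the weighted degree is the sum of the crossing degrees for the side `c` and
-- for the opposite side, so stability compares these two.
stableAtᵉ : Exp (bool ∷ row ∷ bits ∷ []) bool
stableAtᵉ = call leqᵉ (lit false
  ∷ call crossᵉ (notᵉ (var 0F) ∷ var 1F ∷ var 2F ∷ [])
  ∷ call crossᵉ (var 0F ∷ var 1F ∷ var 2F ∷ []) ∷ [])

tailsᵉ : ∀ {Γ} → Exp Γ (bits ⊗ bits) → Exp Γ (bits ⊗ bits)
tailsᵉ e = pair (tailᵉ (fst e)) (tailᵉ (snd e))

validˡ : Loop (bits ∷ bits ∷ graph ∷ []) row (bits ⊗ bits) bool
validˡ = loop
  (lit true) (tailsᵉ (var 2F))
  (ifᵉ headᵉ (fst (var 3F))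
   then ifᵉ call stableAtᵉ (headᵉ (snd (var 3F)) ∷ var 1F ∷ var 5F ∷ []) then var 0F else lit false
   else var 0F)

validᵉ : Exp (bits ∷ bits ∷ graph ∷ []) bool
validᵉ = rec (var 2F) (pair (var 0F) (var 1F)) validˡ

costˡ : Loop (bits ∷ bits ∷ graph ∷ []) row (bits ⊗ bits) bits
costˡ = loop
  [] (tailsᵉ (var 2F))
  (ifᵉ headᵉ (fst (var 3F))
   then call addᵉ (call crossᵉ (headᵉ (snd (var 3F)) ∷ var 1F ∷ var 5F ∷ []) ∷ var 0F ∷ [])
   else var 0F)

costᵉ : Exp (bits ∷ bits ∷ graph ∷ []) bits
costᵉ = rec (var 2F) (pair (var 0F) (var 1F)) costˡ

touchedˡ : Loop (row ∷ bits ∷ bool ∷ []) (list bits) bits bool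
touchedˡ = loop
  (lit false) (tailᵉ (var 2F))
  (caseList (var 1F) (var 0F)
    (ifᵉ var 8F then lit true else ifᵉ headᵉ (var 5F) then lit true else var 2F))

touchedᵉ : Exp (row ∷ bits ∷ bool ∷ []) bool
touchedᵉ = rec (var 0F) (var 1F) touchedˡ

-- The bit handed to `touchedᵉ` says whether the vertex of the row is itself in the bag, in which
-- case each of its edges counts. A vertex without edges never enters the boundary, which is why the
-- size of the boundary is bounded by a multiple of Δ.
boundaryˡ : Loop (graph ∷ bits ∷ []) row bits bits
boundaryˡ = loop
  [] (tailᵉ (var 2F))
  (call touchedᵉ (var 1F ∷ var 5F ∷ headᵉ (var 3F) ∷ []) ∷ var 0F)

boundaryᵉ : Exp (graph ∷ bits ∷ []) bits
boundaryᵉ = rec (var 0F) (var 1F) boundaryˡ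

consAllˡ : Loop (bool ∷ list bits ∷ list bits ∷ []) bits bool (list bits)
consAllˡ = loop
  (var 3F) (lit false) ((var 4F ∷ var 1F) ∷ var 0F)

consAllᵉ : Exp (bool ∷ list bits ∷ list bits ∷ []) (list bits)
consAllᵉ = rec (var 1F) (lit false) consAllˡ

-- Positions outside the boundary are fixed to false, so there is one list for each cut of the
-- boundary.
assignmentsˡ : Loop (bits ∷ []) bool bool (list bits)
assignmentsˡ = loop
  ([] ∷ []) (lit false)
  (ifᵉ var 1F
   then call consAllᵉ (lit false ∷ var 0F ∷ call consAllᵉ (lit true ∷ var 0F ∷ [] ∷ []) ∷ [])
   else call consAllᵉ (lit false ∷ var 0F ∷ [] ∷ []))

assignmentsᵉ : Exp (bits ∷ []) (list bits)
assignmentsᵉ = rec (var 0F) (lit false) assignmentsˡ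

agreeˡ : Loop (bits ∷ bits ∷ bits ∷ []) bool (bits ⊗ bits) bool
agreeˡ = loop
  (lit true) (tailsᵉ (var 2F))
  (ifᵉ var 1F
   then ifᵉ xorᵉ (headᵉ (fst (var 3F))) (headᵉ (snd (var 3F))) then lit false else var 0F
   else var 0F)

agreeᵉ : Exp (bits ∷ bits ∷ bits ∷ []) bool
agreeᵉ = rec (var 0F) (pair (var 1F) (var 2F)) agreeˡ

-- The result is an optional cut, as a list of length at most one. With an empty first argument the
-- agreement test is vacuous, so `answerᵉ` uses the same search for the global optimum.
bestˡ : Loop (bits ∷ bits ∷ bits ∷ graph ∷ list bits ∷ []) bits bool (list bits)
bestˡ = loop
  [] (lit false)
  (ifᵉ call agreeᵉ (var 4F ∷ var 5F ∷ var 1F ∷ []) then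
   ifᵉ call validᵉ (var 6F ∷ var 1F ∷ var 7F ∷ []) then
   caseList (var 0F) (var 1F ∷ [])
     (ifᵉ call leqᵉ (lit false ∷ call costᵉ (var 8F ∷ var 3F ∷ var 9F ∷ [])
                               ∷ call costᵉ (var 8F ∷ var 0F ∷ var 9F ∷ []) ∷ [])
      then var 3F ∷ [] else var 2F)
   else var 0F else var 0F)

bestᵉ : Exp (bits ∷ bits ∷ bits ∷ graph ∷ list bits ∷ []) (list bits)
bestᵉ = rec (var 4F) (lit false) bestˡ

pruneˡ : Loop (bits ∷ bits ∷ graph ∷ list bits ∷ []) bits bool (list bits)
pruneˡ = loop
  [] (lit false)
  (caseList (call bestᵉ (var 4F ∷ var 1F ∷ var 5F ∷ var 6F ∷ var 7F ∷ []))
    (var 0F) (var 0F ∷ var 2F))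

pruneᵉ : Exp (bits ∷ bits ∷ graph ∷ list bits ∷ []) (list bits)
pruneᵉ = rec (call assignmentsᵉ (var 0F ∷ [])) (lit false) pruneˡ

patchˡ : Loop (bits ∷ bits ∷ bits ∷ []) bool (bits ⊗ bits) bits
patchˡ = loop
  [] (tailsᵉ (var 2F))
  ((ifᵉ var 1F then headᵉ (fst (var 3F)) else headᵉ (snd (var 3F))) ∷ var 0F)

patchᵉ : Exp (bits ∷ bits ∷ bits ∷ []) bits
patchᵉ = rec (var 0F) (pair (var 1F) (var 2F)) patchˡ

patchAllˡ : Loop (bits ∷ bits ∷ list bits ∷ list bits ∷ []) bits bool (list bits)
patchAllˡ = loop
  (var 4F) (lit false)
  (call patchᵉ (var 4F ∷ var 1F ∷ var 5F ∷ []) ∷ var 0F)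

patchAllᵉ : Exp (bits ∷ bits ∷ list bits ∷ list bits ∷ []) (list bits)
patchAllᵉ = rec (var 2F) (lit false) patchAllˡ

-- All pairs are patched together, whether or not they match where they overlap. A patched list is
-- again a cut, judged on its own by `pruneᵉ`, so a mismatched pair either fails the test or is a
-- legitimate entry.
mergeˡ : Loop (bits ∷ list bits ∷ list bits ∷ []) bits bool (list bits)
mergeˡ = loop
  [] (lit false)
  (call patchAllᵉ (var 4F ∷ var 1F ∷ var 6F ∷ var 0F ∷ []))

mergeᵉ : Exp (bits ∷ list bits ∷ list bits ∷ []) (list bits)
mergeᵉ = rec (var 1F) (lit false) mergeˡ

unionˡ : Loop (bits ∷ bits ∷ []) bool bits bits
unionˡ = loop
  [] (tailᵉ (var 2F))
  ((ifᵉ var 1F then lit true else headᵉ (var 3F)) ∷ var 0F)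

unionᵉ : Exp (bits ∷ bits ∷ []) bits
unionᵉ = rec (var 0F) (var 1F) unionˡ

leafᵉ : Exp (bits ∷ graph ∷ []) piece
leafᵉ = pair (var 0F) (call assignmentsᵉ (call boundaryᵉ (var 1F ∷ var 0F ∷ []) ∷ []))

prunedᵉ : Exp (bits ∷ bits ∷ graph ∷ list bits ∷ []) piece
prunedᵉ = pair (var 0F)
  (call pruneᵉ (call boundaryᵉ (var 2F ∷ var 1F ∷ []) ∷ var 0F ∷ var 2F ∷ var 3F ∷ []))

joinᵉ : Exp (piece ∷ piece ∷ bits ∷ graph ∷ []) piece
joinᵉ = call prunedᵉ (call unionᵉ (fst (var 0F) ∷ fst (var 1F) ∷ []) ∷ var 2F ∷ var 3F
  ∷ call mergeᵉ (fst (var 1F) ∷ snd (var 0F) ∷ snd (var 1F) ∷ []) ∷ [])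

-- The output must have exactly one entry per vertex, whereas all other programs read a cut entry by
-- entry with false beyond its end.
resizeˡ : Loop (graph ∷ bits ∷ []) row bits bits
resizeˡ = loop
  [] (tailᵉ (var 2F)) (headᵉ (var 3F) ∷ var 0F)

resizeᵉ : Exp (graph ∷ bits ∷ []) bits
resizeᵉ = rec (var 0F) (var 1F) resizeˡ

answerᵉ : Exp (piece ∷ graph ∷ []) bits
answerᵉ = call resizeᵉ (var 1F ∷
  caseList (call bestᵉ ([] ∷ [] ∷ fst (var 0F) ∷ var 1F ∷ snd (var 0F) ∷ [])) [] (var 0F) ∷ [])

-- The meaning of the programs

Bits : Set
Bits = ⟦ bits ⟧

val : Bits → ℕ
val []           = 0
val (true  ∷ bs) = suc (2 * val bs)
val (false ∷ bs) = 2 * suc (val bs)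

toℕ : Bool → ℕ
toℕ false = 0
toℕ true  = 1

hd : Bits → Bool
hd bs = matchList bs false λ b _ → b

tl : Bits → Bits
tl bs = matchList bs [] λ _ bs → bs

nth : ∀ {n} → Bits → Fin n → Bool
nth bs zero    = hd bs
nth bs (suc i) = nth (tl bs) i

nth-tabulate : ∀ {n} (f : Fin n → Bool) u → nth (tabulate f) u ≡ f u
nth-tabulate f zero    = refl
nth-tabulate f (suc u) = nth-tabulate (f ∘ suc) u

false≢true : ∀ {A : Set} {b} → b ≡ false → b ≡ true → A
false≢true refl ()

Reflects-map : ∀ {A B : Set} {b} → (A → B) → (B → A) → Reflects A b → Reflects B b
Reflects-map f g (ofʸ a)  = ofʸ (f a)
Reflects-map f g (ofⁿ ¬a) = ofⁿ (¬a ∘ g)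

Reflects-true : ∀ {A : Set} {b} → Reflects A b → b ≡ true → A
Reflects-true (ofʸ a) _ = a

true-Reflects : ∀ {A : Set} {b} → Reflects A b → A → b ≡ true
true-Reflects (ofʸ _)  _ = refl
true-Reflects (ofⁿ ¬a) a = ⊥-elim (¬a a)

inc : Bits → Bits
inc x = eval incᵉ (x , tt)

val-incˡ : ∀ γ x q → val (evalRec incˡ γ x q) ≡ suc (val x)
val-incˡ γ []          q = refl
val-incˡ γ (true ∷ x)  q = cong suc (+-suc (val x) (val x + 0))
val-incˡ γ (false ∷ x) q = cong (λ k → suc (2 * k)) (val-incˡ γ x false)

val-inc : ∀ x → val (inc x) ≡ suc (val x)
val-inc x = val-incˡ _ x false

add : Bits → Bits → Bits
add x y = eval addᵉ (x , y , tt)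

val-addˡ : ∀ γ x y → val (evalRec addˡ γ x y) ≡ val x + val y
val-addˡ γ []          y           = refl
val-addˡ γ (d ∷ x)     []          = sym (+-identityʳ _)
val-addˡ γ (true ∷ x)  (true ∷ y)  =
  trans (cong (λ k → 2 * suc k) (val-addˡ γ x y)) (eq (val x) (val y))
  where
  eq : ∀ x y → 2 * suc (x + y) ≡ suc (2 * x) + suc (2 * y)
  eq = solve-∀
val-addˡ γ (true ∷ x)  (false ∷ y) =
  trans (cong (λ k → suc (2 * k)) (trans (val-inc (evalRec addˡ γ x y)) (cong suc (val-addˡ γ x y)))) (eq (val x) (val y))
  where
  eq : ∀ x y → suc (2 * suc (x + y)) ≡ suc (2 * x) + 2 * suc y
  eq = solve-∀
val-addˡ γ (false ∷ x) (true ∷ y)  =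
  trans (cong (λ k → suc (2 * k)) (trans (val-inc (evalRec addˡ γ x y)) (cong suc (val-addˡ γ x y)))) (eq (val x) (val y))
  where
  eq : ∀ x y → suc (2 * suc (x + y)) ≡ 2 * suc x + suc (2 * y)
  eq = solve-∀
val-addˡ γ (false ∷ x) (false ∷ y) =
  trans (cong (λ k → 2 * suc k) (trans (val-inc (evalRec addˡ γ x y)) (cong suc (val-addˡ γ x y)))) (eq (val x) (val y))
  where
  eq : ∀ x y → 2 * suc (suc (x + y)) ≡ 2 * suc x + 2 * suc y
  eq = solve-∀

val-add : ∀ x y → val (add x y) ≡ val x + val y
val-add x y = val-addˡ _ x y

double≤⁻ : ∀ {x y} → 2 * x ≤ suc (2 * y) → x ≤ y
double≤⁻ {x} {y} h = ≤-pred (*-cancelˡ-< 2 x (suc y) (≤-trans (s≤s h) (≤-reflexive (eq y))))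
  where
  eq : ∀ y → suc (suc (2 * y)) ≡ 2 * suc y
  eq = solve-∀

double<⁻ : ∀ {x y} → suc (2 * x) ≤ 2 * y → suc x ≤ y
double<⁻ {x} {y} h = *-cancelˡ-< 2 x y h

double<⁺ : ∀ {x y} → suc x ≤ y → suc (2 * x) ≤ 2 * y
double<⁺ {x} {y} h = *-monoʳ-< 2 h

leq-reflects : ∀ γ x s y → Reflects (toℕ s + val x ≤ val y) (evalRec leqˡ γ x (s , y))
leq-reflects γ [] true  []          = ofⁿ λ ()
leq-reflects γ [] false []          = ofʸ z≤n
leq-reflects γ [] true  (true ∷ y)  = ofʸ (s≤s z≤n)
leq-reflects γ [] false (true ∷ y)  = ofʸ z≤n
leq-reflects γ [] true  (false ∷ y) = ofʸ (s≤s z≤n)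
leq-reflects γ [] false (false ∷ y) = ofʸ z≤n
leq-reflects γ (true ∷ x)  s [] = ofⁿ λ h → n≮0 (≤-trans (m≤n+m _ (toℕ s)) h)
leq-reflects γ (false ∷ x) s [] = ofⁿ λ h → n≮0 (≤-trans (m≤n+m _ (toℕ s)) h)
leq-reflects γ (true ∷ x) false (true ∷ y) =
  Reflects-map (s≤s ∘ *-monoʳ-≤ 2) (*-cancelˡ-≤ 2 ∘ ≤-pred) (leq-reflects γ x false y)
leq-reflects γ (true ∷ x) true (true ∷ y) =
  Reflects-map (s≤s ∘ double<⁺) (double<⁻ ∘ ≤-pred) (leq-reflects γ x true y)
leq-reflects γ (true ∷ x) false (false ∷ y) =
  Reflects-map (λ h → ≤-trans (s≤s (*-monoʳ-≤ 2 h)) (≤-trans (n≤1+n _) (≤-reflexive (eq (val y)))))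
    (λ h → double≤⁻ (≤-pred (≤-trans h (≤-reflexive (sym (eq (val y)))))))
    (leq-reflects γ x false y)
  where
  eq : ∀ y → suc (suc (2 * y)) ≡ 2 * suc y
  eq = solve-∀
leq-reflects γ (true ∷ x) true (false ∷ y) =
  Reflects-map (λ h → ≤-trans (s≤s (s≤s (*-monoʳ-≤ 2 h))) (≤-reflexive (eq (val y))))
    (λ h → *-cancelˡ-≤ 2 (≤-pred (≤-pred (≤-trans h (≤-reflexive (sym (eq (val y))))))))
    (leq-reflects γ x false y)
  where
  eq : ∀ y → suc (suc (2 * y)) ≡ 2 * suc y
  eq = solve-∀
leq-reflects γ (false ∷ x) false (true ∷ y) =
  Reflects-map (λ h → ≤-trans (*-monoʳ-≤ 2 h) (n≤1+n _)) double≤⁻ (leq-reflects γ x true y)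
leq-reflects γ (false ∷ x) true (true ∷ y) =
  Reflects-map (s≤s ∘ *-monoʳ-≤ 2) (*-cancelˡ-≤ 2 ∘ ≤-pred) (leq-reflects γ x true y)
leq-reflects γ (false ∷ x) false (false ∷ y) =
  Reflects-map (*-monoʳ-≤ 2 ∘ s≤s) (≤-pred ∘ *-cancelˡ-≤ 2) (leq-reflects γ x false y)
leq-reflects γ (false ∷ x) true (false ∷ y) =
  Reflects-map (double<⁺ ∘ s≤s) (≤-pred ∘ double<⁻) (leq-reflects γ x true y)

leq : Bits → Bits → Bool
leq x y = eval leqᵉ (false , x , y , tt)

cross : Bool → ⟦ row ⟧ → Bits → Bits
cross c r C = eval crossᵉ (c , r , C , tt)

entryWeight : List Bits → ℕ
entryWeight e = matchList e 0 λ k _ → val k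

cross-step : ∀ c b e r →
  val (if eval (xorᵉ {bool ∷ bool ∷ []} (var zero) (var (suc zero))) (c , b , tt)
       then matchList e r (λ k _ → add k r) else r)
  ≡ (if c xor b then entryWeight e else 0) + val r
cross-step true  true  e       r = refl
cross-step false false e       r = refl
cross-step true  false []      r = refl
cross-step true  false (k ∷ _) r = val-add k r
cross-step false true  []      r = refl
cross-step false true  (k ∷ _) r = val-add k r

val-crossˡ : ∀ {n} c R C₀ (r : Fin n → List Bits) C →
  val (evalRec crossˡ (c , R , C₀ , tt) (tabulate r) C) ≡
  sumFin λ u → if c xor nth C u then entryWeight (r u) else 0
val-crossˡ {zero}  c R C₀ r C = refl
val-crossˡ {suc n} c R C₀ r C = trans (cross-step c (hd C) (r zero) _)
  (cong ((if c xor hd C then entryWeight (r zero) else 0) +_) (val-crossˡ c R C₀ (r ∘ suc) (tl C)))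

val-cross : ∀ {n} c (r : Fin n → List Bits) C →
  val (cross c (tabulate r) C) ≡ sumFin λ u → if c xor nth C u then entryWeight (r u) else 0
val-cross c r C = val-crossˡ c _ _ r C

LocallyStable : Bool → ⟦ row ⟧ → Bits → Set
LocallyStable c r C = val (cross (not c) r C) ≤ val (cross c r C)

stableAt-reflects : ∀ c r C → Reflects (LocallyStable c r C) (eval stableAtᵉ (c , r , C , tt))
stableAt-reflects true  r C = leq-reflects _ (cross false r C) false (cross true r C)
stableAt-reflects false r C = leq-reflects _ (cross true r C) false (cross false r C)

-- `C` is the whole cut, against which every row is tested; `V` and `D` are the parts of the vertex
-- set and of the cut that remain from the current row on.
valid-reflectsˡ : ∀ {n} V₀ C G (rows : Fin n → ⟦ row ⟧) V D →
  Reflects (∀ v → nth V v ≡ true → LocallyStable (nth D v) (rows v) C)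
           (evalRec validˡ (V₀ , C , G , tt) (tabulate rows) (V , D))
valid-reflectsˡ {zero}  V₀ C G rows V D = ofʸ λ ()
valid-reflectsˡ {suc n} V₀ C G rows V D =
  step (hd V) refl (stableAt-reflects (hd D) (rows zero) C)
       (valid-reflectsˡ V₀ C G (rows ∘ suc) (tl V) (tl D))
  where
  P : Fin (suc n) → Set
  P v = nth V v ≡ true → LocallyStable (nth D v) (rows v) C
  step : ∀ {s r} b → hd V ≡ b → Reflects (LocallyStable (hd D) (rows zero) C) s →
         Reflects (∀ v → P (suc v)) r →
         Reflects (∀ v → P v) (if b then (if s then r else false) else r)
  step false q s R = Reflects-map
    (λ h → λ { zero e → false≢true q e ; (suc v) → h v }) (_∘ suc) R
  step true q (ofʸ s)  R =
    Reflects-map (λ h → λ { zero _ → s ; (suc v) → h v }) (_∘ suc) R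
  step true q (ofⁿ ¬s) R = ofⁿ λ h → ¬s (h zero q)

valid : ∀ (V C : Bits) (G : ⟦ graph ⟧) → Bool
valid V C G = eval validᵉ (V , C , G , tt)

valid-reflects : ∀ {n} V C (rows : Fin n → ⟦ row ⟧) →
  Reflects (∀ v → nth V v ≡ true → LocallyStable (nth C v) (rows v) C) (valid V C (tabulate rows))
valid-reflects V C rows = valid-reflectsˡ V C _ rows V C

val-costˡ : ∀ {n} V₀ C G (rows : Fin n → ⟦ row ⟧) V D →
  val (evalRec costˡ (V₀ , C , G , tt) (tabulate rows) (V , D)) ≡
  sumFin λ v → if nth V v then val (cross (nth D v) (rows v) C) else 0
val-costˡ {zero}  V₀ C G rows V D = refl
val-costˡ {suc n} V₀ C G rows V D = trans (step (hd V) (cross (hd D) (rows zero) C) _)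
  (cong ((if hd V then val (cross (hd D) (rows zero) C) else 0) +_)
        (val-costˡ V₀ C G (rows ∘ suc) (tl V) (tl D)))
  where
  step : ∀ b x r → val (if b then add x r else r) ≡ (if b then val x else 0) + val r
  step true  x r = val-add x r
  step false x r = refl

cutCost : ∀ (V C : Bits) (G : ⟦ graph ⟧) → Bits
cutCost V C G = eval costᵉ (V , C , G , tt)

val-cutCost : ∀ {n} V C (rows : Fin n → ⟦ row ⟧) → val (cutCost V C (tabulate rows)) ≡
  sumFin λ v → if nth V v then val (cross (nth C v) (rows v) C) else 0
val-cutCost V C rows = val-costˡ V C _ rows V C

touched-reflectsˡ : ∀ {n} R s₀ b (r : Fin n → List Bits) s →
  Reflects (∃[ v ] (¬ r v ≡ []) × (b ≡ true ⊎ nth s v ≡ true))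
           (evalRec touchedˡ (R , s₀ , b , tt) (tabulate r) s)
touched-reflectsˡ {zero}  R s₀ b r s = ofⁿ λ ()
touched-reflectsˡ {suc n} R s₀ b r s =
  step (r zero) refl b (hd s) refl refl (touched-reflectsˡ R s₀ b (r ∘ suc) (tl s))
  where
  Q : Fin (suc n) → Set
  Q v = (¬ r v ≡ []) × (b ≡ true ⊎ nth s v ≡ true)
  nonempty : ∀ {k ks} → r zero ≡ k ∷ ks → ¬ r zero ≡ []
  nonempty p q with () ← trans (sym p) q
  later : ∀ {x} → ¬ Q zero → Reflects (∃[ v ] Q (suc v)) x → Reflects (∃[ v ] Q v) x
  later ¬q = Reflects-map (λ (v , q) → suc v , q)
    λ { (zero , q) → ⊥-elim (¬q q) ; (suc v , q) → v , q }
  step : ∀ {x} e → r zero ≡ e → ∀ b′ h → b ≡ b′ → hd s ≡ h →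
    Reflects (∃[ v ] Q (suc v)) x →
    Reflects (∃[ v ] Q v)
      (matchList e x λ _ _ → if b′ then true else (if h then true else x))
  step [] p b′ h pb ph R = later (λ q → proj₁ q p) R
  step (k ∷ ks) p true h pb ph R = ofʸ (zero , nonempty p , inj₁ pb)
  step (k ∷ ks) p false true pb ph R = ofʸ (zero , nonempty p , inj₂ ph)
  step (k ∷ ks) p false false pb ph R = later (λ { (_ , inj₁ q) → false≢true pb q
                                                 ; (_ , inj₂ q) → false≢true ph q }) R

touched : ⟦ row ⟧ → Bits → Bool → Bool
touched r s b = eval touchedᵉ (r , s , b , tt)

boundaryˡ-tabulate : ∀ {n} G s (rows : Fin n → ⟦ row ⟧) t →
  evalRec boundaryˡ (G , s , tt) (tabulate rows) t ≡ tabulate λ u → touched (rows u) s (nth t u)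
boundaryˡ-tabulate {zero}  G s rows t = refl
boundaryˡ-tabulate {suc n} G s rows t = cong (touched (rows zero) s (hd t) ∷_) (boundaryˡ-tabulate G s (rows ∘ suc) (tl t))

boundary : ⟦ graph ⟧ → Bits → Bits
boundary G s = eval boundaryᵉ (G , s , tt)

consAll : Bool → List Bits → List Bits → List Bits
consAll b l acc = eval consAllᵉ (b , l , acc , tt)

consAllˡ-map : ∀ b l₀ acc l q → evalRec consAllˡ (b , l₀ , acc , tt) l q ≡ map (b ∷_) l ++ acc
consAllˡ-map b l₀ acc []      q = refl
consAllˡ-map b l₀ acc (C ∷ l) q = cong ((b ∷ C) ∷_) (consAllˡ-map b l₀ acc l _)

consAll-map : ∀ b l acc → consAll b l acc ≡ map (b ∷_) l ++ acc
consAll-map b l acc = consAllˡ-map b l acc l false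

assignments : Bits → List Bits
assignments P = eval assignmentsᵉ (P , tt)

popcount : ∀ {n} → (Fin n → Bool) → ℕ
popcount P = sumFin λ u → if P u then 1 else 0

extend : Bool → List Bits → List Bits
extend true  l = map (false ∷_) l ++ map (true ∷_) l
extend false l = map (false ∷_) l

assignmentsˡ-∷ : ∀ γ p P q →
  evalRec assignmentsˡ γ (p ∷ P) q ≡ extend p (evalRec assignmentsˡ γ P false)
assignmentsˡ-∷ γ p P q = step p (evalRec assignmentsˡ γ P false)
  where
  consAll-[] : ∀ b l → consAll b l [] ≡ map (b ∷_) l
  consAll-[] b l = trans (consAll-map b l []) (++-identityʳ (map (b ∷_) l))
  step : ∀ p l → (if p then consAll false l (consAll true l []) else consAll false l []) ≡ extend p l
  step true  l = trans (consAll-map false l (consAll true l []))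
                       (cong (map (false ∷_) l ++_) (consAll-[] true l))
  step false l = consAll-[] false l

length-extend : ∀ p l → length (extend p l) ≡ 2 ^ (if p then 1 else 0) * length l
length-extend true  l = trans (length-++ (map (false ∷_) l))
  (cong₂ _+_ (length-map _ l) (trans (length-map _ l) (sym (+-identityʳ _))))
length-extend false l = trans (length-map _ l) (sym (+-identityʳ _))

length-assignmentsˡ : ∀ {n} γ (P : Fin n → Bool) q →
  length (evalRec assignmentsˡ γ (tabulate P) q) ≡ 2 ^ popcount P
length-assignmentsˡ {zero}  γ P q = refl
length-assignmentsˡ {suc n} γ P q = begin
  length (evalRec assignmentsˡ γ (tabulate P) q) ≡⟨ cong length (assignmentsˡ-∷ γ (P zero) (tabulate (P ∘ suc)) q) ⟩
  length (extend (P zero) l) ≡⟨ length-extend (P zero) l ⟩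
  2 ^ b * length l ≡⟨ cong (2 ^ b *_) (length-assignmentsˡ γ (P ∘ suc) false) ⟩
  2 ^ b * 2 ^ popcount (P ∘ suc) ≡⟨ ^-distribˡ-+-* 2 b (popcount (P ∘ suc)) ⟨
  2 ^ popcount P ∎
  where
  open ≡-Reasoning
  b = if P zero then 1 else 0
  l = evalRec assignmentsˡ γ (tabulate (P ∘ suc)) false

assignmentsˡ-complete : ∀ {n} γ (P f : Fin n → Bool) q →
  ∃[ α ] α ∈ evalRec assignmentsˡ γ (tabulate P) q × (∀ u → P u ≡ true → nth α u ≡ f u)
assignmentsˡ-complete {zero}  γ P f q = [] , here refl , λ ()
assignmentsˡ-complete {suc n} γ P f q =
  let α , α∈ , h = assignmentsˡ-complete γ (P ∘ suc) (f ∘ suc) false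
      b , b∈ , e = extend-complete (P zero) (f zero) α∈
  in b ∷ α , subst ((b ∷ α) ∈_) (sym (assignmentsˡ-∷ γ (P zero) (tabulate (P ∘ suc)) q)) b∈ ,
     λ { zero → e ; (suc u) → h u }
  where
  extend-complete : ∀ p c {α l} → α ∈ l → ∃[ b ] (b ∷ α) ∈ extend p l × (p ≡ true → b ≡ c)
  extend-complete true  true  {l = l} α∈ = true , ∈-++⁺ʳ (map (false ∷_) l) (∈-map⁺ (true ∷_) α∈) , λ _ → refl
  extend-complete true  false α∈ = false , ∈-++⁺ˡ (∈-map⁺ (false ∷_) α∈) , λ _ → refl
  extend-complete false c     α∈ = false , ∈-map⁺ (false ∷_) α∈ , λ ()

agree : (P α C : Bits) → Bool
agree P α C = eval agreeᵉ (P , α , C , tt)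

agree-reflectsˡ : ∀ {n} γ (P : Fin n → Bool) α C →
  Reflects (∀ u → P u ≡ true → nth α u ≡ nth C u) (evalRec agreeˡ γ (tabulate P) (α , C))
agree-reflectsˡ {zero}  γ P α C = ofʸ λ ()
agree-reflectsˡ {suc n} γ P α C =
  step (P zero) refl (hd α) (hd C) refl refl (agree-reflectsˡ γ (P ∘ suc) (tl α) (tl C))
  where
  Q : Fin (suc n) → Set
  Q u = P u ≡ true → nth α u ≡ nth C u
  step : ∀ {r} p → P zero ≡ p → ∀ a c → hd α ≡ a → hd C ≡ c → Reflects (∀ u → Q (suc u)) r →
    Reflects (∀ u → Q u)
      (if p then (if (if a then (if c then false else true) else c) then false else r) else r)
  step false q a c qa qc R =
    Reflects-map (λ h → λ { zero e → false≢true q e ; (suc u) → h u }) (_∘ suc) R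
  step true q true  true  qa qc R =
    Reflects-map (λ h → λ { zero _ → trans qa (sym qc) ; (suc u) → h u }) (_∘ suc) R
  step true q false false qa qc R =
    Reflects-map (λ h → λ { zero _ → trans qa (sym qc) ; (suc u) → h u }) (_∘ suc) R
  step true q true  false qa qc R = ofⁿ λ h → false≢true (trans (h zero q) qc) qa
  step true q false true  qa qc R = ofⁿ λ h → false≢true qa (trans (h zero q) qc)

agree-reflects : ∀ {n} (P : Fin n → Bool) α C →
  Reflects (∀ u → P u ≡ true → nth α u ≡ nth C u) (agree (tabulate P) α C)
agree-reflects P α C = agree-reflectsˡ _ P α C

module _ (P α V : Bits) (G : ⟦ graph ⟧) where

  Candidate : Bits → Set
  Candidate C = agree P α C ≡ true × valid V C G ≡ true

  bestStep : Bits → List Bits → List Bits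
  bestStep C r =
    if agree P α C then
      if valid V C G then
        matchList r (C ∷ []) (λ D _ → if leq (cutCost V C G) (cutCost V D G) then C ∷ [] else r)
      else r
    else r

  data BestStep (C : Bits) (r : List Bits) : List Bits → Set where
    skip : ¬ Candidate C → BestStep C r r
    keep : ∀ {D Ds} → Candidate C → r ≡ D ∷ Ds → val (cutCost V D G) ≤ val (cutCost V C G) →
           BestStep C r r
    take : Candidate C → (∀ {D Ds} → r ≡ D ∷ Ds → val (cutCost V C G) ≤ val (cutCost V D G)) →
           BestStep C r (C ∷ [])

  bestStep-view : ∀ C r → BestStep C r (bestStep C r)
  bestStep-view C r = go (agree P α C) refl (valid V C G) refl r
    where
    go : ∀ a → agree P α C ≡ a → ∀ v → valid V C G ≡ v → ∀ r → BestStep C r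
      (if a then
        (if v then matchList r (C ∷ []) (λ D _ → if leq (cutCost V C G) (cutCost V D G) then C ∷ [] else r)
         else r)
       else r)
    go false ea v ev r = skip λ (h , _) → false≢true ea h
    go true ea false ev r = skip λ (_ , h) → false≢true ev h
    go true ea true ev [] = take (ea , ev) λ ()
    go true ea true ev (D ∷ Ds) =
      choose (leq (cutCost V C G) (cutCost V D G))
             (leq-reflects _ (cutCost V C G) false (cutCost V D G))
      where
      choose : ∀ b → Reflects (val (cutCost V C G) ≤ val (cutCost V D G)) b →
               BestStep C (D ∷ Ds) (if b then C ∷ [] else (D ∷ Ds))
      choose true  (ofʸ h)  = take (ea , ev) λ { refl → h }
      choose false (ofⁿ ¬h) = keep (ea , ev) refl (≰⇒≥ ¬h)

  bestOf : List Bits → List Bits → Bool → List Bits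
  bestOf L₀ L q = evalRec bestˡ (P , α , V , G , L₀ , tt) L q

  best-candidate : ∀ L₀ L q {D Ds} → bestOf L₀ L q ≡ D ∷ Ds → Candidate D
  best-candidate L₀ (C ∷ L) q e
    with bestStep C (bestOf L₀ L false) | bestStep-view C (bestOf L₀ L false)
  ... | _ | skip _     = best-candidate L₀ L false e
  ... | _ | keep _ _ _ = best-candidate L₀ L false e
  best-candidate L₀ (C ∷ L) q refl | _ | take c _ = c

  best-optimal : ∀ L₀ L q {C} → C ∈ L → Candidate C →
    ∃[ D ] ∃[ Ds ] bestOf L₀ L q ≡ D ∷ Ds × val (cutCost V D G) ≤ val (cutCost V C G)
  best-optimal L₀ (C ∷ L) q (here refl) c
    with bestStep C (bestOf L₀ L false) | bestStep-view C (bestOf L₀ L false)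
  ... | _ | skip ¬c    = ⊥-elim (¬c c)
  ... | _ | keep _ e h = _ , _ , e , h
  ... | _ | take _ _   = _ , _ , refl , ≤-refl
  best-optimal L₀ (C ∷ L) q (there C∈) c
    with best-optimal L₀ L false C∈ c
       | bestStep C (bestOf L₀ L false) | bestStep-view C (bestOf L₀ L false)
  ... | D , Ds , e , h | _ | skip _      = D , Ds , e , h
  ... | D , Ds , e , h | _ | keep _ _ _  = D , Ds , e , h
  ... | D , Ds , e , h | _ | take _ h′   = _ , _ , refl , ≤-trans (h′ e) h

best : (P α V : Bits) → ⟦ graph ⟧ → List Bits → List Bits
best P α V G L = eval bestᵉ (P , α , V , G , L , tt)

prune : (P V : Bits) → ⟦ graph ⟧ → List Bits → List Bits
prune P V G L = eval pruneᵉ (P , V , G , L , tt)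

pruneStep : List Bits → List Bits → List Bits
pruneStep b r = matchList b r λ C _ → C ∷ r

length-pruneˡ : ∀ γ αs q → length (evalRec pruneˡ γ αs q) ≤ length αs
length-pruneˡ γ []       q = z≤n
length-pruneˡ γ@(P , V , G , L , tt) (α ∷ αs) q =
  step (best P α V G L) (length-pruneˡ γ αs false)
  where
  step : ∀ b {r k} → length r ≤ k → length (pruneStep b r) ≤ suc k
  step []      h = m≤n⇒m≤1+n h
  step (_ ∷ _) h = s≤s h

∈-pruneˡ : ∀ P V G L αs q {α D Ds} → α ∈ αs → best P α V G L ≡ D ∷ Ds →
           D ∈ evalRec pruneˡ (P , V , G , L , tt) αs q
∈-pruneˡ P V G L (α ∷ αs) q {D = D} (here refl) e =
  subst (λ b → D ∈ pruneStep b (evalRec pruneˡ (P , V , G , L , tt) αs false)) (sym e) (here refl)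
∈-pruneˡ P V G L (α ∷ αs) q {D = D} (there α∈) e =
  step (best P α V G L) (∈-pruneˡ P V G L αs false α∈ e)
  where
  step : ∀ b {r} → D ∈ r → D ∈ pruneStep b r
  step []      h = h
  step (_ ∷ _) h = there h

-- The entry is found in the slot of the assignment `α` that equals `C` on `P`. There `C` itself is
-- a candidate, so the slot is filled, and its winner `D` costs no more and agrees with `α`, hence
-- with `C`, on `P`.
prune-spec : ∀ {n} (P : Fin n → Bool) V G L {C} → C ∈ L → valid V C G ≡ true →
  ∃[ D ] D ∈ prune (tabulate P) V G L × (∀ u → P u ≡ true → nth D u ≡ nth C u) ×
         valid V D G ≡ true × val (cutCost V D G) ≤ val (cutCost V C G)
prune-spec P V G L {C} C∈ C-valid =
  let α , α∈ , αC = assignmentsˡ-complete (tabulate P , tt) P (nth C) false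
      C-agrees = true-Reflects (agree-reflects P α C) αC
      D , Ds , e , h = best-optimal (tabulate P) α V G L L false C∈ (C-agrees , C-valid)
      D-agrees , D-valid = best-candidate (tabulate P) α V G L L false e
      αD = Reflects-true (agree-reflects P α D) D-agrees
  in D , ∈-pruneˡ (tabulate P) V G L _ false α∈ e ,
     (λ u p → trans (sym (αD u p)) (αC u p)) , D-valid , h

length-prune : ∀ {n} (P : Fin n → Bool) V G L → length (prune (tabulate P) V G L) ≤ 2 ^ popcount P
length-prune P V G L = ≤-trans (length-pruneˡ (tabulate P , V , G , L , tt) (assignments (tabulate P)) false)
  (≤-reflexive (length-assignmentsˡ (tabulate P , tt) P false))

patch : (V D C : Bits) → Bits
patch V D C = eval patchᵉ (V , D , C , tt)

nth-patchˡ : ∀ {n} γ (V : Fin n → Bool) D C u →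
  nth (evalRec patchˡ γ (tabulate V) (D , C)) u ≡ (if V u then nth D u else nth C u)
nth-patchˡ γ V D C zero    = refl
nth-patchˡ γ V D C (suc u) = nth-patchˡ γ (V ∘ suc) (tl D) (tl C) u

merge : (V : Bits) → List Bits → List Bits → List Bits
merge V L₁ L₂ = eval mergeᵉ (V , L₁ , L₂ , tt)

patchAllˡ-map : ∀ V C L₀ acc L q →
  evalRec patchAllˡ (V , C , L₀ , acc , tt) L q ≡ map (λ D → patch V D C) L ++ acc
patchAllˡ-map V C L₀ acc []      q = refl
patchAllˡ-map V C L₀ acc (D ∷ L) q = cong (patch V D C ∷_) (patchAllˡ-map V C L₀ acc L false)

mergeˡ-∷ : ∀ V L₀ L₂ C L₁ q → evalRec mergeˡ (V , L₀ , L₂ , tt) (C ∷ L₁) q ≡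
  map (λ D → patch V D C) L₂ ++ evalRec mergeˡ (V , L₀ , L₂ , tt) L₁ false
mergeˡ-∷ V L₀ L₂ C L₁ q =
  patchAllˡ-map V C L₂ (evalRec mergeˡ (V , L₀ , L₂ , tt) L₁ false) L₂ false

length-mergeˡ : ∀ V L₀ L₂ L₁ q →
  length (evalRec mergeˡ (V , L₀ , L₂ , tt) L₁ q) ≡ length L₁ * length L₂
length-mergeˡ V L₀ L₂ []       q = refl
length-mergeˡ V L₀ L₂ (C ∷ L₁) q = trans (cong length (mergeˡ-∷ V L₀ L₂ C L₁ q))
  (trans (length-++ (map (λ D → patch V D C) L₂))
         (cong₂ _+_ (length-map (λ D → patch V D C) L₂) (length-mergeˡ V L₀ L₂ L₁ false)))

∈-mergeˡ : ∀ V L₀ L₂ L₁ q {C D} → C ∈ L₁ → D ∈ L₂ →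
           patch V D C ∈ evalRec mergeˡ (V , L₀ , L₂ , tt) L₁ q
∈-mergeˡ V L₀ L₂ (C ∷ L₁) q {D = D} (here refl) D∈ =
  subst (patch V D C ∈_) (sym (mergeˡ-∷ V L₀ L₂ C L₁ q)) (∈-++⁺ˡ (∈-map⁺ (λ D → patch V D C) D∈))
∈-mergeˡ V L₀ L₂ (B ∷ L₁) q {C} {D} (there C∈) D∈ =
  subst (patch V D C ∈_) (sym (mergeˡ-∷ V L₀ L₂ B L₁ q))
    (∈-++⁺ʳ (map (λ D → patch V D B) L₂) (∈-mergeˡ V L₀ L₂ L₁ false C∈ D∈))

union : Bits → Bits → Bits
union U V = eval unionᵉ (U , V , tt)

unionˡ-tabulate : ∀ {n} γ (U : Fin n → Bool) V →
  evalRec unionˡ γ (tabulate U) V ≡ tabulate λ u → U u ∨ nth V u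
unionˡ-tabulate {zero}  γ U V = refl
unionˡ-tabulate {suc n} γ U V = cong₂ _∷_ (step (U zero)) (unionˡ-tabulate γ (U ∘ suc) (tl V))
  where
  step : ∀ b → (if b then true else hd V) ≡ b ∨ hd V
  step true  = refl
  step false = refl

union-tabulate : ∀ {n} (U V : Fin n → Bool) →
  union (tabulate U) (tabulate V) ≡ tabulate λ u → U u ∨ V u
union-tabulate U V = trans (unionˡ-tabulate _ U (tabulate V))
  (tabulate-cong λ u → cong (U u ∨_) (nth-tabulate V u))

resizeˡ-tabulate : ∀ {n} γ (rows : Fin n → ⟦ row ⟧) C →
  evalRec resizeˡ γ (tabulate rows) C ≡ tabulate {n = n} (nth C)
resizeˡ-tabulate {zero}  γ rows C = refl
resizeˡ-tabulate {suc n} γ rows C = cong (hd C ∷_) (resizeˡ-tabulate γ (rows ∘ suc) (tl C))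

-- Running times

incBound : ℕ → ℕ
incBound k = bound incᵉ (rounds incˡ k 0)

cost-inc : ∀ {k} x → length x ≤ k → cost incᵉ (x , tt) ≤ incBound k
cost-inc x h = cost≤bound incᵉ (x , tt)
  (_ , _ , costRec≤ _ _ _ _ 0 (λ _ _ → ⊤) (λ _ _ → _) (λ _ _ _ _ → _) x false _ h)

length-incˡ : ∀ γ x q → length (evalRec incˡ γ x q) ≤ suc (length x)
length-incˡ γ []          q = ≤-refl
length-incˡ γ (true ∷ x)  q = n≤1+n _
length-incˡ γ (false ∷ x) q = s≤s (length-incˡ γ x false)

-- Crude, but additive under repeated addition: no logarithm of the number of summands has to be
-- tracked when whole rows are summed.
length-addˡ : ∀ γ x y → length (evalRec addˡ γ x y) ≤ length x + length y
length-addˡ γ []      y       = ≤-refl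
length-addˡ γ (d ∷ x) []      = s≤s (m≤m+n _ 0)
length-addˡ γ (d ∷ x) (e ∷ y) = step d e (evalRec addˡ γ x y) (length-addˡ γ x y)
  where
  step : ∀ d e r → length r ≤ length x + length y →
    length (if d then (if e then false ∷ r else (true ∷ inc r))
                 else (if e then true ∷ inc r else (false ∷ inc r)))
    ≤ suc (length x) + suc (length y)
  -- Each operand has given up a digit: one pays for the digit that is output, the other for the
  -- growth of the tail by the carry.
  carry : ∀ r → length r ≤ length x + length y → suc (length (inc r)) ≤ suc (length x) + suc (length y)
  carry r h = s≤s (≤-trans (length-incˡ _ r false)
    (≤-trans (s≤s h) (≤-reflexive (sym (+-suc (length x) (length y))))))
  step true  true  r h = s≤s (≤-trans h (+-monoʳ-≤ (length x) (n≤1+n _)))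
  step true  false r h = carry r h
  step false true  r h = carry r h
  step false false r h = carry r h

length-tl : ∀ x {k} → length x ≤ k → length (tl x) ≤ k
length-tl []      h = h
length-tl (_ ∷ x) h = ≤-trans (n≤1+n _) h

-- Carries are added to sums of tails, whose length is at most `k + l`.
addBound : ℕ → ℕ → ℕ
addBound k l = bound addᵉ (rounds addˡ k (incBound (k + l)))

cost-add : ∀ {k l} x y → length x ≤ k → length y ≤ l → cost addᵉ (x , y , tt) ≤ addBound k l
cost-add {k} {l} x y hx hy = cost≤bound addᵉ (x , y , tt)
  (_ , _ , costRec≤ _ _ _ _ (incBound (k + l)) (λ x y → length x ≤ k × length y ≤ l)
    (λ _ _ → _)
    (λ d x y (hx , hy) →
      let hx′ = ≤-trans (n≤1+n _) hx
          hy′ = length-tl y hy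
          inc≤ = cost-inc (evalRec addˡ _ x (tl y))
                   (≤-trans (length-addˡ _ x (tl y)) (+-mono-≤ hx′ hy′))
      in _ , (hx′ , hy′) , (_ , _ , λ _ _ _ → _ , (_ , _ , _ , _ , inc≤) , _ , (_ , _ , inc≤) , _ , _ , inc≤))
    x y (hx , hy) hx)

leqBound : ℕ → ℕ
leqBound k = bound leqᵉ (rounds leqˡ k 0)

cost-leq : ∀ {k} s x y → length x ≤ k → cost leqᵉ (s , x , y , tt) ≤ leqBound k
cost-leq s x y h = cost≤bound leqᵉ (s , x , y , tt)
  (_ , _ , costRec≤ _ _ _ _ 0 (λ _ _ → ⊤) (λ _ _ → _) (λ _ _ _ _ → _) x (s , y) _ h)

crossBound stableAtBound validBound costBound touchedBound boundaryBound consAllBound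
  assignmentsBound agreeBound bestBound pruneBound patchBound patchAllBound mergeBound
  unionBound leafBound prunedBound joinBound resizeBound answerBound : ℕ → ℕ
crossBound       M = bound crossᵉ (rounds crossˡ M (addBound M M))
stableAtBound    M = bound stableAtᵉ (leqBound M + crossBound M)
validBound       M = bound validᵉ (rounds validˡ M (stableAtBound M))
costBound        M = bound costᵉ (rounds costˡ M (addBound M M + crossBound M))
touchedBound     M = bound touchedᵉ (rounds touchedˡ M 0)
boundaryBound    M = bound boundaryᵉ (rounds boundaryˡ M (touchedBound M))
consAllBound     M = bound consAllᵉ (rounds consAllˡ M 0)
assignmentsBound M = bound assignmentsᵉ (rounds assignmentsˡ M (consAllBound M))
agreeBound       M = bound agreeᵉ (rounds agreeˡ M 0)
-- Two tables of at most `M` entries merge into as many as `M * M` candidates before pruning.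
bestBound        M = bound bestᵉ (rounds bestˡ (M * M)
                       (agreeBound M + (validBound M + (leqBound M + costBound M))))
pruneBound       M = bound pruneᵉ (assignmentsBound M + rounds pruneˡ M (bestBound M))
patchBound       M = bound patchᵉ (rounds patchˡ M 0)
patchAllBound    M = bound patchAllᵉ (rounds patchAllˡ M (patchBound M))
mergeBound       M = bound mergeᵉ (rounds mergeˡ M (patchAllBound M))
unionBound       M = bound unionᵉ (rounds unionˡ M 0)
leafBound        M = bound leafᵉ (assignmentsBound M + boundaryBound M)
prunedBound      M = bound prunedᵉ (boundaryBound M + pruneBound M)
joinBound        M = bound joinᵉ (unionBound M + (mergeBound M + prunedBound M))
resizeBound      M = bound resizeᵉ (rounds resizeˡ M 0)
answerBound      M = bound answerᵉ (resizeBound M + bestBound M)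

-- The intermediate lists of the recursion are no longer than the final one, so a bound on the final
-- table covers the cost of every round.
length-assignmentsˡ-∷ : ∀ γ p P q → length (evalRec assignmentsˡ γ P false)
                      ≤ length (evalRec assignmentsˡ γ (p ∷ P) q)
length-assignmentsˡ-∷ γ p P q = ≤-trans (extend≤ p (evalRec assignmentsˡ γ P false))
  (≤-reflexive (cong length (sym (assignmentsˡ-∷ γ p P q))))
  where
  extend≤ : ∀ p l → length l ≤ length (extend p l)
  extend≤ p l = ≤-trans (m≤m*n′ p) (≤-reflexive (sym (length-extend p l)))
    where
    m≤m*n′ : ∀ p → length l ≤ 2 ^ (if p then 1 else 0) * length l
    m≤m*n′ true  = m≤m+n _ _
    m≤m*n′ false = m≤m+n _ _

SmallBoundary : ℕ → Bits → Set
SmallBoundary M P = length P ≤ M × length (assignments P) ≤ M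

module _ (n ℓ : ℕ) where

  SmallEntry : List Bits → Set
  SmallEntry e = ∀ k ks → e ≡ k ∷ ks → length k ≤ ℓ

  SmallRow : ⟦ row ⟧ → Set
  SmallRow r = length r ≤ n × All SmallEntry r

  SmallGraph : ⟦ graph ⟧ → Set
  SmallGraph G = length G ≤ n × All SmallRow G

  length-crossˡ : ∀ c R C₀ {r} → All SmallEntry r → ∀ C →
    length (evalRec crossˡ (c , R , C₀ , tt) r C) ≤ length r * ℓ
  length-crossˡ c R C₀ [] C = z≤n
  length-crossˡ c R C₀ {e ∷ r} (se ∷ sr) C =
    step (eval (xorᵉ {bool ∷ bool ∷ []} (var zero) (var (suc zero))) (c , hd C , tt))
         e se (evalRec crossˡ (c , R , C₀ , tt) r (tl C)) (length-crossˡ c R C₀ sr (tl C))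
    where
    step : ∀ b e → SmallEntry e → ∀ x → length x ≤ length r * ℓ →
      length (if b then matchList e x (λ k _ → add k x) else x) ≤ ℓ + length r * ℓ
    step false e       se x h = m≤n⇒m≤o+n ℓ h
    step true  []      se x h = m≤n⇒m≤o+n ℓ h
    step true  (k ∷ _) se x h = ≤-trans (length-addˡ _ k x) (+-mono-≤ (se k _ refl) h)

  length-cross : ∀ c {r} C → SmallRow r → length (cross c r C) ≤ n * ℓ
  length-cross c {r} C (h , sr) = ≤-trans (length-crossˡ c r C sr C) (*-monoˡ-≤ ℓ h)

  length-costˡ : ∀ V₀ C G {rows} → All SmallRow rows → ∀ V D →
    length (evalRec costˡ (V₀ , C , G , tt) rows (V , D)) ≤ length rows * (n * ℓ)
  length-costˡ V₀ C G [] V D = z≤n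
  length-costˡ V₀ C G {r ∷ rows} (sr ∷ srs) V D =
    step (hd V) (evalRec costˡ (V₀ , C , G , tt) rows (tl V , tl D))
         (length-costˡ V₀ C G srs (tl V) (tl D))
    where
    step : ∀ b x → length x ≤ length rows * (n * ℓ) →
      length (if b then add (cross (hd D) r C) x else x) ≤ n * ℓ + length rows * (n * ℓ)
    step false x h = m≤n⇒m≤o+n (n * ℓ) h
    step true  x h =
      ≤-trans (length-addˡ _ (cross (hd D) r C) x) (+-mono-≤ (length-cross (hd D) C sr) h)

  -- With additive lengths, a crossing degree is a sum of `n` weights and has at most `n * ℓ`
  -- digits, and a cost is a sum of `n` crossing degrees. The last field is the origin of the cube
  -- in the choice of `M`.
  record Size (M : ℕ) : Set where
    field
      n≤M   : n ≤ M
      ℓ≤M   : ℓ ≤ M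
      nℓ≤M  : n * ℓ ≤ M
      nnℓ≤M : n * (n * ℓ) ≤ M

  module _ {M : ℕ} (size : Size M) where
    open Size size

    cost-cross : ∀ c {r} C → SmallRow r → cost crossᵉ (c , r , C , tt) ≤ crossBound M
    cost-cross c {r₀} C₀ (h , sr) = cost≤bound crossᵉ (c , r₀ , C₀ , tt)
      (_ , _ , costRec≤ _ _ _ _ (addBound M M)
        (λ r _ → All SmallEntry r × length r * ℓ ≤ M)
        (λ _ _ → _)
        (λ { e r C (se ∷ sr , h) →
          let h′ = ≤-trans (m≤n+m _ ℓ) h in
          _ , (sr , h′) ,
          _ , (_ , _ , λ k ks eq → _ ,
            cost-add k (evalRec crossˡ (c , r₀ , C₀ , tt) r (tl C)) (≤-trans (se k ks eq) ℓ≤M)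
              (≤-trans (length-crossˡ c r₀ C₀ sr (tl C)) h′)) , _ })
        r₀ C₀ (sr , ≤-trans (*-monoˡ-≤ ℓ h) nℓ≤M) (≤-trans h n≤M))

    cost-stableAt : ∀ c {r} C → SmallRow r → cost stableAtᵉ (c , r , C , tt) ≤ stableAtBound M
    cost-stableAt c {r} C sr = cost≤bound stableAtᵉ (c , r , C , tt)
      ((_ , (_ , cross≤ (eval (notᵉ (var zero)) (c , tt))) , (_ , cross≤ c) , _) ,
       ≤-trans (cost-leq false (cross c′ r C) (cross c r C) (≤-trans (length-cross c′ C sr) nℓ≤M))
               (m≤m+n _ _))
      where
      c′ = eval (notᵉ (var zero)) (c , tt)
      cross≤ : ∀ c → cost crossᵉ (c , r , C , tt) ≤ leqBound M + crossBound M
      cross≤ c = m≤n⇒m≤o+n _ (cost-cross c C sr)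

    cost-valid : ∀ V C {G} → SmallGraph G → cost validᵉ (V , C , G , tt) ≤ validBound M
    cost-valid V C {G} (h , srs) = cost≤bound validᵉ (V , C , G , tt)
      (_ , _ , costRec≤ _ _ _ _ (stableAtBound M) (λ rows _ → All SmallRow rows)
        (λ _ _ → _)
        (λ { r rows (V , D) (sr ∷ srs) →
          _ , srs , _ , ((_ , cost-stableAt (hd D) C sr) , _) , _ })
        G (V , C) srs (≤-trans h n≤M))

    cost-cost : ∀ V C {G} → SmallGraph G → cost costᵉ (V , C , G , tt) ≤ costBound M
    cost-cost V₀ C {G} (h , srs) = cost≤bound costᵉ (V₀ , C , G , tt)
      (_ , _ , costRec≤ _ _ _ _ (addBound M M + crossBound M)
        (λ rows _ → All SmallRow rows × length rows * (n * ℓ) ≤ M)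
        (λ _ _ → _)
        (λ { r rows (V , D) (sr ∷ srs , h) →
          let h′ = ≤-trans (m≤n+m _ (n * ℓ)) h
              add≤ = cost-add (cross (hd D) r C) (evalRec costˡ (V₀ , C , G , tt) rows (tl V , tl D))
                       (≤-trans (length-cross (hd D) C sr) nℓ≤M)
                       (≤-trans (length-costˡ V₀ C G srs (tl V) (tl D)) h′)
          in _ , (srs , h′) ,
             _ , (((_ , m≤n⇒m≤o+n (addBound M M) (cost-cross (hd D) C sr)) , _) ,
                  ≤-trans add≤ (m≤m+n _ _)) , _ })
        G (V₀ , C) (srs , ≤-trans (*-monoˡ-≤ (n * ℓ) h) nnℓ≤M) (≤-trans h n≤M))

    length-cutCost : ∀ V C {G} → SmallGraph G → length (cutCost V C G) ≤ M
    length-cutCost V C {G} (h , srs) =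
      ≤-trans (length-costˡ V C G srs V C) (≤-trans (*-monoˡ-≤ (n * ℓ) h) nnℓ≤M)

    cost-touched : ∀ {r} s b → SmallRow r → cost touchedᵉ (r , s , b , tt) ≤ touchedBound M
    cost-touched {r} s b (h , _) = cost≤bound touchedᵉ (r , s , b , tt)
      (_ , _ , costRec≤ _ _ _ _ 0 (λ _ _ → ⊤) (λ _ _ → _) (λ _ _ _ _ → _) r s _ (≤-trans h n≤M))

    cost-boundary : ∀ {G} s → SmallGraph G → cost boundaryᵉ (G , s , tt) ≤ boundaryBound M
    cost-boundary {G} s (h , srs) = cost≤bound boundaryᵉ (G , s , tt)
      (_ , _ , costRec≤ _ _ _ _ (touchedBound M) (λ rows _ → All SmallRow rows)
        (λ _ _ → _)
        (λ { r rows t (sr ∷ srs) → _ , srs , (_ , cost-touched s (hd t) sr) , _ })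
        G s srs (≤-trans h n≤M))

    cost-consAll : ∀ b l acc → length l ≤ M → cost consAllᵉ (b , l , acc , tt) ≤ consAllBound M
    cost-consAll b l acc h = cost≤bound consAllᵉ (b , l , acc , tt)
      (_ , _ , costRec≤ _ _ _ _ 0 (λ _ _ → ⊤) (λ _ _ → _) (λ _ _ _ _ → _) l false _ h)

    cost-assignments : ∀ P → length P ≤ M → length (assignments P) ≤ M →
                       cost assignmentsᵉ (P , tt) ≤ assignmentsBound M
    cost-assignments P₀ hP h = cost≤bound assignmentsᵉ (P₀ , tt)
      (_ , _ , costRec≤ _ _ _ _ (consAllBound M)
        (λ P q → length (evalRec assignmentsˡ (P₀ , tt) P q) ≤ M)
        (λ _ _ → _)
        (λ p P q h →
          let h′ = ≤-trans (length-assignmentsˡ-∷ (P₀ , tt) p P q) h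
              r = evalRec assignmentsˡ (P₀ , tt) P false
          in _ , h′ , _ ,
             ((_ , _ , (_ , cost-consAll true r [] h′) , _) , cost-consAll false r _ h′) ,
             (_ , cost-consAll false r [] h′))
        P₀ false h hP)

    cost-agree : ∀ P α C → length P ≤ M → cost agreeᵉ (P , α , C , tt) ≤ agreeBound M
    cost-agree P α C h = cost≤bound agreeᵉ (P , α , C , tt)
      (_ , _ , costRec≤ _ _ _ _ 0 (λ _ _ → ⊤) (λ _ _ → _) (λ _ _ _ _ → _) P (α , C) _ h)

    cost-best : ∀ P α V {G} L → length P ≤ M → SmallGraph G → length L ≤ M * M →
                cost bestᵉ (P , α , V , G , L , tt) ≤ bestBound M
    cost-best P α V {G} L hP sG hL = cost≤bound bestᵉ (P , α , V , G , L , tt)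
      (_ , _ , costRec≤ _ _ _ _ B (λ _ _ → ⊤) (λ _ _ → _)
        (λ C L _ _ → _ , _ ,
          (_ , ≤-trans (cost-agree P α C hP) (m≤m+n _ _)) ,
          ((_ , m≤n⇒m≤o+n a (≤-trans (cost-valid V C sG) (m≤m+n _ _))) ,
           (_ , _ , λ D Ds _ →
             ((_ , (_ , cost≤ C) , (_ , cost≤ D) , _) ,
              m≤n⇒m≤o+n a (m≤n⇒m≤o+n v (≤-trans
                (cost-leq false (cutCost V C G) (cutCost V D G) (length-cutCost V C sG)) (m≤m+n _ _)))) ,
             _) , _) ,
          _)
        L false _ hL)
      where
      a = agreeBound M
      v = validBound M
      B = a + (v + (leqBound M + costBound M))
      cost≤ : ∀ C → cost costᵉ (V , C , G , tt) ≤ B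
      cost≤ C = m≤n⇒m≤o+n a (m≤n⇒m≤o+n v (m≤n⇒m≤o+n (leqBound M) (cost-cost V C sG)))

    cost-prune : ∀ P V {G} L → length P ≤ M → length (assignments P) ≤ M → SmallGraph G →
                 length L ≤ M * M → cost pruneᵉ (P , V , G , L , tt) ≤ pruneBound M
    cost-prune P V {G} L hP hA sG hL = cost≤bound pruneᵉ (P , V , G , L , tt)
      ((_ , ≤-trans (cost-assignments P hP hA) (m≤m+n _ _)) , _ ,
       m≤n⇒m≤o+n (assignmentsBound M)
        (costRec≤ _ _ _ _ (bestBound M) (λ _ _ → ⊤) (λ _ _ → _)
          (λ α αs _ _ → _ , _ , (_ , cost-best P α V L hP sG hL) , _)
          (assignments P) false _ hA))

    cost-patch : ∀ V D C → length V ≤ M → cost patchᵉ (V , D , C , tt) ≤ patchBound M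
    cost-patch V D C h = cost≤bound patchᵉ (V , D , C , tt)
      (_ , _ , costRec≤ _ _ _ _ 0 (λ _ _ → ⊤) (λ _ _ → _) (λ _ _ _ _ → _) V (D , C) _ h)

    cost-patchAll : ∀ V C L acc → length V ≤ M → length L ≤ M →
                    cost patchAllᵉ (V , C , L , acc , tt) ≤ patchAllBound M
    cost-patchAll V C L acc hV h = cost≤bound patchAllᵉ (V , C , L , acc , tt)
      (_ , _ , costRec≤ _ _ _ _ (patchBound M) (λ _ _ → ⊤) (λ _ _ → _)
        (λ D _ _ _ → _ , _ , (_ , cost-patch V D C hV) , _) L false _ h)

    cost-merge : ∀ V L₁ L₂ → length V ≤ M → length L₁ ≤ M → length L₂ ≤ M →
                 cost mergeᵉ (V , L₁ , L₂ , tt) ≤ mergeBound M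
    cost-merge V L₁ L₂ hV h₁ h₂ = cost≤bound mergeᵉ (V , L₁ , L₂ , tt)
      (_ , _ , costRec≤ _ _ _ _ (patchAllBound M) (λ _ _ → ⊤) (λ _ _ → _)
        (λ C L _ _ → _ , _ , (_ , cost-patchAll V C L₂ _ hV h₂)) L₁ false _ h₁)

    cost-union : ∀ U V → length U ≤ M → cost unionᵉ (U , V , tt) ≤ unionBound M
    cost-union U V h = cost≤bound unionᵉ (U , V , tt)
      (_ , _ , costRec≤ _ _ _ _ 0 (λ _ _ → ⊤) (λ _ _ → _) (λ _ _ _ _ → _) U V _ h)

    cost-resize : ∀ {G} C → SmallGraph G → cost resizeᵉ (G , C , tt) ≤ resizeBound M
    cost-resize {G} C (h , _) = cost≤bound resizeᵉ (G , C , tt)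
      (_ , _ , costRec≤ _ _ _ _ 0 (λ _ _ → ⊤) (λ _ _ → _) (λ _ _ _ _ → _) G C _ (≤-trans h n≤M))

    cost-leaf : ∀ {G} s → SmallGraph G → SmallBoundary M (boundary G s) →
                cost leafᵉ (s , G , tt) ≤ leafBound M
    cost-leaf {G} s sG (hP , hA) = cost≤bound leafᵉ (s , G , tt)
      (_ , ((_ , m≤n⇒m≤o+n (assignmentsBound M) (cost-boundary s sG)) , _) ,
       ≤-trans (cost-assignments (boundary G s) hP hA) (m≤m+n _ _))

    cost-pruned : ∀ V s {G} L → SmallGraph G → SmallBoundary M (boundary G s) → length L ≤ M * M →
                  cost prunedᵉ (V , s , G , L , tt) ≤ prunedBound M
    cost-pruned V s {G} L sG (hP , hA) hL = cost≤bound prunedᵉ (V , s , G , L , tt)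
      (_ , ((_ , ≤-trans (cost-boundary s sG) (m≤m+n _ _)) , _) ,
       m≤n⇒m≤o+n (boundaryBound M) (cost-prune (boundary G s) V L hP hA sG hL))

    cost-join : ∀ V₁ L₁ V₂ L₂ s {G} → SmallGraph G → SmallBoundary M (boundary G s) →
                length V₁ ≤ M → length V₂ ≤ M → length L₁ ≤ M → length L₂ ≤ M →
                cost joinᵉ ((V₁ , L₁) , (V₂ , L₂) , s , G , tt) ≤ joinBound M
    cost-join V₁ L₁ V₂ L₂ s {G} sG sB h₁ h₂ k₁ k₂ =
      cost≤bound joinᵉ ((V₁ , L₁) , (V₂ , L₂) , s , G , tt)
      (((_ , ≤-trans (cost-union V₁ V₂ h₁) (m≤m+n _ _)) , _ , _ ,
        (_ , m≤n⇒m≤o+n (unionBound M) (≤-trans (cost-merge V₂ L₁ L₂ h₂ k₁ k₂) (m≤m+n _ _))) , _) ,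
       m≤n⇒m≤o+n (unionBound M) (m≤n⇒m≤o+n (mergeBound M)
         (cost-pruned (union V₁ V₂) s (merge V₂ L₁ L₂) sG sB
           (≤-trans (≤-reflexive (length-mergeˡ V₂ L₁ L₂ L₁ false)) (*-mono-≤ k₁ k₂)))))

    cost-answer : ∀ V L {G} → SmallGraph G → length L ≤ M * M →
                  cost answerᵉ ((V , L) , G , tt) ≤ answerBound M
    cost-answer V L {G} sG hL = cost≤bound answerᵉ ((V , L) , G , tt)
      ((_ , ((_ , m≤n⇒m≤o+n (resizeBound M) (cost-best [] [] V L z≤n sG hL)) , _) , _) ,
       ≤-trans (cost-resize _ sG) (m≤m+n _ _))

-- Polynomial growth of the time bounds

poly-addBound : ∀ {f g} → Polynomial f → Polynomial g → Polynomial (λ M → addBound (f M) (g M))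
poly-addBound p q = poly-bound addᵉ (poly-rounds addˡ p
  (poly-bound incᵉ (poly-rounds incˡ (poly-+ p q) (poly-const 0))))

poly-leqBound : Polynomial leqBound
poly-leqBound = poly-bound leqᵉ (poly-rounds leqˡ poly-id (poly-const 0))

poly-crossBound : Polynomial crossBound
poly-crossBound = poly-bound crossᵉ (poly-rounds crossˡ poly-id (poly-addBound poly-id poly-id))

poly-bestBound : Polynomial bestBound
poly-bestBound = poly-bound bestᵉ (poly-rounds bestˡ (poly-* poly-id poly-id)
  (poly-+ (poly-bound agreeᵉ (poly-rounds agreeˡ poly-id (poly-const 0)))
  (poly-+ (poly-bound validᵉ (poly-rounds validˡ poly-id
            (poly-bound stableAtᵉ (poly-+ poly-leqBound poly-crossBound))))
  (poly-+ poly-leqBound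
          (poly-bound costᵉ (poly-rounds costˡ poly-id
            (poly-+ (poly-addBound poly-id poly-id) poly-crossBound)))))))

poly-boundaryBound : Polynomial boundaryBound
poly-boundaryBound = poly-bound boundaryᵉ (poly-rounds boundaryˡ poly-id
  (poly-bound touchedᵉ (poly-rounds touchedˡ poly-id (poly-const 0))))

poly-assignmentsBound : Polynomial assignmentsBound
poly-assignmentsBound = poly-bound assignmentsᵉ (poly-rounds assignmentsˡ poly-id
  (poly-bound consAllᵉ (poly-rounds consAllˡ poly-id (poly-const 0))))

poly-leafBound : Polynomial leafBound
poly-leafBound = poly-bound leafᵉ (poly-+ poly-assignmentsBound poly-boundaryBound)

poly-joinBound : Polynomial joinBound
poly-joinBound = poly-bound joinᵉ
  (poly-+ (poly-bound unionᵉ (poly-rounds unionˡ poly-id (poly-const 0)))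
  (poly-+ (poly-bound mergeᵉ (poly-rounds mergeˡ poly-id (poly-bound patchAllᵉ
            (poly-rounds patchAllˡ poly-id
              (poly-bound patchᵉ (poly-rounds patchˡ poly-id (poly-const 0)))))))
          (poly-bound prunedᵉ (poly-+ poly-boundaryBound (poly-bound pruneᵉ
            (poly-+ poly-assignmentsBound (poly-rounds pruneˡ poly-id poly-bestBound)))))))

poly-answerBound : Polynomial answerBound
poly-answerBound = poly-bound answerᵉ
  (poly-+ (poly-bound resizeᵉ (poly-rounds resizeˡ poly-id (poly-const 0))) poly-bestBound)

-- Partial solutions

sum-cong : ∀ {n} {f g : Fin n → ℕ} → (∀ i → f i ≡ g i) → sumFin f ≡ sumFin g
sum-cong {n} h = sum-cong-≗ +-0-commutativeMonoid {n} h

sum-+ : ∀ {n} (f g : Fin n → ℕ) → sumFin (λ i → f i + g i) ≡ sumFin f + sumFin g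
sum-+ = ∑-distrib-+ +-0-commutativeMonoid

if-congᵗ : ∀ {A : Set} b {x y z : A} → (b ≡ true → x ≡ y) →
           (if b then x else z) ≡ (if b then y else z)
if-congᵗ true  h = h refl
if-congᵗ false h = refl

if-congᶠ : ∀ {A : Set} b {x y z : A} → (b ≡ false → x ≡ y) →
           (if b then z else x) ≡ (if b then z else y)
if-congᶠ true  h = refl
if-congᶠ false h = h refl

if-true : ∀ {A : Set} {b} {x y : A} → b ≡ true → (if b then x else y) ≡ x
if-true refl = refl

if-false : ∀ {A : Set} {b} {x y : A} → b ≡ false → (if b then x else y) ≡ y
if-false refl = refl

sum-if-split : ∀ {n} (V : Fin n → Bool) f →
  sumFin f ≡ sumFin (λ v → if V v then f v else 0) + sumFin (λ v → if V v then 0 else f v)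
sum-if-split V f = trans (sum-cong λ v → split (V v) (f v))
  (sum-+ (λ v → if V v then f v else 0) (λ v → if V v then 0 else f v))
  where
  split : ∀ b x → x ≡ (if b then x else 0) + (if b then 0 else x)
  split true  x = sym (+-identityʳ x)
  split false x = refl

digits : ℕᵇ → Bits
digits 0ᵇ       = []
digits 2[1+ b ] = false ∷ digits b
digits 1+[2 b ] = true ∷ digits b

enc-digits : ∀ b → enc bits (digits b) ≡ encodeℕᵇ b
enc-digits 0ᵇ       = refl
enc-digits 2[1+ b ] = cong (cons (encodeBool false)) (enc-digits b)
enc-digits 1+[2 b ] = cong (cons (encodeBool true)) (enc-digits b)

val-digits : ∀ b → val (digits b) ≡ valᵇ b
val-digits 0ᵇ       = refl
val-digits 2[1+ b ] = cong (λ k → 2 * suc k) (val-digits b)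
val-digits 1+[2 b ] = cong (λ k → suc (2 * k)) (val-digits b)

val-digits-fromℕ : ∀ k → val (digits (fromℕ k)) ≡ k
val-digits-fromℕ k = trans (val-digits (fromℕ k)) (toℕ-fromℕ k)

entry : Maybe ℕ → List Bits
entry nothing  = []
entry (just k) = digits (fromℕ k) ∷ []

entryWeight-entry : ∀ e → entryWeight (entry e) ≡ fromMaybe 0 e
entryWeight-entry nothing  = refl
entryWeight-entry (just k) = val-digits-fromℕ k

enc-entry : ∀ e → enc (list bits) (entry e) ≡ encodeMaybe (Data.Maybe.map encodeℕ e)
enc-entry nothing  = refl
enc-entry (just k) = cong (λ v → cons v nil) (enc-digits (fromℕ k))

module _ {n : ℕ} (G : WeightedGraph n) where
  open WeightedGraph G

  rowData : Fin n → ⟦ row ⟧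
  rowData u = tabulate λ v → entry (edge u v)

  graphData : ⟦ graph ⟧
  graphData = tabulate rowData

  enc-graphData : enc graph graphData ≡ encodeGraph G
  enc-graphData = cong encodeList (trans (map-tabulate rowData (enc row)) (tabulate-cong λ u →
    cong encodeList (trans (map-tabulate (λ v → entry (edge u v)) (enc (list bits)))
                           (tabulate-cong λ v → enc-entry (edge u v)))))

  sideDegree : Bool → Cut n → Fin n → ℕ
  sideDegree c S v = sumFin λ u → if c xor S u then weight v u else 0

  val-cross-rowData : ∀ c C v → val (cross c (rowData v) C) ≡ sideDegree c (nth C) v
  val-cross-rowData c C v = trans (val-cross c (λ u → entry (edge v u)) C)
    (sum-cong λ u → cong (λ k → if c xor nth C u then k else 0) (entryWeight-entry (edge v u)))

  weightedDegree-split : ∀ c S v → weightedDegree v ≡ sideDegree (not c) S v + sideDegree c S v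
  weightedDegree-split c S v = trans (sum-cong λ u → split c (S u) (weight v u))
    (sum-+ (λ u → if not c xor S u then weight v u else 0) (λ u → if c xor S u then weight v u else 0))
    where
    split : ∀ c b x → x ≡ (if not c xor b then x else 0) + (if c xor b then x else 0)
    split true  true  x = sym (+-identityʳ x)
    split true  false x = refl
    split false true  x = refl
    split false false x = sym (+-identityʳ x)

  stableAt⁺ : ∀ S v → sideDegree (not (S v)) S v ≤ sideDegree (S v) S v → StableAt G S v
  stableAt⁺ S v h = begin
    weightedDegree v ≡⟨ weightedDegree-split (S v) S v ⟩
    sideDegree (not (S v)) S v + sideDegree (S v) S v ≤⟨ +-monoˡ-≤ _ h ⟩
    sideDegree (S v) S v + sideDegree (S v) S v ≡⟨ cong (sideDegree (S v) S v +_) (+-identityʳ _) ⟨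
    2 * sideDegree (S v) S v ∎
    where open ≤-Reasoning

  stableAt⁻ : ∀ S v → StableAt G S v → sideDegree (not (S v)) S v ≤ sideDegree (S v) S v
  stableAt⁻ S v h = +-cancelʳ-≤ (sideDegree (S v) S v) _ _ (begin
    sideDegree (not (S v)) S v + sideDegree (S v) S v ≡⟨ weightedDegree-split (S v) S v ⟨
    weightedDegree v ≤⟨ h ⟩
    2 * sideDegree (S v) S v ≡⟨ cong (sideDegree (S v) S v +_) (+-identityʳ _) ⟩
    sideDegree (S v) S v + sideDegree (S v) S v ∎)
    where open ≤-Reasoning

  locallyStable⁻ : ∀ C v → LocallyStable (nth C v) (rowData v) C → StableAt G (nth C) v
  locallyStable⁻ C v h = stableAt⁺ (nth C) v
    (subst₂ _≤_ (val-cross-rowData (not (nth C v)) C v) (val-cross-rowData (nth C v) C v) h)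

  locallyStable⁺ : ∀ C v → StableAt G (nth C) v → LocallyStable (nth C v) (rowData v) C
  locallyStable⁺ C v h = subst₂ _≤_ (sym (val-cross-rowData (not (nth C v)) C v))
    (sym (val-cross-rowData (nth C v) C v)) (stableAt⁻ (nth C) v h)

  totalCrossing : Cut n → ℕ
  totalCrossing S = sumFin (crossingDegree G S)

  crossingWithin : (Fin n → Bool) → Cut n → ℕ
  crossingWithin V S = sumFin λ v → if V v then crossingDegree G S v else 0

  val-cutCost-graphData : ∀ V C →
    val (cutCost (tabulate V) C graphData) ≡ crossingWithin V (nth C)
  val-cutCost-graphData V C = trans (val-cutCost (tabulate V) C rowData)
    (sum-cong λ v → cong₂ (λ b k → if b then k else 0) (nth-tabulate V v)
                          (val-cross-rowData (nth C v) C v))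

  -- Agreement is required only along edges at `v`, because non-edges contribute 0. In particular
  -- nothing is asked at an isolated vertex, where table entries are arbitrary.
  crossingDegree-cong : ∀ S S′ v → (∀ u → IsEdge v u → S v ≡ S′ v × S u ≡ S′ u) →
                        crossingDegree G S v ≡ crossingDegree G S′ v
  crossingDegree-cong S S′ v h = sum-cong λ u → term u (edge v u) refl
    where
    0-if : ∀ b → (if b then 0 else 0) ≡ 0
    0-if true  = refl
    0-if false = refl
    term : ∀ u e → edge v u ≡ e → (if S v xor S u then fromMaybe 0 (edge v u) else 0)
                                ≡ (if S′ v xor S′ u then fromMaybe 0 (edge v u) else 0)
    term u nothing  eq rewrite eq = trans (0-if (S v xor S u)) (sym (0-if (S′ v xor S′ u)))
    term u (just k) eq = cong₂ (λ a b → if a xor b then weight v u else 0)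
                               (proj₁ (h u (k , eq))) (proj₂ (h u (k , eq)))

  stableAt-cong : ∀ S S′ v → (∀ u → IsEdge v u → S v ≡ S′ v × S u ≡ S′ u) →
                  StableAt G S v → StableAt G S′ v
  stableAt-cong S S′ v h = subst (λ k → weightedDegree v ≤ 2 * k) (crossingDegree-cong S S′ v h)

  boundaryOf : (Fin n → Bool) → Fin n → Bool
  boundaryOf B u = touched (rowData u) (tabulate B) (nth (tabulate B) u)

  boundary-graphData : ∀ B → boundary graphData (tabulate B) ≡ tabulate (boundaryOf B)
  boundary-graphData B = boundaryˡ-tabulate graphData (tabulate B) rowData (tabulate B)

  boundaryOf-reflects : ∀ B u →
    Reflects (∃[ v ] IsEdge u v × (B u ≡ true ⊎ B v ≡ true)) (boundaryOf B u)
  boundaryOf-reflects B u = Reflects-map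
    (λ (v , e , h) → v , edge⁺ (edge u v) e ,
      [ (λ p → inj₁ (trans (sym (nth-tabulate B u)) p)) , (λ p → inj₂ (trans (sym (nth-tabulate B v)) p)) ]′ h)
    (λ (v , (k , e) , h) → v , (λ z → edge⁻ {k} (trans (sym (cong entry e)) z)) ,
      [ (λ p → inj₁ (trans (nth-tabulate B u) p)) , (λ p → inj₂ (trans (nth-tabulate B v) p)) ]′ h)
    (touched-reflectsˡ (rowData u) (tabulate B) (nth (tabulate B) u) (λ v → entry (edge u v)) (tabulate B))
    where
    edge⁺ : ∀ e → ¬ entry e ≡ [] → ∃[ k ] e ≡ just k
    edge⁺ nothing  h = ⊥-elim (h refl)
    edge⁺ (just k) h = k , refl
    edge⁻ : ∀ {k} → ¬ entry (just k) ≡ []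
    edge⁻ ()

  isEdge-sym : ∀ {u v} → IsEdge u v → IsEdge v u
  isEdge-sym {u} {v} (k , e) = k , trans (symmetric v u) e

  Separates : (P V : Fin n → Bool) → Set
  Separates P V = ∀ v u → V v ≡ true → V u ≡ false → IsEdge v u → P v ≡ true × P u ≡ true

  overlay : (V D S : Cut n) → Cut n
  overlay V D S u = if V u then D u else S u

  -- The invariant of the tables: P is the boundary of a bag and V the set of
  -- vertices in the bags below it.  The partial solutions in L are only
  -- meaningful on P and V, hence the overlay on an arbitrary stable cut S.
  Complete : (P V : Fin n → Bool) → List Bits → Set
  Complete P V L = ∀ S → Stable G S → ∃[ C ] C ∈ L × (∀ u → P u ≡ true → nth C u ≡ S u) ×
    Stable G (overlay V (nth C) S) × totalCrossing (overlay V (nth C) S) ≤ totalCrossing S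

  bool-cases : ∀ b → b ≡ true ⊎ b ≡ false
  bool-cases true  = inj₁ refl
  bool-cases false = inj₂ refl

  module _ {P V : Fin n → Bool} (sep : Separates P V) where

    -- An edge from `v` that leaves `V` ends in `P`, where `C` and `S` agree; so around a vertex of
    -- `V` the overlay looks like `C`.
    overlay-local : ∀ C S v → (∀ u → P u ≡ true → nth C u ≡ S u) → V v ≡ true →
      ∀ u → IsEdge v u → overlay V (nth C) S v ≡ nth C v × overlay V (nth C) S u ≡ nth C u
    overlay-local C S v C≗S Vv u e with bool-cases (V u)
    ... | inj₁ Vu = if-true Vv , if-true Vu
    ... | inj₂ Vu = if-true Vv , trans (if-false Vu) (sym (C≗S u (proj₂ (sep v u Vv Vu e))))

    -- From outside `V` only those vertices of `V` that lie in `P` are visible along edges, and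
    -- there `C` and `D` agree.
    overlay-far : ∀ C D S v → (∀ u → P u ≡ true → nth D u ≡ nth C u) → V v ≡ false →
      ∀ u → IsEdge v u →
      overlay V (nth C) S v ≡ overlay V (nth D) S v × overlay V (nth C) S u ≡ overlay V (nth D) S u
    overlay-far C D S v D≗C Vv u e with bool-cases (V u)
    ... | inj₁ Vu = trans (if-false Vv) (sym (if-false Vv)) ,
      trans (if-true Vu) (trans (sym (D≗C u (proj₁ (sep u v Vu Vv (isEdge-sym e))))) (sym (if-true Vu)))
    ... | inj₂ Vu = trans (if-false Vv) (sym (if-false Vv)) ,
                    trans (if-false Vu) (sym (if-false Vu))

    totalCrossing-overlay : ∀ C S → (∀ u → P u ≡ true → nth C u ≡ S u) →
      totalCrossing (overlay V (nth C) S) ≡ crossingWithin V (nth C) +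
        sumFin (λ v → if V v then 0 else crossingDegree G (overlay V (nth C) S) v)
    totalCrossing-overlay C S C≗S = trans (sum-if-split V (crossingDegree G (overlay V (nth C) S)))
      (cong (_+ sumFin (λ v → if V v then 0 else crossingDegree G (overlay V (nth C) S) v))
        (sum-cong λ v → if-congᵗ (V v) λ Vv →
          crossingDegree-cong (overlay V (nth C) S) (nth C) v (overlay-local C S v C≗S Vv)))

    -- The entry `C` for `S` passes the test on `V`, since near `V` it looks like the stable cut
    -- `S₁`; so its slot has a winner `D`. Replacing `C` by `D` is safe: inside `V` stability has
    -- just been tested and the cost does not rise, and outside `V` no crossing degree changes.
    prune-complete : ∀ {L} → Complete P V L → Complete P V (prune (tabulate P) (tabulate V) graphData L)
    prune-complete {L} complete S S-stable =
      let C , C∈ , C≗S , S₁-stable , S₁≤S = complete S S-stable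
          S₁ = overlay V (nth C) S
          C-valid = true-Reflects (valid-reflects (tabulate V) C rowData) λ v Vv →
            locallyStable⁺ C v (stableAt-cong S₁ (nth C) v
              (overlay-local C S v C≗S (trans (sym (nth-tabulate V v)) Vv)) (S₁-stable v))
          D , D∈ , D≗C , D-valid , D≤C = prune-spec P (tabulate V) graphData L C∈ C-valid
          D≗S = λ u Pu → trans (D≗C u Pu) (C≗S u Pu)
      in D , D∈ , D≗S , stable C D S C≗S D≗C S₁-stable
           (Reflects-true (valid-reflects (tabulate V) D rowData) D-valid) ,
         ≤-trans (cheaper C D S C≗S D≗S D≗C
           (subst₂ _≤_ (val-cutCost-graphData V D) (val-cutCost-graphData V C) D≤C)) S₁≤S
      where
      stable : ∀ C D S → (∀ u → P u ≡ true → nth C u ≡ S u) → (∀ u → P u ≡ true → nth D u ≡ nth C u) →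
        Stable G (overlay V (nth C) S) →
        (∀ v → nth (tabulate V) v ≡ true → LocallyStable (nth D v) (rowData v) D) →
        Stable G (overlay V (nth D) S)
      stable C D S C≗S D≗C S₁-stable D-stable v with bool-cases (V v)
      ... | inj₁ Vv = stableAt-cong (nth D) (overlay V (nth D) S) v
        (λ u e → let p , q = overlay-local D S v (λ u Pu → trans (D≗C u Pu) (C≗S u Pu)) Vv u e
                 in sym p , sym q)
        (locallyStable⁻ D v (D-stable v (trans (nth-tabulate V v) Vv)))
      ... | inj₂ Vv = stableAt-cong (overlay V (nth C) S) (overlay V (nth D) S) v
        (overlay-far C D S v D≗C Vv) (S₁-stable v)
      cheaper : ∀ C D S → (∀ u → P u ≡ true → nth C u ≡ S u) → (∀ u → P u ≡ true → nth D u ≡ S u) →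
        (∀ u → P u ≡ true → nth D u ≡ nth C u) →
        crossingWithin V (nth D) ≤ crossingWithin V (nth C) →
        totalCrossing (overlay V (nth D) S) ≤ totalCrossing (overlay V (nth C) S)
      cheaper C D S C≗S D≗S D≗C h = begin
        totalCrossing (overlay V (nth D) S) ≡⟨ totalCrossing-overlay D S D≗S ⟩
        crossingWithin V (nth D) + sumFin (λ v → if V v then 0 else crossingDegree G (overlay V (nth D) S) v)
          ≡⟨ cong (crossingWithin V (nth D) +_) (sum-cong term) ⟩
        crossingWithin V (nth D) + sumFin (λ v → if V v then 0 else crossingDegree G (overlay V (nth C) S) v)
          ≤⟨ +-monoˡ-≤ _ h ⟩
        crossingWithin V (nth C) + sumFin (λ v → if V v then 0 else crossingDegree G (overlay V (nth C) S) v)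
          ≡⟨ totalCrossing-overlay C S C≗S ⟨
        totalCrossing (overlay V (nth C) S) ∎
        where
        open ≤-Reasoning
        term : ∀ v → (if V v then 0 else crossingDegree G (overlay V (nth D) S) v)
                   ≡ (if V v then 0 else crossingDegree G (overlay V (nth C) S) v)
        term v = if-congᶠ (V v) λ Vv → sym (crossingDegree-cong (overlay V (nth C) S)
          (overlay V (nth D) S) v (overlay-far C D S v D≗C Vv))

  totalCrossing-cong : ∀ S S′ → (∀ v u → IsEdge v u → S v ≡ S′ v × S u ≡ S′ u) →
                       totalCrossing S ≡ totalCrossing S′
  totalCrossing-cong S S′ h = sum-cong λ v → crossingDegree-cong S S′ v (h v)

  -- The table contains an entry equal to `S` on the boundary. Overlaying it on the bag can change
  -- `S` only at isolated vertices, since any other vertex of the bag lies in the boundary.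
  leaf-complete : ∀ B → Complete (boundaryOf B) B (assignments (tabulate (boundaryOf B)))
  leaf-complete B S S-stable =
    let C , C∈ , C≗S = assignmentsˡ-complete (tabulate (boundaryOf B) , tt) (boundaryOf B) S false
        S₁≗S = λ v u e → same C C≗S v u e , same C C≗S u v (isEdge-sym e)
    in C , C∈ , C≗S , (λ v → stableAt-cong S _ v (λ u e → sym (proj₁ (S₁≗S v u e)) , sym (proj₂ (S₁≗S v u e))) (S-stable v)) ,
       ≤-reflexive (totalCrossing-cong _ S S₁≗S)
    where
    same : ∀ C → (∀ u → boundaryOf B u ≡ true → nth C u ≡ S u) →
           ∀ v u → IsEdge v u → overlay B (nth C) S v ≡ S v
    same C C≗S v u e with bool-cases (B v)
    ... | inj₁ Bv = trans (if-true Bv)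
      (C≗S v (true-Reflects (boundaryOf-reflects B v) (u , e , inj₁ Bv)))
    ... | inj₂ Bv = if-false Bv

  -- The second table is applied to `S₁`, the result of applying the first table to `S`, not to `S`
  -- itself; this is what the quantifier over all stable cuts in `Complete` provides. The hypothesis
  -- on `P₁` and `V₂` ensures that the second overlay does not alter the values on `P₁`.
  merge-complete : ∀ {P₁ V₁ L₁ P₂ V₂ L₂} → Complete P₁ V₁ L₁ → Complete P₂ V₂ L₂ →
    (∀ u → P₁ u ≡ true → V₂ u ≡ true → P₂ u ≡ true) →
    Complete P₁ (λ u → V₁ u ∨ V₂ u) (merge (tabulate V₂) L₁ L₂)
  merge-complete {P₁} {V₁} {L₁} {P₂} {V₂} {L₂} complete₁ complete₂ P₁V₂⊆P₂ S S-stable =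
    let C , C∈ , C≗S , S₁-stable , S₁≤S = complete₁ S S-stable
        S₁ = overlay V₁ (nth C) S
        D , D∈ , D≗S₁ , S₂-stable , S₂≤S₁ = complete₂ S₁ S₁-stable
        S₂ = overlay V₂ (nth D) S₁
        M = patch (tabulate V₂) D C
        M≗ = λ u → nth-patchˡ (tabulate V₂ , D , C , tt) V₂ D C u
        S₂≗ = λ u → overlay-∨ (V₁ u) (V₂ u) (M≗ u)
    in M , ∈-mergeˡ (tabulate V₂) L₁ L₂ L₁ false C∈ D∈ ,
       (λ u P₁u → trans (M≗ u) (agrees C D C≗S D≗S₁ u P₁u)) ,
       (λ v → stableAt-cong S₂ _ v (λ u e → S₂≗ v , S₂≗ u) (S₂-stable v)) ,
       ≤-trans (≤-reflexive (totalCrossing-cong _ S₂ λ v u e → sym (S₂≗ v) , sym (S₂≗ u)))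
               (≤-trans S₂≤S₁ S₁≤S)
    where
    overlay-∨ : ∀ a b {m d c s : Bool} → m ≡ (if b then d else c) →
      (if b then d else (if a then c else s)) ≡ (if a ∨ b then m else s)
    overlay-∨ true  true  refl = refl
    overlay-∨ true  false refl = refl
    overlay-∨ false true  refl = refl
    overlay-∨ false false refl = refl
    agrees : ∀ C D → (∀ u → P₁ u ≡ true → nth C u ≡ S u) →
      (∀ u → P₂ u ≡ true → nth D u ≡ overlay V₁ (nth C) S u) →
      ∀ u → P₁ u ≡ true → (if V₂ u then nth D u else nth C u) ≡ S u
    agrees C D C≗S D≗S₁ u P₁u with bool-cases (V₂ u) | bool-cases (V₁ u)
    ... | inj₂ V₂u | _ = trans (if-false V₂u) (C≗S u P₁u)
    ... | inj₁ V₂u | inj₁ V₁u = trans (if-true V₂u)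
      (trans (D≗S₁ u (P₁V₂⊆P₂ u P₁u V₂u)) (trans (if-true V₁u) (C≗S u P₁u)))
    ... | inj₁ V₂u | inj₂ V₁u = trans (if-true V₂u)
      (trans (D≗S₁ u (P₁V₂⊆P₂ u P₁u V₂u)) (if-false V₁u))

-- Existence of stable cuts

sum-mono : ∀ {n} {f g : Fin n → ℕ} → (∀ i → f i ≤ g i) → sumFin f ≤ sumFin g
sum-mono {zero}  h = z≤n
sum-mono {suc n} h = +-mono-≤ (h zero) (sum-mono (h ∘ suc))

sum-swap : ∀ {m n} (f : Fin m → Fin n → ℕ) →
  sumFin (λ i → sumFin (f i)) ≡ sumFin (λ j → sumFin λ i → f i j)
sum-swap = ∑-comm +-0-commutativeMonoid

sum-punchIn : ∀ {n} (i : Fin (suc n)) (f : Fin (suc n) → ℕ) →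
  sumFin f ≡ f i + sumFin (f ∘ punchIn i)
sum-punchIn i f = sum-remove +-0-commutativeMonoid {i = i} f

module _ {n : ℕ} (G : WeightedGraph n) where
  open WeightedGraph G

  weight-sym : ∀ u v → weight u v ≡ weight v u
  weight-sym u v = cong (fromMaybe 0) (symmetric u v)

  weight-loop : ∀ v → weight v v ≡ 0
  weight-loop v = cong (fromMaybe 0) (loopless v)

  crossingTerm : Cut n → Fin n → Fin n → ℕ
  crossingTerm S u v = if S u xor S v then weight u v else 0

  crossingTerm-sym : ∀ S u v → crossingTerm S u v ≡ crossingTerm S v u
  crossingTerm-sym S u v = cong₂ (λ b k → if b then k else 0) (xor-comm (S u) (S v)) (weight-sym u v)

  crossingTerm-loop : ∀ S v → crossingTerm S v v ≡ 0
  crossingTerm-loop S v = cong (λ b → if b then weight v v else 0) (xor-same (S v))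

  totalCrossing-cutWeight : ∀ S → totalCrossing G S ≡ 2 * cutWeight G S
  totalCrossing-cutWeight S = begin
    sumFin (λ u → sumFin (crossingTerm S u)) ≡⟨ sum-cong (λ u → sum-cong (split u)) ⟩
    sumFin (λ u → sumFin λ v → half u v + half v u)
      ≡⟨ sum-cong (λ u → sum-+ (half u) (λ v → half v u)) ⟩
    sumFin (λ u → sumFin (half u) + sumFin λ v → half v u)
      ≡⟨ sum-+ (λ u → sumFin (half u)) (λ u → sumFin λ v → half v u) ⟩
    cutWeight G S + sumFin (λ u → sumFin λ v → half v u)
      ≡⟨ cong (cutWeight G S +_) (trans (sum-swap (λ u v → half v u)) (sym (+-identityʳ _))) ⟩
    2 * cutWeight G S ∎
    where
    open ≡-Reasoning
    half : Fin n → Fin n → ℕ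
    half u v = if does (u Data.Fin.<? v) ∧ (S u xor S v) then weight u v else 0
    half-< : ∀ {u v} → u Data.Fin.< v → half u v ≡ crossingTerm S u v
    half-< {u} {v} l =
      cong (λ b → if b ∧ (S u xor S v) then weight u v else 0) (dec-true (u Data.Fin.<? v) l)
    half-≮ : ∀ {u v} → ¬ u Data.Fin.< v → half u v ≡ 0
    half-≮ {u} {v} l =
      cong (λ b → if b ∧ (S u xor S v) then weight u v else 0) (dec-false (u Data.Fin.<? v) l)
    split : ∀ u v → crossingTerm S u v ≡ half u v + half v u
    split u v with <ᶠ-cmp u v
    ... | tri< l _ g = sym (trans (cong₂ _+_ (half-< l) (half-≮ g)) (+-identityʳ _))
    ... | tri≈ l refl g = trans (crossingTerm-loop S u) (sym (cong₂ _+_ (half-≮ l) (half-≮ g)))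
    ... | tri> l _ g = trans (crossingTerm-sym S u v) (sym (cong₂ _+_ (half-≮ l) (half-< g)))

  flip : Fin n → Cut n → Cut n
  flip v S u = if does (u ≟ᶠ v) then not (S u) else S u

  flip-same : ∀ v S → flip v S v ≡ not (S v)
  flip-same v S = cong (λ b → if b then not (S v) else S v) (dec-true (v ≟ᶠ v) refl)

  flip-other : ∀ v S u → ¬ u ≡ v → flip v S u ≡ S u
  flip-other v S u h = cong (λ b → if b then not (S u) else S u) (dec-false (u ≟ᶠ v) h)

  crossingDegree-flip : ∀ v S → crossingDegree G (flip v S) v ≡ sideDegree G (not (S v)) S v
  crossingDegree-flip v S = sum-cong term
    where
    if-0 : ∀ b {k} → k ≡ 0 → (if b then k else 0) ≡ 0
    if-0 true  h = h
    if-0 false h = refl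
    term : ∀ u → (if flip v S v xor flip v S u then weight v u else 0)
               ≡ (if not (S v) xor S u then weight v u else 0)
    term u with u ≟ᶠ v
    ... | yes refl = trans (if-0 _ (weight-loop v)) (sym (if-0 (not (S v) xor S v) (weight-loop v)))
    ... | no u≢v = cong (λ b → if b xor S u then weight v u else 0) (flip-same v S)

crossingAway : ∀ {n} (G : WeightedGraph (suc n)) → Fin (suc n) → Cut (suc n) → ℕ
crossingAway G v S = sumFin λ i → sumFin λ j → crossingTerm G S (punchIn v i) (punchIn v j)

-- The row and the column of `v` each contribute its crossing degree, by symmetry and the absence of
-- loops. The remaining sum does not involve `v`, so flipping `v` leaves it unchanged.
totalCrossing-punchIn : ∀ {n} (G : WeightedGraph (suc n)) S v → totalCrossing G S ≡
  crossingDegree G S v + (crossingDegree G S v + crossingAway G v S)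
totalCrossing-punchIn G S v = begin
  totalCrossing G S ≡⟨ sum-punchIn v (crossingDegree G S) ⟩
  crossingDegree G S v + sumFin (λ i → sumFin (crossingTerm G S (punchIn v i)))
    ≡⟨ cong (crossingDegree G S v +_) (trans
         (sum-cong λ i → sum-punchIn v (crossingTerm G S (punchIn v i)))
         (sum-+ (λ i → crossingTerm G S (punchIn v i) v)
                (λ i → sumFin λ j → crossingTerm G S (punchIn v i) (punchIn v j)))) ⟩
  crossingDegree G S v + (sumFin (λ i → crossingTerm G S (punchIn v i) v) + crossingAway G v S)
    ≡⟨ cong (λ k → crossingDegree G S v + (k + crossingAway G v S)) column ⟩
  crossingDegree G S v + (crossingDegree G S v + crossingAway G v S) ∎
  where
  open ≡-Reasoning
  column : sumFin (λ i → crossingTerm G S (punchIn v i) v) ≡ crossingDegree G S v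
  column = begin
    sumFin (λ i → crossingTerm G S (punchIn v i) v)
      ≡⟨ sum-cong (λ i → crossingTerm-sym G S (punchIn v i) v) ⟩
    sumFin (λ i → crossingTerm G S v (punchIn v i))
      ≡⟨ cong (_+ sumFin (λ i → crossingTerm G S v (punchIn v i))) (crossingTerm-loop G S v) ⟨
    crossingTerm G S v v + sumFin (λ i → crossingTerm G S v (punchIn v i))
      ≡⟨ sum-punchIn v (crossingTerm G S v) ⟨
    crossingDegree G S v ∎

totalCrossing-flip : ∀ {n} (G : WeightedGraph n) S v → ¬ StableAt G S v →
                     totalCrossing G S < totalCrossing G (flip G v S)
totalCrossing-flip {suc n} G S v unstable = begin-strict
  totalCrossing G S ≡⟨ totalCrossing-punchIn G S v ⟩
  c + (c + rest S) <⟨ +-mono-<-≤ c<c′ (+-mono-≤ (<⇒≤ c<c′) (≤-reflexive (sym rest-flip))) ⟩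
  c′ + (c′ + rest S′) ≡⟨ totalCrossing-punchIn G S′ v ⟨
  totalCrossing G S′ ∎
  where
  open ≤-Reasoning
  S′ = flip G v S
  c  = crossingDegree G S v
  c′ = crossingDegree G S′ v
  rest = crossingAway G v
  rest-flip : rest S′ ≡ rest S
  rest-flip = sum-cong λ i → sum-cong λ j →
    cong₂ (λ a b → if a xor b then WeightedGraph.weight G (punchIn v i) (punchIn v j) else 0)
      (flip-other G v S (punchIn v i) (punchInᵢ≢i v i)) (flip-other G v S (punchIn v j) (punchInᵢ≢i v j))
  c<c′ : c < c′
  c<c′ = ≰⇒> λ h → unstable
    (stableAt⁺ G S v (≤-trans (≤-reflexive (sym (crossingDegree-flip G v S))) h))

module _ {n : ℕ} (G : WeightedGraph n) where
  open WeightedGraph G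

  totalCrossing≤ : ∀ S → totalCrossing G S ≤ sumFin weightedDegree
  totalCrossing≤ S = sum-mono λ v → sum-mono λ u → if≤ (S v xor S u) (weight v u)
    where
    if≤ : ∀ b k → (if b then k else 0) ≤ k
    if≤ true  k = ≤-refl
    if≤ false k = z≤n

  -- Local search: flipping an unstable vertex increases the weight of the cut.
  stableCut-from : ∀ f S → sumFin weightedDegree ≤ totalCrossing G S + f → ∃[ S′ ] Stable G S′
  stableCut-from f S h with all? (λ v → weightedDegree v ≤? 2 * crossingDegree G S v)
  ... | yes stable = S , stable
  ... | no unstable with ¬∀⟶∃¬ n _ (λ v → weightedDegree v ≤? 2 * crossingDegree G S v) unstable
  -- The fuel bounds the gap to the sum of all weighted degrees, which no cut exceeds; with no fuel
  -- left, a strict improvement is absurd.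
  stableCut-from zero S h | no _ | v , ¬stable = ⊥-elim (<⇒≱ (totalCrossing-flip G S v ¬stable)
    (≤-trans (totalCrossing≤ (flip G v S)) (≤-trans h (≤-reflexive (+-identityʳ _)))))
  stableCut-from (suc f) S h | no _ | v , ¬stable = stableCut-from f (flip G v S)
    (≤-trans h (≤-trans (≤-reflexive (+-suc _ f)) (+-monoˡ-≤ f (totalCrossing-flip G S v ¬stable))))

  stableCut : ∃[ S ] Stable G S
  stableCut = stableCut-from (sumFin weightedDegree) (λ _ → false) (m≤n+m _ _)

  minStableCut : ∀ S → Stable G S → (∀ S′ → Stable G S′ → totalCrossing G S ≤ totalCrossing G S′) →
                 IsMinStableCut G S
  minStableCut S stable h = stable , λ S′ stable′ → *-cancelˡ-≤ 2
    (subst₂ _≤_ (totalCrossing-cutWeight G S) (totalCrossing-cutWeight G S′) (h S′ stable′))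

-- Tree decompositions

toList-tabulate : ∀ {n} (s : Subset n) → Vec.toList s ≡ tabulate (Vec.lookup s)
toList-tabulate Vec.[]      = refl
toList-tabulate (b Vec.∷ s) = cong (b ∷_) (toList-tabulate s)

EqClosure-bind : ∀ {A B : Set} {R : A → A → Set} {S : B → B → Set} (f : A → B) →
  (∀ {x y} → R x y → EqClosure S (f x) (f y)) →
  ∀ {x y} → EqClosure R x y → EqClosure S (f x) (f y)
EqClosure-bind f h ε                   = ε
EqClosure-bind f h (fwd r ◅ p)         = h r ◅◅ EqClosure-bind f h p
EqClosure-bind {S = S} f h (bwd r ◅ p) = EqClosure-sym S (h r) ◅◅ EqClosure-bind f h p

-- A rooted tree is given by the label s of its root and the list ts of its
-- children; it is taken apart by detaching its first child.
module _ {n : ℕ} where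

  Forest : Set
  Forest = List (Tree (Subset n))

  covers : Subset n → Forest → Fin n → Bool
  covers s []                u = Vec.lookup s u
  covers s (node s′ ts′ ∷ ts) u = covers s ts u ∨ covers s′ ts′ u

  InBag : ∀ {t : Tree (Subset n)} → Fin n → Node t → Set
  InBag v x = Vec.lookup (label x) v ≡ true

  covers⁺ : ∀ s ts v (x : Node (node s ts)) → InBag v x → covers s ts v ≡ true
  covers⁺ s [] v root h = h
  covers⁺ s (node s′ ts′ ∷ ts) v root h =
    cong (_∨ covers s′ ts′ v) (covers⁺ s ts v root h)
  covers⁺ s (node s′ ts′ ∷ ts) v (below zero x) h =
    trans (cong (covers s ts v ∨_) (covers⁺ s′ ts′ v x h)) (∨-zeroʳ _)
  covers⁺ s (node s′ ts′ ∷ ts) v (below (suc i) x) h =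
    cong (_∨ covers s′ ts′ v) (covers⁺ s ts v (below i x) h)

  covers⁻ : ∀ s ts v → covers s ts v ≡ true → ∃[ x ] InBag {node s ts} v x
  covers⁻ s [] v h = root , h
  covers⁻ s (node s′ ts′ ∷ ts) v h with covers s ts v in eq
  covers⁻ s (node s′ ts′ ∷ ts) v h | true with covers⁻ s ts v eq
  ... | root , e      = root , e
  ... | below i x , e = below (suc i) x , e
  covers⁻ s (node s′ ts′ ∷ ts) v h | false with covers⁻ s′ ts′ v h
  ... | x , e = below zero x , e

  -- The form in which connectedness is used, following the way the tree is taken apart: a vertex
  -- that occurs on both sides of the link between the root and its first child lies in the bags at
  -- both ends of the link.
  Separated : Subset n → Forest → Set
  Separated s []                = ⊤
  Separated s (node s′ ts′ ∷ ts) = Separated s ts × Separated s′ ts′ ×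
    (∀ u → covers s ts u ≡ true → covers s′ ts′ u ≡ true →
     Vec.lookup s u ≡ true × Vec.lookup s′ u ≡ true)

  Link : ∀ {t : Tree (Subset n)} → Fin n → Node t → Node t → Set
  Link v x y = Child x y × InBag v x × InBag v y

  Connected : Tree (Subset n) → Set
  Connected t = ∀ v (x y : Node t) → InBag v x → InBag v y → EqClosure (Link v) x y

  module _ {s : Subset n} {t : Tree (Subset n)} {ts : Forest} where

    -- Retractions onto the two parts: the other part is contracted to the root.
    toRest : Node (node s (t ∷ ts)) → Node (node s ts)
    toRest root              = root
    toRest (below zero x)    = root
    toRest (below (suc i) x) = below i x

    toChild : Node (node s (t ∷ ts)) → Node t
    toChild root              = root
    toChild (below zero x)    = x
    toChild (below (suc i) x) = root

    fromRest : Node (node s ts) → Node (node s (t ∷ ts))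
    fromRest root        = root
    fromRest (below i x) = below (suc i) x

    toRest-link : ∀ {v x y} → Link v x y → EqClosure (Link v) (toRest x) (toRest y)
    toRest-link (here zero , _)           = ε
    toRest-link (here (suc i) , hx , hy)    = fwd (here i , hx , hy) ◅ ε
    toRest-link (there zero c , _)        = ε
    toRest-link (there (suc i) c , hx , hy) = fwd (there i c , hx , hy) ◅ ε

    toChild-link : ∀ {v x y} → Link v x y → EqClosure (Link v) (toChild x) (toChild y)
    toChild-link (here zero , _)           = ε
    toChild-link (here (suc i) , _)        = ε
    toChild-link (there zero c , hx , hy)    = fwd (c , hx , hy) ◅ ε
    toChild-link (there (suc i) c , _)     = ε

    -- A chain of links between nodes of the rest may make excursions into the detached child;
    -- `toRest` turns each of them into a stay at the root.
    connected-rest : Connected (node s (t ∷ ts)) → Connected (node s ts)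
    connected-rest conn v x y hx hy = subst₂ (EqClosure (Link v)) (retract x) (retract y)
      (EqClosure-bind toRest toRest-link (conn v (fromRest x) (fromRest y) (inBag x hx) (inBag y hy)))
      where
      retract : ∀ x → toRest (fromRest x) ≡ x
      retract root        = refl
      retract (below i x) = refl
      inBag : ∀ x → InBag v x → InBag v (fromRest x)
      inBag root        h = h
      inBag (below i x) h = h

    connected-child : Connected (node s (t ∷ ts)) → Connected t
    connected-child conn v x y hx hy =
      EqClosure-bind toChild toChild-link (conn v (below zero x) (below zero y) hx hy)

    inChild : Node (node s (t ∷ ts)) → Bool
    inChild root              = false
    inChild (below zero x)    = true
    inChild (below (suc i) x) = false

    -- Only the link between the root and the first child joins the two parts. A chain from one part
    -- to the other must use it, and each link of the chain carries `v` in both of its bags.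
    crossing-link : ∀ {v x y} → EqClosure (Link v) x y → inChild x ≡ false → inChild y ≡ true →
      Vec.lookup s v ≡ true × InBag v (root {t = t})
    crossing-link {v} ε p q with () ← trans (sym p) q
    crossing-link (fwd (here zero , hx , hy) ◅ _)    p q = hx , hy
    crossing-link (fwd (here (suc i) , _) ◅ r)       p q = crossing-link r refl q
    crossing-link (fwd (there zero c , _) ◅ _)       () q
    crossing-link (fwd (there (suc i) c , _) ◅ r)    p q = crossing-link r refl q
    crossing-link (bwd (here zero , _) ◅ _)          () q
    crossing-link (bwd (here (suc i) , _) ◅ r)       p q = crossing-link r refl q
    crossing-link (bwd (there zero c , _) ◅ _)       () q
    crossing-link (bwd (there (suc i) c , _) ◅ r)    p q = crossing-link r refl q

    shared : Connected (node s (t ∷ ts)) → ∀ v (x : Node (node s ts)) (y : Node t) →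
             InBag v x → InBag v y → Vec.lookup s v ≡ true × InBag v (root {t = t})
    shared conn v root        y hx hy = crossing-link (conn v root (below zero y) hx hy) refl refl
    shared conn v (below i x) y hx hy =
      crossing-link (conn v (below (suc i) x) (below zero y) hx hy) refl refl

  separated : ∀ s ts → Connected (node s ts) → Separated s ts
  separated s [] conn = tt
  separated s (node s′ ts′ ∷ ts) conn =
    separated s ts (connected-rest conn) , separated s′ ts′ (connected-child conn) ,
    λ u h h′ → let x , hx = covers⁻ s ts u h ; y , hy = covers⁻ s′ ts′ u h′ in shared conn u x y hx hy

  Together : Subset n → Forest → Fin n → Fin n → Set
  Together s ts u v = ∃[ x ] InBag {node s ts} u x × InBag {node s ts} v x

  together-split : ∀ s t ts u v → Together s (t ∷ ts) u v →
                   Together s ts u v ⊎ (∃[ x ] InBag {t} u x × InBag {t} v x)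
  together-split s t ts u v (root , h)            = inj₁ (root , h)
  together-split s t ts u v (below zero x , h)    = inj₂ (x , h)
  together-split s t ts u v (below (suc i) x , h) = inj₁ (below i x , h)

  module _ (G : WeightedGraph n) where
    open WeightedGraph G

    solve : Subset n → Forest → Bits × List Bits
    solve s []                 = eval leafᵉ (Vec.toList s , graphData G , tt)
    solve s (node s′ ts′ ∷ ts) =
      eval joinᵉ (solve s ts , solve s′ ts′ , Vec.toList s , graphData G , tt)

    solve-vertices : ∀ s ts → proj₁ (solve s ts) ≡ tabulate (covers s ts)
    solve-vertices s []                 = toList-tabulate s
    solve-vertices s (node s′ ts′ ∷ ts) =
      trans (cong₂ union (solve-vertices s ts) (solve-vertices s′ ts′)) (union-tabulate _ _)

    bagBoundary : Subset n → Fin n → Bool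
    bagBoundary s = boundaryOf G (Vec.lookup s)

    boundary-toList : ∀ s → boundary (graphData G) (Vec.toList s) ≡ tabulate (bagBoundary s)
    boundary-toList s = trans (cong (boundary (graphData G)) (toList-tabulate s))
                              (boundary-graphData G (Vec.lookup s))

    solve-[] : ∀ s → proj₂ (solve s []) ≡ assignments (tabulate (bagBoundary s))
    solve-[] s = cong assignments (boundary-toList s)

    solve-∷ : ∀ s s′ ts′ ts → proj₂ (solve s (node s′ ts′ ∷ ts)) ≡
      prune (tabulate (bagBoundary s)) (tabulate (covers s (node s′ ts′ ∷ ts))) (graphData G)
        (merge (tabulate (covers s′ ts′)) (proj₂ (solve s ts)) (proj₂ (solve s′ ts′)))
    solve-∷ s s′ ts′ ts = trans
      (cong (λ P → prune P (union (proj₁ (solve s ts)) (proj₁ (solve s′ ts′))) (graphData G) L)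
            (boundary-toList s))
      (cong₂ (λ V V′ → prune (tabulate (bagBoundary s)) V (graphData G)
                         (merge V′ (proj₂ (solve s ts)) (proj₂ (solve s′ ts′))))
        (solve-vertices s (node s′ ts′ ∷ ts)) (solve-vertices s′ ts′))
      where
      L = merge (proj₁ (solve s′ ts′)) (proj₂ (solve s ts)) (proj₂ (solve s′ ts′))

    length-solve : ∀ s ts → length (proj₂ (solve s ts)) ≤ 2 ^ popcount (bagBoundary s)
    length-solve s [] = ≤-reflexive (trans (cong length (solve-[] s))
      (length-assignmentsˡ (tabulate (bagBoundary s) , tt) (bagBoundary s) false))
    length-solve s (node s′ ts′ ∷ ts) = ≤-trans (≤-reflexive (cong length (solve-∷ s s′ ts′ ts)))
      (length-prune (bagBoundary s) (tabulate (covers s (node s′ ts′ ∷ ts))) (graphData G)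
        (merge (tabulate (covers s′ ts′)) (proj₂ (solve s ts)) (proj₂ (solve s′ ts′))))

    -- O u v stands for an edge that is covered by a bag outside the subtree.
    record Context (s : Subset n) (ts : Forest) (O : Fin n → Fin n → Set) : Set where
      field
        edges   : ∀ u v → IsEdge u v → Together s ts u v ⊎ O u v
        outside : ∀ u v → O u v → covers s ts u ≡ true → Vec.lookup s u ≡ true

    -- If `u` is not covered, the edge lies in no bag of the subtree, so it is covered outside. Then
    -- the covered end `v` must be in the root bag `s`, the edge meets `s`, and both of its ends are
    -- in the boundary.
    separates : ∀ {s ts O} → Context s ts O → Separates G (bagBoundary s) (covers s ts)
    separates {s} {ts} ctx v u Vv Vu e with Context.edges ctx v u e
    ... | inj₁ (x , _ , hu) with () ← trans (sym Vu) (covers⁺ s ts u x hu)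
    ... | inj₂ o =
      let v∈s = Context.outside ctx v u o Vv
      in true-Reflects (boundaryOf-reflects G (Vec.lookup s) v) (u , e , inj₁ v∈s) ,
         true-Reflects (boundaryOf-reflects G (Vec.lookup s) u) (v , isEdge-sym G e , inj₂ v∈s)

    module _ {s s′ ts′ ts O} (sep : ∀ u → covers s ts u ≡ true → covers s′ ts′ u ≡ true →
               Vec.lookup s u ≡ true × Vec.lookup s′ u ≡ true)
             (ctx : Context s (node s′ ts′ ∷ ts) O) where
      open Context ctx

      covers-left : ∀ u → covers s ts u ≡ true → covers s (node s′ ts′ ∷ ts) u ≡ true
      covers-left u h = cong (_∨ covers s′ ts′ u) h

      covers-right : ∀ u → covers s′ ts′ u ≡ true → covers s (node s′ ts′ ∷ ts) u ≡ true
      covers-right u h = trans (cong (covers s ts u ∨_) h) (∨-zeroʳ _)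
    
      covers-root : ∀ s ts u → Vec.lookup s u ≡ true → covers s ts u ≡ true
      covers-root s ts u h = covers⁺ s ts u root h

      restContext : Context s ts (λ u v → O u v ⊎ Together s′ ts′ u v)
      restContext = record
        { edges = λ u v e → [ (λ h → [ inj₁ , (λ h → inj₂ (inj₂ h)) ]′ (together-split s _ ts u v h)) ,
                              (λ o → inj₂ (inj₁ o)) ]′ (edges u v e)
        ; outside = λ u v → [ (λ o h → outside u v o (covers-left u h)) ,
                              (λ (x , hu , _) h → proj₁ (sep u h (covers⁺ s′ ts′ u x hu))) ]′ }

      childContext : Context s′ ts′ (λ u v → O u v ⊎ Together s ts u v)
      childContext = record
        { edges = λ u v e → [ (λ h → [ (λ h → inj₂ (inj₂ h)) , inj₁ ]′ (together-split s _ ts u v h)) ,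
                              (λ o → inj₂ (inj₁ o)) ]′ (edges u v e)
        -- An edge covered outside the whole subtree meets its vertices only in `s`; a vertex of `s`
        -- that also occurs below the child is in `s′` by separation.
        ; outside = λ u v → [ (λ o h → proj₂ (sep u (covers-root s ts u (outside u v o (covers-right u h))) h)) ,
                              (λ (x , hu , _) h → proj₂ (sep u (covers⁺ s ts u x hu) h)) ]′ }

      -- This is the overlap condition of `merge-complete`. The edge that puts `u` into the boundary
      -- of `s` has an end in `s`. If that end occurs below the child, it is in `s′` by separation;
      -- otherwise it is the neighbour `v`, and the edge leaves the vertices of the child, so
      -- `separates` applies.
      boundary-step : ∀ u → bagBoundary s u ≡ true → covers s′ ts′ u ≡ true → bagBoundary s′ u ≡ true
      boundary-step u Pu Vu with Reflects-true (boundaryOf-reflects G (Vec.lookup s) u) Pu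
      ... | v , e , inj₁ u∈s = true-Reflects (boundaryOf-reflects G (Vec.lookup s′) u)
        (v , e , inj₁ (proj₂ (sep u (covers-root s ts u u∈s) Vu)))
      ... | v , e , inj₂ v∈s with bool-cases G (covers s′ ts′ v)
      ... | inj₁ Vv = true-Reflects (boundaryOf-reflects G (Vec.lookup s′) u)
        (v , e , inj₂ (proj₂ (sep v (covers-root s ts v v∈s) Vv)))
      ... | inj₂ Vv = proj₁ (separates childContext u v Vu Vv e)

    solve-complete : ∀ s ts {O} → Separated s ts → Context s ts O →
                     Complete G (bagBoundary s) (covers s ts) (proj₂ (solve s ts))
    solve-complete s [] sep ctx = subst (Complete G (bagBoundary s) (covers s []))
      (sym (solve-[] s)) (leaf-complete G (Vec.lookup s))
    solve-complete s (node s′ ts′ ∷ ts) (sep₁ , sep₂ , sep) ctx =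
      subst (Complete G (bagBoundary s) (covers s (node s′ ts′ ∷ ts))) (sym (solve-∷ s s′ ts′ ts))
        (prune-complete G (separates ctx) (merge-complete G {V₁ = covers s ts} {V₂ = covers s′ ts′}
          (solve-complete s ts sep₁ (restContext sep ctx))
          (solve-complete s′ ts′ sep₂ (childContext sep ctx))
          (boundary-step sep ctx)))

-- Sizes

-- The least number with k digits in bijective base 2 has all digits 1 and equals 2^k - 1.
length-digits : ∀ b → 2 ^ length b ≤ suc (val b)
length-digits []          = ≤-refl
length-digits (true ∷ b)  = ≤-trans (*-monoʳ-≤ 2 (length-digits b)) (≤-reflexive (eq (val b)))
  where
  eq : ∀ v → 2 * suc v ≡ suc (suc (2 * v))
  eq = solve-∀
length-digits (false ∷ b) = ≤-trans (*-monoʳ-≤ 2 (length-digits b)) (n≤1+n _)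

length-log : ∀ b {W} → val b ≤ W → length b ≤ suc ⌈log₂ W ⌉
length-log b {W} h = go (length b) (≤-trans (length-digits b) (s≤s h))
  where
  go : ∀ k → 2 ^ k ≤ suc W → k ≤ suc ⌈log₂ W ⌉
  go zero    h = z≤n
  go (suc k) h = s≤s (≤-trans (≤-reflexive (sym (⌈log₂2^n⌉≡n k))) (⌈log₂⌉-mono-≤ half))
    where
    -- One of the two copies of `2 ^ k` absorbs the successor on the right, being at least 1.
    half : 2 ^ k ≤ W
    half = ≤-pred (≤-trans (+-monoʳ-≤ 1 (m≤m+n (2 ^ k) 0))
      (≤-trans (+-monoˡ-≤ (2 ^ k + 0) (m^n>0 2 k)) h))

≤maxFin : ∀ {n} (f : Fin n → ℕ) i → f i ≤ maxFin f
≤maxFin f = tabulate⁻ (xs≤max 0 (tabulate f))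

maxFin≤ : ∀ {n k} (f : Fin n → ℕ) → (∀ i → f i ≤ k) → maxFin f ≤ k
maxFin≤ f h = max≤v⁺ z≤n (tabulate⁺ h)

term≤sum : ∀ {n} (f : Fin n → ℕ) i → f i ≤ sumFin f
term≤sum f zero    = m≤m+n _ _
term≤sum f (suc i) = m≤n⇒m≤o+n (f zero) (term≤sum (f ∘ suc) i)

sum-*ʳ : ∀ {n} k (f : Fin n → ℕ) → sumFin (λ i → f i * k) ≡ sumFin f * k
sum-*ʳ {zero}  k f = refl
sum-*ʳ {suc n} k f = trans (cong (f zero * k +_) (sum-*ʳ k (f ∘ suc)))
  (sym (*-distribʳ-+ k (f zero) (sumFin (f ∘ suc))))

∣∣-sum : ∀ {n} (s : Subset n) → ∣ s ∣ ≡ sumFin λ u → toℕ (Vec.lookup s u)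
∣∣-sum Vec.[]          = refl
∣∣-sum (true Vec.∷ s)  = cong suc (∣∣-sum s)
∣∣-sum (false Vec.∷ s) = ∣∣-sum s

two-elements : ∀ {n} (s : Subset n) u v → ¬ u ≡ v →
               Vec.lookup s u ≡ true → Vec.lookup s v ≡ true → 2 ≤ ∣ s ∣
two-elements {suc n} s u v u≢v hu hv = begin
  2 ≡⟨ cong₂ (λ a b → toℕ a + toℕ b) hu hv′ ⟨
  f u + f (punchIn u (punchOut u≢v)) ≤⟨ +-monoʳ-≤ (f u) (term≤sum (f ∘ punchIn u) (punchOut u≢v)) ⟩
  f u + sumFin (f ∘ punchIn u) ≡⟨ sum-punchIn u f ⟨
  sumFin f ≡⟨ ∣∣-sum s ⟨
  ∣ s ∣ ∎
  where
  open ≤-Reasoning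
  f : Fin (suc n) → ℕ
  f = toℕ ∘ Vec.lookup s
  hv′ : Vec.lookup s (punchIn u (punchOut u≢v)) ≡ true
  hv′ = trans (cong (Vec.lookup s) (punchIn-punchOut u≢v)) hv

module _ {n : ℕ} (G : WeightedGraph n) where
  open WeightedGraph G

  adjacency : Fin n → Fin n → ℕ
  adjacency u v = if is-just (edge u v) then 1 else 0

  adjacency-sym : ∀ u v → adjacency u v ≡ adjacency v u
  adjacency-sym u v = cong (λ e → if is-just e then 1 else 0) (symmetric u v)

  -- Double counting: each vertex of the boundary is charged to an edge with an end in s.
  popcount-boundary : ∀ s → popcount (bagBoundary G s) ≤ 2 * (∣ s ∣ * maxDegree)
  popcount-boundary s = begin
    popcount (bagBoundary G s) ≤⟨ sum-mono charge ⟩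
    sumFin (λ u → sumFin λ v → b u * adjacency u v + b v * adjacency u v)
      ≡⟨ sum-cong (λ u → sum-+ (λ v → b u * adjacency u v) (λ v → b v * adjacency u v)) ⟩
    sumFin (λ u → sumFin (λ v → b u * adjacency u v) + sumFin λ v → b v * adjacency u v)
      ≡⟨ sum-+ (λ u → sumFin λ v → b u * adjacency u v) (λ u → sumFin λ v → b v * adjacency u v) ⟩
    X + sumFin (λ u → sumFin λ v → b v * adjacency u v)
      ≡⟨ cong (X +_) (trans (sum-swap (λ u v → b v * adjacency u v))
           (sum-cong λ u → sum-cong λ v → cong (b u *_) (adjacency-sym v u))) ⟩
    X + X ≡⟨ cong (X +_) (+-identityʳ X) ⟨
    2 * X ≤⟨ *-monoʳ-≤ 2 X≤ ⟩
    2 * (∣ s ∣ * maxDegree) ∎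
    where
    open ≤-Reasoning
    b : Fin n → ℕ
    b = toℕ ∘ Vec.lookup s
    X = sumFin λ u → sumFin λ v → b u * adjacency u v
    scale : ∀ k (f : Fin n → ℕ) → sumFin (λ v → k * f v) ≡ sumFin f * k
    scale k f = trans (sum-cong λ v → *-comm k (f v)) (sum-*ʳ k f)
    X≤ : X ≤ ∣ s ∣ * maxDegree
    X≤ = begin
      X ≤⟨ sum-mono (λ u → ≤-trans (≤-reflexive (trans (scale (b u) (adjacency u)) (*-comm (degree u) (b u))))
                             (*-monoʳ-≤ (b u) (≤maxFin degree u))) ⟩
      sumFin (λ u → b u * maxDegree) ≡⟨ sum-*ʳ maxDegree b ⟩
      sumFin b * maxDegree ≡⟨ cong (_* maxDegree) (∣∣-sum s) ⟨
      ∣ s ∣ * maxDegree ∎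
    charge : ∀ u → (if bagBoundary G s u then 1 else 0) ≤
             sumFin λ v → b u * adjacency u v + b v * adjacency u v
    charge u = go (boundaryOf-reflects G (Vec.lookup s) u)
      where
      charge-term : ∀ v → IsEdge u v → (Vec.lookup s u ≡ true ⊎ Vec.lookup s v ≡ true) →
                    1 ≤ b u * adjacency u v + b v * adjacency u v
      charge-term v (k , e) (inj₁ h) rewrite e | h = s≤s z≤n
      charge-term v (k , e) (inj₂ h) rewrite e | h = m≤n+m 1 _
      go : ∀ {x} → Reflects (∃[ v ] IsEdge u v × (Vec.lookup s u ≡ true ⊎ Vec.lookup s v ≡ true)) x →
           (if x then 1 else 0) ≤ sumFin λ v → b u * adjacency u v + b v * adjacency u v
      go (ofʸ (v , e , h)) = ≤-trans (charge-term v e h)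
        (term≤sum (λ v → b u * adjacency u v + b v * adjacency u v) v)
      go (ofⁿ _) = z≤n

  weight≤maxWeight : ∀ u v → weight u v ≤ maxWeight
  weight≤maxWeight u v =
    ≤-trans (≤maxFin (weight u) v) (≤maxFin (λ u → maxFin (weight u)) u)

  graph-small : SmallGraph n (suc ⌈log₂ maxWeight ⌉) (graphData G)
  graph-small = ≤-reflexive (length-tabulate (rowData G)) , tabulate⁺ λ u →
    ≤-reflexive (length-tabulate (λ v → entry (edge u v))) , tabulate⁺ λ v k ks eq → small u v k ks eq
    where
    small : ∀ u v k ks → entry (edge u v) ≡ k ∷ ks → length k ≤ suc ⌈log₂ maxWeight ⌉
    small u v k ks eq with edge u v in e
    small u v k ks refl | just w = length-log (digits (fromℕ w))
      (≤-trans (≤-reflexive (trans (val-digits-fromℕ w) (sym (cong (fromMaybe 0) e)))) (weight≤maxWeight u v))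

  answer-optimal : ∀ {P V L} → (∀ v → V v ≡ true) → Complete G P V L →
    ∃[ S ] IsMinStableCut G S × eval answerᵉ ((tabulate V , L) , graphData G , tt) ≡ tabulate S
  answer-optimal {P} {V} {L} all-V complete =
    -- The existence of a stable cut guarantees that the search returns a cut, so the default `[]`
    -- in `answerᵉ` does not occur.
    let S₀ , S₀-stable = stableCut G
        C₀ , C₀∈ , C₀-candidate , _ = candidate S₀ S₀-stable
        D , Ds , e , _ = best-optimal [] [] (tabulate V) (graphData G) L L false C₀∈ C₀-candidate
        D-stable = λ v → locallyStable⁻ G D v (Reflects-true (valid-reflects (tabulate V) D (rowData G))
          (proj₂ (best-candidate [] [] (tabulate V) (graphData G) L L false e)) v (all-V′ v))
    in nth D , minStableCut G (nth D) D-stable (λ S S-stable →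
         let C , C∈ , C-candidate , C≤S = candidate S S-stable
             -- The winner is obtained anew for each `S`; it is always `D`, as both are the head of
             -- the same list.
             D′ , Ds′ , e′ , D′≤C = best-optimal [] [] (tabulate V) (graphData G) L L false C∈ C-candidate
         in ≤-trans (subst (λ D → totalCrossing G (nth D) ≤ totalCrossing G (nth C))
              (∷-injectiveˡ (trans (sym e′) e))
              (subst₂ _≤_ (cutCost≡ D′) (cutCost≡ C) D′≤C)) C≤S) ,
       trans (cong (λ l → eval resizeᵉ (graphData G , matchList l [] (λ C _ → C) , tt)) e)
             (resizeˡ-tabulate _ (rowData G) D)
    where
    all-V′ : ∀ v → nth (tabulate V) v ≡ true
    all-V′ v = trans (nth-tabulate V v) (all-V v)
    cutCost≡ : ∀ C → val (cutCost (tabulate V) C (graphData G)) ≡ totalCrossing G (nth C)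
    cutCost≡ C = trans (val-cutCost-graphData G V C) (sum-cong λ v → if-true (all-V v))
    candidate : ∀ S → Stable G S → ∃[ C ] C ∈ L × Candidate [] [] (tabulate V) (graphData G) C ×
                totalCrossing G (nth C) ≤ totalCrossing G S
    candidate S S-stable =
      let C , C∈ , _ , S₁-stable , S₁≤S = complete S S-stable
          S₁≗C = λ v → if-true {x = nth C v} {y = S v} (all-V v)
      in C , C∈ , (refl , true-Reflects (valid-reflects (tabulate V) C (rowData G)) λ v _ →
           locallyStable⁺ G C v (stableAt-cong G (overlay G V (nth C) S) (nth C) v
             (λ u _ → S₁≗C v , S₁≗C u) (S₁-stable v))) ,
         ≤-trans (≤-reflexive (totalCrossing-cong G (nth C) (overlay G V (nth C) S)
           (λ v u _ → sym (S₁≗C v) , sym (S₁≗C u)))) S₁≤S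

labels-All : ∀ {A : Set} {Q : A → Set} (t : Tree A) → All Q (labels t) → ∀ x → Q (label {t = t} x)
labels*-All : ∀ {A : Set} {Q : A → Set} (ts : List (Tree A)) → All Q (labels* ts) →
              ∀ i → All Q (labels (lookup ts i))
labels-All (node a ts) (q ∷ qs) root        = q
labels-All (node a ts) (q ∷ qs) (below i x) = labels-All (lookup ts i) (labels*-All ts qs i) x
labels*-All (t ∷ ts) qs zero    = ++⁻ˡ (labels t) qs
labels*-All (t ∷ ts) qs (suc i) = labels*-All ts (++⁻ʳ (labels t) qs) i

module _ {n : ℕ} {G : WeightedGraph n} (D : TreeDecomposition G) where
  open WeightedGraph G
  open TreeDecomposition D

  bag-size : All (λ s → ∣ s ∣ ≤ suc width) (labels tree)
  bag-size = All.map (λ h → ≤-trans h (m≤n+m∸n _ 1)) (All-map⁻ (xs≤max 0 (map ∣_∣ (labels tree))))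

  edge⇒width : ∀ {u v} → IsEdge u v → 1 ≤ width
  edge⇒width {u} {v} e =
    let x , hu , hv = coversEdges u v e
    in ≤-pred (≤-trans (two-elements (bag x) u v (u≢v e) ([]=⇒lookup hu) ([]=⇒lookup hv))
                       (labels-All tree bag-size x))
    where
    u≢v : ∀ {u v} → IsEdge u v → ¬ u ≡ v
    u≢v {u} (k , p) refl with () ← trans (sym (loopless u)) p

  -- If the width is at least 1, its successor is at most its double. If it is 0, no bag contains
  -- both ends of an edge, so there are no edges and both sides vanish. Together with the 2 in
  -- `popcount-boundary` this yields the factor 4 in the exponent.
  maxDegree-width : maxDegree * suc width ≤ 2 * (maxDegree * width)
  maxDegree-width with width in eq
  ... | suc w = ≤-trans (*-monoʳ-≤ maxDegree (s≤s (m≤n+m (suc w) w)))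
    (≤-reflexive (trans (cong (maxDegree *_) (lemma w)) (lemma′ maxDegree (suc w))))
    where
    lemma : ∀ w → suc (w + suc w) ≡ 2 * suc w
    lemma = solve-∀
    lemma′ : ∀ d w → d * (2 * w) ≡ 2 * (d * w)
    lemma′ = solve-∀
  ... | zero = ≤-trans (*-monoˡ-≤ 1 (maxFin≤ degree λ v → ≤-reflexive (degree-0 v))) z≤n
    where
    no-edge : ∀ u v → adjacency G u v ≡ 0
    no-edge u v with edge u v in e
    ... | nothing = refl
    ... | just k with () ← subst (1 ≤_) eq (edge⇒width (k , e))
    degree-0 : ∀ v → degree v ≡ 0
    degree-0 v = trans (sum-cong (no-edge v)) (sum-zero n)
      where
      sum-zero : ∀ n → sumFin {n} (λ _ → 0) ≡ 0
      sum-zero zero    = refl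
      sum-zero (suc n) = sum-zero n

  boundary-size : All (λ s → popcount (bagBoundary G s) ≤ 4 * (maxDegree * width)) (labels tree)
  boundary-size = All.map (λ {s} h → begin
    popcount (bagBoundary G s) ≤⟨ popcount-boundary G s ⟩
    2 * (∣ s ∣ * maxDegree) ≡⟨ cong (2 *_) (*-comm ∣ s ∣ maxDegree) ⟩
    2 * (maxDegree * ∣ s ∣) ≤⟨ *-monoʳ-≤ 2 (*-monoʳ-≤ maxDegree h) ⟩
    2 * (maxDegree * suc width) ≤⟨ *-monoʳ-≤ 2 maxDegree-width ⟩
    2 * (2 * (maxDegree * width)) ≡⟨ *-assoc 2 2 (maxDegree * width) ⟨
    4 * (maxDegree * width) ∎) bag-size
    where open ≤-Reasoning

open WeightedGraph using (maxDegree; maxWeight)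
open TreeDecomposition using (numNodes; width)

-- The solver

-- Variable 0 is the tree, variable 1 the function itself, variable 2 the graph.
solverBody : ∀ {m} → Term (3 + m)
solverBody = case (var 0F) nil (case (var 1F)
  (app (fun (compile leafᵉ)) (cons (var 0F) (cons (var 4F) nil)))
  (app (fun (compile joinᵉ))
    -- A tree is encoded as its bag in front of the list of its children, so
    -- `cons (var 2F) (var 1F)` encodes the same tree without its first child.
    (cons (app (var 5F) (cons (var 2F) (var 1F)))
      (cons (app (var 5F) (var 0F)) (cons (var 2F) (cons (var 6F) nil))))))

program : Program
program = case (var 0F) nil (app (fun (compile answerᵉ))
  (cons (app (fun solverBody) (var 1F)) (cons (var 0F) nil)))

module _ {n : ℕ} (G : WeightedGraph n) (M : ℕ) (size : Size n (suc ⌈log₂ maxWeight G ⌉) M) where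

  private
    gr : ⟦ graph ⟧
    gr = graphData G

  SmallBag : Subset n → Set
  SmallBag s = 2 ^ popcount (bagBoundary G s) ≤ M

  small-boundary : ∀ s → SmallBag s → SmallBoundary M (boundary gr (Vec.toList s))
  small-boundary s h = subst (SmallBoundary M) (sym (boundary-toList G s))
    (≤-trans (≤-reflexive (length-tabulate (bagBoundary G s))) (Size.n≤M size) ,
     ≤-trans (≤-reflexive (length-assignmentsˡ (tabulate (bagBoundary G s) , tt) (bagBoundary G s) false)) h)

  -- A join step applies 21 rules besides its recursive calls and `joinᵉ`; a leaf step applies only
  -- 11 besides `leafᵉ`.
  nodeBound : ℕ
  nodeBound = 21 + (leafBound M + joinBound M)

  length-solve-vertices : ∀ s ts → length (proj₁ (solve G s ts)) ≤ M
  length-solve-vertices s ts = ≤-trans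
    (≤-reflexive (trans (cong length (solve-vertices G s ts)) (length-tabulate (covers s ts)))) (Size.n≤M size)

  length-solve≤ : ∀ s ts → All SmallBag (labels (node s ts)) → length (proj₂ (solve G s ts)) ≤ M
  length-solve≤ s ts (h ∷ _) = ≤-trans (length-solve G s ts) h

  -- A tree with k nodes takes k leaf steps and k - 1 joins, hence the summand on the left.
  solver-⇓ : ∀ s (ts : Forest {n}) {m} {ρ : Vec Value m} → All SmallBag (labels (node s ts)) → ∃[ t ]
    (encodeTree (node s ts) ∷ closure (enc graph gr ∷ ρ) solverBody ∷ enc graph gr ∷ ρ
       ⊢ solverBody ⇓ enc piece (solve G s ts) ∣ t) ×
    t + nodeBound ≤ 2 * (length (labels (node s ts)) * nodeBound)
  solver-⇓ s [] {ρ = ρ} (small ∷ []) = _ ,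
    ⇓case-cons ⇓var (⇓case-nil ⇓var (⇓app ⇓fun (⇓cons ⇓var (⇓cons ⇓var ⇓nil))
      (compile-⇓ leafᵉ (Vec.toList s , gr , tt)))) , leaf≤
    where
    leaf≤ : 11 + cost leafᵉ (Vec.toList s , gr , tt) + nodeBound ≤ 2 * (1 * nodeBound)
    leaf≤ = ≤-trans (+-monoˡ-≤ nodeBound (+-mono-≤ {11} {21} (m≤m+n 11 10)
        (≤-trans (cost-leaf n _ size _ (graph-small G) (small-boundary s small)) (m≤m+n _ _))))
      (≤-reflexive (eq nodeBound))
      where
      eq : ∀ b → b + b ≡ 2 * (1 * b)
      eq = solve-∀
  solver-⇓ s (node s′ ts′ ∷ ts) {ρ = ρ} (small ∷ smalls) =
    let small₁ = small ∷ ++⁻ʳ (labels (node s′ ts′)) smalls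
        small₂ = ++⁻ˡ (labels (node s′ ts′)) smalls
        t₁ , d₁ , h₁ = solver-⇓ s ts small₁
        t₂ , d₂ , h₂ = solver-⇓ s′ ts′ small₂
    in _ ,
    ⇓case-cons ⇓var (⇓case-cons ⇓var (⇓app ⇓fun
      (⇓cons (⇓app ⇓var (⇓cons ⇓var ⇓var) d₁)
        (⇓cons (⇓app ⇓var ⇓var d₂) (⇓cons ⇓var (⇓cons ⇓var ⇓nil))))
      (compile-⇓ joinᵉ (solve G s ts , solve G s′ ts′ , Vec.toList s , gr , tt)))) ,
    join≤ t₁ t₂ h₁ h₂ (cost-join n _ size V₁ L₁ V₂ L₂ (Vec.toList s) {gr} (graph-small G) (small-boundary s small)
      (length-solve-vertices s ts) (length-solve-vertices s′ ts′)
      (length-solve≤ s ts small₁) (length-solve≤ s′ ts′ small₂))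
    where
    V₁ = proj₁ (solve G s ts)
    L₁ = proj₂ (solve G s ts)
    V₂ = proj₁ (solve G s′ ts′)
    L₂ = proj₂ (solve G s′ ts′)
    j = cost joinᵉ (solve G s ts , solve G s′ ts′ , Vec.toList s , gr , tt)
    k₁ = length (labels (node s ts))
    k₂ = length (labels (node s′ ts′))
    nodes : length (labels (node s (node s′ ts′ ∷ ts))) ≡ k₁ + k₂
    nodes = cong suc (trans (length-++ (labels (node s′ ts′))) (+-comm k₂ (length (labels* ts))))
    join≤ : ∀ t₁ t₂ → t₁ + nodeBound ≤ 2 * (k₁ * nodeBound) → t₂ + nodeBound ≤ 2 * (k₂ * nodeBound) →
      j ≤ joinBound M →
      4 + suc (suc (suc (suc (4 + t₁) + suc (suc (2 + t₂) + 5)) + j)) + nodeBound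
      ≤ 2 * (length (labels (node s (node s′ ts′ ∷ ts))) * nodeBound)
    join≤ t₁ t₂ h₁ h₂ h = begin
      4 + suc (suc (suc (suc (4 + t₁) + suc (suc (2 + t₂) + 5)) + j)) + nodeBound
        ≡⟨ eq₁ t₁ t₂ j nodeBound ⟩
      t₁ + t₂ + nodeBound + (21 + j)
        ≤⟨ +-monoʳ-≤ (t₁ + t₂ + nodeBound) (+-monoʳ-≤ 21 (m≤n⇒m≤o+n (leafBound M) h)) ⟩
      t₁ + t₂ + nodeBound + nodeBound ≡⟨ eq₂ t₁ t₂ nodeBound ⟩
      (t₁ + nodeBound) + (t₂ + nodeBound) ≤⟨ +-mono-≤ h₁ h₂ ⟩
      2 * (k₁ * nodeBound) + 2 * (k₂ * nodeBound) ≡⟨ eq₃ k₁ k₂ nodeBound ⟩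
      2 * ((k₁ + k₂) * nodeBound) ≡⟨ cong (λ k → 2 * (k * nodeBound)) nodes ⟨
      2 * (length (labels (node s (node s′ ts′ ∷ ts))) * nodeBound) ∎
      where
      open ≤-Reasoning
      eq₁ : ∀ t u j b → 4 + suc (suc (suc (suc (4 + t) + suc (suc (2 + u) + 5)) + j)) + b
                      ≡ t + u + b + (21 + j)
      eq₁ = solve-∀
      eq₂ : ∀ t u b → t + u + b + b ≡ (t + b) + (u + b)
      eq₂ = solve-∀
      eq₃ : ∀ k l b → 2 * (k * b) + 2 * (l * b) ≡ 2 * ((k + l) * b)
      eq₃ = solve-∀

  programBound : ℕ
  programBound = 2 * nodeBound + (11 + answerBound M)

  program-⇓ : ∀ s (ts : Forest {n}) → All SmallBag (labels (node s ts)) → ∃[ t ]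
    program on cons (enc graph gr) (encodeTree (node s ts))
      returns enc bits (eval answerᵉ (solve G s ts , gr , tt)) in-time t ×
    t ≤ length (labels (node s ts)) * programBound
  program-⇓ s ts small =
    let t , d , h = solver-⇓ s ts small
        L≤ = length-solve≤ s ts small
    in _ ,
    ⇓case-cons ⇓var (⇓app ⇓fun (⇓cons (⇓app ⇓fun ⇓var d) (⇓cons ⇓var ⇓nil))
      (compile-⇓ answerᵉ (solve G s ts , gr , tt))) ,
    time≤ t h (cost-answer n _ size (proj₁ (solve G s ts)) (proj₂ (solve G s ts)) (graph-small G)
      (≤-trans L≤ (≤-trans (≤-reflexive (sym (*-identityʳ M)))
        (≤-trans (*-monoʳ-≤ M 1≤M) ≤-refl))))
    where
    1≤M : 1 ≤ M
    1≤M = ≤-trans (m^n>0 2 (popcount (bagBoundary G s))) (All.head small)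
    a = cost answerᵉ (solve G s ts , gr , tt)
    k = length (labels* ts)
    time≤ : ∀ t → t + nodeBound ≤ 2 * (suc k * nodeBound) → a ≤ answerBound M →
      2 + suc (suc (suc (suc (2 + t) + 3) + a)) ≤ suc k * programBound
    time≤ t h h′ = begin
      2 + suc (suc (suc (suc (2 + t) + 3) + a)) ≡⟨ eq₁ t a ⟩
      t + (11 + a) ≤⟨ +-mono-≤ (≤-trans (m≤m+n t nodeBound) h) (+-monoʳ-≤ 11 h′) ⟩
      2 * (suc k * nodeBound) + (11 + answerBound M) ≤⟨ m≤m+n _ (k * (11 + answerBound M)) ⟩
      2 * (suc k * nodeBound) + (11 + answerBound M) + k * (11 + answerBound M)
        ≡⟨ eq₂ k nodeBound (11 + answerBound M) ⟩
      suc k * programBound ∎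
      where
      open ≤-Reasoning
      eq₁ : ∀ t a → 2 + suc (suc (suc (suc (2 + t) + 3) + a)) ≡ t + (11 + a)
      eq₁ = solve-∀
      eq₂ : ∀ k b c → 2 * (suc k * b) + c + k * c ≡ suc k * (2 * b + c)
      eq₂ = solve-∀

-- The final estimate

poly-programBound : Polynomial (λ M → 2 * (21 + (leafBound M + joinBound M)) + (11 + answerBound M))
poly-programBound = poly-+
  (poly-* (poly-const 2) (poly-+ (poly-const 21) (poly-+ poly-leafBound poly-joinBound)))
  (poly-+ (poly-const 11) poly-answerBound)

boundDegree : ℕ
boundDegree = proj₁ poly-programBound

^-distribʳ-* : ∀ k m n → (m * n) ^ k ≡ m ^ k * n ^ k
^-distribʳ-* zero    m n = refl
^-distribʳ-* (suc k) m n = trans (cong (m * n *_) (^-distribʳ-* k m n)) (eq m n (m ^ k) (n ^ k))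
  where
  eq : ∀ m n x y → m * n * (x * y) ≡ m * x * (n * y)
  eq = solve-∀

module _ (n L e : ℕ) where

  private
    x y N K M : ℕ
    x = 1 + n + L
    y = suc x
    N = y ^ 3
    K = 2 ^ (4 * e)
    M = N * K

  1≤K : 1 ≤ K
  1≤K = m^n>0 2 (4 * e)

  1≤N : 1 ≤ N
  1≤N = m^n>0 y 3

  N≤M : N ≤ M
  N≤M = ≤-trans (≤-reflexive (sym (*-identityʳ N))) (*-monoʳ-≤ N 1≤K)

  K≤M : K ≤ M
  K≤M = ≤-trans (≤-reflexive (sym (+-identityʳ K))) (*-monoˡ-≤ K 1≤N)

  size-M : Size n (suc L) M
  size-M = record
    { n≤M   = le (≤-trans n≤y y≤N)
    ; ℓ≤M   = le (≤-trans ℓ≤y y≤N)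
    ; nℓ≤M  = le (≤-trans (*-mono-≤ n≤y ℓ≤y) (≤-trans (m≤m*n (y * y) y) (≤-reflexive (eq y))))
    ; nnℓ≤M = le (≤-trans (*-mono-≤ n≤y (*-mono-≤ n≤y ℓ≤y)) (≤-reflexive (eq′ y)))
    }
    where
    le : ∀ {k} → k ≤ N → k ≤ M
    le h = ≤-trans h N≤M
    n≤y : n ≤ y
    n≤y = m≤n⇒m≤o+n 2 (m≤m+n n L)
    ℓ≤y : suc L ≤ y
    ℓ≤y = s≤s (m≤n⇒m≤1+n (m≤n+m L n))
    eq : ∀ y → y * y * y ≡ y * (y * (y * 1))
    eq = solve-∀
    eq′ : ∀ y → y * (y * y) ≡ y * (y * (y * 1))
    eq′ = solve-∀
    y≤N : y ≤ N
    y≤N = ≤-trans (m≤m*n y y) (≤-trans (m≤m*n (y * y) y) (≤-reflexive (eq y)))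

  -- `M` is built on `y = suc x`, the claim on `x`. Since `x` is at least 1, `y ≤ 2 * x`, at the
  -- price of `8 ^ c`. The power of 2 in `M` gives the exponent `4 * c * e`, linear in `e`.
  bound-M : ∀ c → c * M ^ c ≤ 2 ^ (4 * c * e) * (c * 8 ^ c * x ^ (3 * c))
  bound-M c = begin
    c * M ^ c ≡⟨ cong (c *_) (^-distribʳ-* c N K) ⟩
    c * (N ^ c * K ^ c) ≤⟨ *-monoʳ-≤ c (*-mono-≤ N^c≤ (≤-reflexive K^c≡)) ⟩
    c * (8 ^ c * x ^ (3 * c) * 2 ^ (4 * c * e)) ≡⟨ eq c (8 ^ c) (x ^ (3 * c)) (2 ^ (4 * c * e)) ⟩
    2 ^ (4 * c * e) * (c * 8 ^ c * x ^ (3 * c)) ∎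
    where
    open ≤-Reasoning
    eq : ∀ c e x k → c * (e * x * k) ≡ k * (c * e * x)
    eq = solve-∀
    cube : ∀ x → 2 * x * (2 * x * (2 * x * 1)) ≡ 8 * (x * (x * (x * 1)))
    cube = solve-∀
    y≤2x : y ≤ 2 * x
    y≤2x = +-mono-≤ {1} {x} (s≤s z≤n) (≤-reflexive (sym (+-identityʳ x)))
    N^c≤ : N ^ c ≤ 8 ^ c * x ^ (3 * c)
    N^c≤ = begin
      N ^ c ≤⟨ ^-monoˡ-≤ c (≤-trans (^-monoˡ-≤ 3 y≤2x) (≤-reflexive (cube x))) ⟩
      (8 * x ^ 3) ^ c ≡⟨ ^-distribʳ-* c 8 (x ^ 3) ⟩
      8 ^ c * (x ^ 3) ^ c ≡⟨ cong (8 ^ c *_) (^-*-assoc x 3 c) ⟩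
      8 ^ c * x ^ (3 * c) ∎
    K^c≡ : K ^ c ≡ 2 ^ (4 * c * e)
    K^c≡ = trans (^-*-assoc 2 (4 * e) c) (cong (2 ^_) (swap e c))
      where
      swap : ∀ e c → 4 * e * c ≡ 4 * c * e
      swap = solve-∀

  -- The constant `b` is the sum of the coefficient and the exponent of the product, so it dominates
  -- both.
  total-bound : ∀ c d k u → k ≤ d * suc n ^ d → u ≤ c * M ^ c →
    let b = d * (c * 8 ^ c) + (d + 3 * c) in
    k * u ≤ 2 ^ (4 * c * e) * (b * x ^ b)
  total-bound c d k u hk hu = begin
    k * u ≤⟨ *-mono-≤ (≤-trans hk (*-monoʳ-≤ d (^-monoˡ-≤ d (s≤s (m≤m+n n L)))))
                      (≤-trans hu (bound-M c)) ⟩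
    (d * x ^ d) * (P * (c * 8 ^ c * x ^ (3 * c)))
      ≡⟨ eq d (x ^ d) P (c * 8 ^ c) (x ^ (3 * c)) ⟩
    P * (d * (c * 8 ^ c) * (x ^ d * x ^ (3 * c)))
      ≡⟨ cong (λ z → P * (d * (c * 8 ^ c) * z)) (^-distribˡ-+-* x d (3 * c)) ⟨
    P * (d * (c * 8 ^ c) * x ^ (d + 3 * c))
      ≤⟨ *-monoʳ-≤ P (*-mono-≤ (m≤m+n (d * (c * 8 ^ c)) (d + 3 * c))
           (^-monoʳ-≤ x (m≤n+m (d + 3 * c) (d * (c * 8 ^ c))))) ⟩
    P * (b * x ^ b) ∎
    where
    open ≤-Reasoning
    P = 2 ^ (4 * c * e)
    b = d * (c * 8 ^ c) + (d + 3 * c)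
    eq : ∀ d y p c z → (d * y) * (p * (c * z)) ≡ p * (d * c * (y * z))
    eq = solve-∀

connected-bags : ∀ {n} {G : WeightedGraph n} (D : TreeDecomposition G) →
                 Connected (TreeDecomposition.tree D)
connected-bags D v x y hx hy = EqClosure-bind id
  (λ (c , hx , hy) → fwd (c , []=⇒lookup hx , []=⇒lookup hy) ◅ ε)
  (TreeDecomposition.connected D v x y (lookup⇒[]= v _ hx) (lookup⇒[]= v _ hy))

-- Even for a fixed graph and width a tree decomposition can have arbitrarily many nodes, all part
-- of the input, so a polynomial bound on their number is assumed. The program and the constant `a`
-- in the exponent are the same for all `d`; only `b` depends on it.
theorem7 : Σ Program λ p → ∃[ a ] ∀ (d : ℕ) → ∃[ b ]
    ∀ {n} (G : WeightedGraph n) (D : TreeDecomposition G) →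
    numNodes D ≤ d * suc n ^ d →
    ∃[ S ] ∃[ t ]
    ( p on encodeInstance G D returns encodeCut S in-time t
    × IsMinStableCut G S
    × t ≤ 2 ^ (a * (maxDegree G * width D)) * (b * (1 + n + ⌈log₂ maxWeight G ⌉) ^ b) )
theorem7 = program , 4 * c , λ d → d * (c * 8 ^ c) + (d + 3 * c) , λ G D → solution d G D
  where
  c = boundDegree
  solution : ∀ d {n} (G : WeightedGraph n) (D : TreeDecomposition G) →
    let b = d * (c * 8 ^ c) + (d + 3 * c) in
    numNodes D ≤ d * suc n ^ d →
    ∃[ S ] ∃[ t ]
    ( program on encodeInstance G D returns encodeCut S in-time t
    × IsMinStableCut G S
    × t ≤ 2 ^ (4 * c * (maxDegree G * width D)) * (b * (1 + n + ⌈log₂ maxWeight G ⌉) ^ b) )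
  solution d {n} G D@record { tree = node s ts } few =
    let L = ⌈log₂ maxWeight G ⌉
        e = maxDegree G * width D
        M = suc (1 + n + L) ^ 3 * 2 ^ (4 * e)
        size = size-M n L e
        small = All.map (λ h → ≤-trans (^-monoʳ-≤ 2 h) (K≤M n L e)) (boundary-size D)
        t , run , t≤ = program-⇓ G M size s ts small
        context = record
          { edges = λ u v uv → let x , hu , hv = TreeDecomposition.coversEdges D u v uv
                               in inj₁ (x , []=⇒lookup hu , []=⇒lookup hv)
          ; outside = λ u v () }
        complete = solve-complete G s ts {O = λ _ _ → ⊥} (separated s ts (connected-bags D)) context
        all-covered = λ v → let x , h = TreeDecomposition.coversVertices D v
                            in covers⁺ s ts v x ([]=⇒lookup h)
        S , optimal , answer≡ = answer-optimal G all-covered complete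
    in S , t ,
       subst₂ (λ i o → program on i returns o in-time t)
         (cong (λ g → cons g (encodeTree (node s ts))) (enc-graphData G))
         (trans (cong (enc bits) (trans
           (cong (λ V → eval answerᵉ ((V , proj₂ (solve G s ts)) , graphData G , tt)) (solve-vertices G s ts))
           answer≡)) (cong encodeList (map-tabulate S encodeBool)))
         run ,
       optimal ,
       ≤-trans t≤ (total-bound n L e c d (numNodes D) (programBound G M size) few
         (proj₂ poly-programBound M (≤-trans (1≤K n L e) (K≤M n L e))))
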